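{- Let $r \ge 2$, and set $\delta = 2^{ -160} r^{ -12}$. Then $$R_r(k) \le e^{ -\delta k} r^{rk}$$ for every $k \in \mathbb{N}$ with $k \ge 2^{160} r^{16}$.
   Context: For $r,k \in \mathbb{N}$, $R_r(k)$ is the minimum $n \in \mathbb{N}$ such that every colouring of the edges of the complete graph $K_n$ with $r$ colours contains a monochromatic copy of $K_k$. -}

module Defs where

open import Data.Nat as ℕ using (ℕ; zero; suc; _^_; _<_; _≤_; s≤s; z≤n)
open import Data.Nat.Properties using (≤-trans; m^n≢0; m*n≢0)
open import Data.Fin using (Fin; toℕ)
open import Data.Integer using (+_)
open import Data.Rational using (ℚ; _/_; _+_; _*_; 0ℚ; 1ℚ)
open import Data.Product using (Σ; ∃; _×_)
open import Relation.Binary.PropositionalEquality using (_≡_)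

-- An r-colouring of the edges of K_n: the colour of the edge {i,j} with
-- toℕ i < toℕ j is c i j (values of c i j with toℕ i ≥ toℕ j are ignored).
Colouring : ℕ → ℕ → Set
Colouring r n = Fin n → Fin n → Fin r

HasMonoClique : ∀ {r n} → ℕ → Colouring r n → Set
HasMonoClique {r} {n} k c =
  Σ (Fin k → Fin n) λ f → Σ (Fin r) λ col →
    (∀ (a b : Fin k) → toℕ a < toℕ b → toℕ (f a) < toℕ (f b))
    × (∀ (a b : Fin k) → toℕ a < toℕ b → c (f a) (f b) ≡ col)

-- n has the Ramsey property for (r, k): every r-colouring of E(K_n)
-- contains a monochromatic K_k.  R_r(k) is the least such n.
RamseyProp : ℕ → ℕ → ℕ → Set
RamseyProp r k n = (c : Colouring r n) → HasMonoClique k c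

expTerm : ℚ → ℕ → ℚ
expTerm x zero    = 1ℚ
expTerm x (suc i) = expTerm x i * (x * ((+ 1) / suc i))

expPartial : ℚ → ℕ → ℚ
expPartial x zero    = 0ℚ
expPartial x (suc N) = expPartial x N + expTerm x N

δk : (r k : ℕ) → 2 ≤ r → ℚ
δk (suc r') k _ = _/_ (+ k) (2 ^ 160 ℕ.* suc r' ^ 12)
  {{m*n≢0 (2 ^ 160) (suc r' ^ 12) {{m^n≢0 2 160}} {{m^n≢0 (suc r') 12}}}}
δk zero k ()

{-# OPTIONS --safe #-}

-- If some vertex sees a colour with density noticeably below 1/r, then it sees another colour with density
-- noticeably above 1/r, and passing to that neighbourhood gains over the Erdős–Szekeres step. After enough such
-- steps the bound holds; otherwise one reaches a set W in which all colours have density almost 1/r everywhere.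
-- There the book algorithm, started from X = Y₁ = … = Y_r = W, finds a monochromatic clique of size t = Ω(k)
-- in some colour j, joined in colour j to a set Y of size almost r^{-t} |W|. In Y only k - t further vertices of
-- colour j are needed, and an Erdős–Szekeres argument with weights skewed in favour of the other colours gains
-- a factor exponential in t²/k over the balanced bound.
--
-- Each step of the algorithm comes from positive definiteness: for each colour i, the deviation of
-- |N_i(x) ∩ N_i(x') ∩ Y_i| from its expected value is a positive definite kernel in x, x'. A polynomial with
-- non-negative coefficients in such kernels has non-negative average. Using Chebyshev polynomials, one is chosen
-- that is negative as soon as one kernel is very negative and that grows only like exp √z. Hence either many pairs
-- have no very negative kernel, and x extends the clique of its majority colour at a small cost in density, or for
-- some i many pairs have kernel z ≥ 4^i, and restricting to them boosts the density of one colour.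
module Submission where

-- The book gains only about t²/k bits, so all losses together must stay below that. A colour step
-- shrinks `Y` by (1 - O(1/Z))/r, harmless once Z is a large multiple of k/t. A boost shrinks one
-- `Y` by about 1/r without lengthening its clique, so boosts must be rare, fewer than t²/(k log r).
-- Hence kernels up to 4^i₀ do not count as boosts: every real boost uses up at least 4^i₀ of an
-- allowance of order r t log(rZ) per colour, beyond which a density would exceed 1. The price falls
-- on `X`: a colour step costs it about r 2^i₀ bits, up to rt such steps may occur, and only about
-- rk bits are available, which forces t to be of order k/(r 2^i₀). Reconciling the two demands
-- makes 2^i₀ of order r³, t of order k/r⁴ and the gain of order k/r⁸. Balancing costs one more
-- factor r, so the argument needs δ of order r^-9 and leaves room in r^-12.
--
-- `X` may shrink by large factors but `Y` may not, so every vertex must start with density at least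
-- (1 - 1/Z)/r in every colour; this is the reason for balancing.
--
-- Losses are measured in bits with denominators cleared. Partial cliques are never stored:
-- continuations into a fixed `Goal` extend whatever clique is found later.

module Powers where

  open import Data.Nat using (ℕ; zero; suc; _+_; _*_; _^_; _<_; z≤n; s≤s)
  open import Data.Nat.Properties
  open import Data.Nat.Tactic.RingSolver using (solve-∀)
  open import Relation.Binary.PropositionalEquality

  m<2^m : ∀ m → m < 2 ^ m
  m<2^m zero    = s≤s z≤n
  m<2^m (suc m) = +-mono-≤ (m^n>0 2 m) (≤-trans (m<2^m m) (m≤m+n (2 ^ m) 0))

  ^-*-distrib : ∀ a b m → (a * b) ^ m ≡ a ^ m * b ^ m
  ^-*-distrib a b zero    = refl
  ^-*-distrib a b (suc m) = trans (cong (a * b *_) (^-*-distrib a b m)) (interchange a b (a ^ m) (b ^ m))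
    where
    interchange : ∀ a b x y → a * b * (x * y) ≡ a * x * (b * y)
    interchange = solve-∀

  4^≡2^*2^ : ∀ i → 4 ^ i ≡ 2 ^ i * 2 ^ i
  4^≡2^*2^ = ^-*-distrib 2 2

-- Finite sums and the sizes of decidable vertex sets.

module Counting where

  open import Data.Bool using (Bool; true; false; _∧_; _∨_)
  open import Data.Fin using (Fin; zero; suc; toℕ; _≟_)
  open import Data.Nat using (ℕ; zero; suc; _+_; _*_; _≤_; _<_; z≤n; s≤s; _<?_)
  open import Data.Nat.Properties hiding (_≟_)
  open import Data.Product using (Σ; ∃; _×_; _,_)
  open import Data.Vec.Functional using (updateAt)
  open import Function using (_∘_; const)
  open import Relation.Binary.PropositionalEquality
  open import Relation.Nullary using (Dec; yes; no; does; ¬_; contradiction)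
  open import Data.Sum using (_⊎_; inj₁; inj₂)
  open import Data.Bool.Properties using (∨-zeroʳ)
  open import Algebra.Properties.Semiring.Sum +-*-semiring public
    using (sum; sum-cong-≗; ∑-distrib-+; ∑-comm; *-distribˡ-sum; *-distribʳ-sum)

  Subset : ℕ → Set
  Subset n = Fin n → Bool

  𝟙 : Bool → ℕ
  𝟙 true  = 1
  𝟙 false = 0

  𝟙≤1 : ∀ b → 𝟙 b ≤ 1
  𝟙≤1 true  = ≤-refl
  𝟙≤1 false = z≤n

  count : ∀ {n} → Subset n → ℕ
  count S = sum (𝟙 ∘ S)

  -- A record rather than the bare equation, so that `x` and `S` can be recovered from a membership
  -- proof even when `S x` computes.
  record _∈_ {n} (x : Fin n) (S : Subset n) : Set where
    constructor mem
    field holds : S x ≡ true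

  _⊆_ : ∀ {n} → Subset n → Subset n → Set
  S ⊆ S' = ∀ x → x ∈ S → x ∈ S'

  _∩_ _∪_ : ∀ {n} → Subset n → Subset n → Subset n
  (S ∩ S') x = S x ∧ S' x
  (S ∪ S') x = S x ∨ S' x

  ⁅_⁆ : ∀ {n} → Fin n → Subset n
  ⁅ v ⁆ x = does (x ≟ v)

  ∩-intro : ∀ {n} {S S' : Subset n} {x} → x ∈ S → x ∈ S' → x ∈ (S ∩ S')
  ∩-intro (mem p) (mem q) = mem (cong₂ _∧_ p q)

  ∩-left : ∀ {n} {S S' : Subset n} {x} → x ∈ (S ∩ S') → x ∈ S
  ∩-left {S = S} {x = x} (mem p) with S x in eq
  ... | true  = mem eq

  ∩-right : ∀ {n} {S S' : Subset n} {x} → x ∈ (S ∩ S') → x ∈ S'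
  ∩-right {S = S} {x = x} (mem p) with S x
  ... | true  = mem p

  ∪-left : ∀ {n} {S S' : Subset n} {x} → x ∈ S → x ∈ (S ∪ S')
  ∪-left {S' = S'} {x} (mem p) = mem (cong (_∨ S' x) p)

  ∪-right : ∀ {n} {S S' : Subset n} {x} → x ∈ S' → x ∈ (S ∪ S')
  ∪-right {S = S} {x = x} (mem p) = mem (trans (cong (S x ∨_) p) (∨-zeroʳ (S x)))

  ∪-elim : ∀ {n} {S S' : Subset n} {x} → x ∈ (S ∪ S') → x ∈ S ⊎ x ∈ S'
  ∪-elim {S = S} {x = x} (mem p) with S x in eq
  ... | true  = inj₁ (mem eq)
  ... | false = inj₂ (mem p)

  ∪-least : ∀ {n} {S S' T : Subset n} → S ⊆ T → S' ⊆ T → (S ∪ S') ⊆ T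
  ∪-least S⊆T S'⊆T x x∈ with ∪-elim x∈
  ... | inj₁ x∈S  = S⊆T x x∈S
  ... | inj₂ x∈S' = S'⊆T x x∈S'

  ∪-mono : ∀ {n} {S S' T T' : Subset n} → S ⊆ T → S' ⊆ T' → (S ∪ S') ⊆ (T ∪ T')
  ∪-mono {T = T} {T'} S⊆T S'⊆T' = ∪-least (λ x x∈S → ∪-left {S' = T'} (S⊆T x x∈S)) (λ x x∈S' → ∪-right {S = T} (S'⊆T' x x∈S'))

  ∈⁅⁆ : ∀ {n} {v x : Fin n} → x ∈ ⁅ v ⁆ → x ≡ v
  ∈⁅⁆ {v = v} {x} (mem p) with x ≟ v
  ... | yes eq = eq

  _∈?_ : ∀ {n} (x : Fin n) (S : Subset n) → Dec (x ∈ S)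
  x ∈? S with S x in eq
  ... | true  = yes (mem eq)
  ... | false = no λ (mem p) → contradiction (trans (sym eq) p) λ ()

  ∉⇒false : ∀ {n} {x : Fin n} {S : Subset n} → ¬ (x ∈ S) → S x ≡ false
  ∉⇒false {x = x} {S} x∉S with S x in eq
  ... | true  = contradiction (mem eq) x∉S
  ... | false = refl

  ⊆-trans : ∀ {n} {S S' S″ : Subset n} → S ⊆ S' → S' ⊆ S″ → S ⊆ S″
  ⊆-trans p q x x∈S = q x (p x x∈S)

  sum-mono : ∀ {n} {f g : Fin n → ℕ} → (∀ i → f i ≤ g i) → sum f ≤ sum g
  sum-mono {zero}  f≤g = z≤n
  sum-mono {suc n} f≤g = +-mono-≤ (f≤g zero) (sum-mono (f≤g ∘ suc))

  sum-const : ∀ n c → sum {n} (λ _ → c) ≡ n * c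
  sum-const zero    c = refl
  sum-const (suc n) c = cong (c +_) (sum-const n c)

  ≤-sum : ∀ {n} (f : Fin n → ℕ) i → f i ≤ sum f
  ≤-sum f zero    = m≤m+n _ _
  ≤-sum f (suc i) = ≤-trans (≤-sum (f ∘ suc) i) (m≤n+m _ _)

  sum-updateAt : ∀ {n} (f : Fin n → ℕ) i (h : ℕ → ℕ) →
    sum (updateAt f i h) + f i ≡ sum f + h (f i)
  sum-updateAt f zero h = begin
    h (f zero) + s + f zero ≡⟨ +-comm (h (f zero) + s) (f zero) ⟩
    f zero + (h (f zero) + s) ≡⟨ cong (f zero +_) (+-comm (h (f zero)) s) ⟩
    f zero + (s + h (f zero)) ≡⟨ sym (+-assoc (f zero) s _) ⟩
    f zero + s + h (f zero) ∎
    where open ≡-Reasoning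
          s = sum (f ∘ suc)
  sum-updateAt f (suc i) h = begin
    f zero + s' + f (suc i) ≡⟨ +-assoc (f zero) s' _ ⟩
    f zero + (s' + f (suc i)) ≡⟨ cong (f zero +_) (sum-updateAt (f ∘ suc) i h) ⟩
    f zero + (s + h (f (suc i))) ≡⟨ sym (+-assoc (f zero) s _) ⟩
    f zero + s + h (f (suc i)) ∎
    where open ≡-Reasoning
          s  = sum (f ∘ suc)
          s' = sum (updateAt (f ∘ suc) i h)

  -- The averaging principle used throughout. The thresholds `g i` may differ, so weighted averages
  -- and a lowered threshold for one colour are instances.
  pigeonhole : ∀ {n} (g f : Fin n → ℕ) → sum g < sum f → ∃ λ i → g i < f i
  pigeonhole {suc n} g f lt with g zero <? f zero
  ... | yes p = zero , p
  ... | no ¬p with pigeonhole (g ∘ suc) (f ∘ suc)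
                     (+-cancelˡ-< (f zero) _ _ (≤-<-trans (+-monoˡ-≤ _ (≮⇒≥ ¬p)) lt))
  ...   | i , q = suc i , q

  count-mono : ∀ {n} {S S' : Subset n} → S ⊆ S' → count S ≤ count S'
  count-mono {S = S} {S'} S⊆S' = sum-mono λ x → pt x λ p → _∈_.holds (S⊆S' x (mem p))
    where
    pt : ∀ x → (S x ≡ true → S' x ≡ true) → 𝟙 (S x) ≤ 𝟙 (S' x)
    pt x imp with S x
    ... | false = z≤n
    ... | true rewrite imp refl = ≤-refl

  inhabited : ∀ {n} (S : Subset n) → 0 < count S → ∃ λ x → x ∈ S
  inhabited {n} S pos
    with pigeonhole (const 0) (𝟙 ∘ S) (subst (_< count S) (sym (trans (sum-const n 0) (*-zeroʳ n))) pos)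
  ... | x , q = x , mem (true! (S x) q)
    where
    true! : ∀ b → 0 < 𝟙 b → b ≡ true
    true! true _ = refl

  count-full : ∀ n → count {n} (λ _ → true) ≡ n
  count-full n = trans (sum-const n 1) (*-identityʳ n)

  count-⁅⁆ : ∀ {n} (v : Fin n) → count ⁅ v ⁆ ≡ 1
  count-⁅⁆ {suc n} zero    = cong suc (trans (sum-const n 0) (*-zeroʳ n))
  count-⁅⁆ {suc n} (suc v) = trans (sum-cong-≗ same) (count-⁅⁆ v)
    where
    same : ∀ x → 𝟙 (⁅ suc v ⁆ (suc x)) ≡ 𝟙 (⁅ v ⁆ x)
    same x with x ≟ v
    ... | yes _ = refl
    ... | no _  = refl

  count-insert : ∀ {n} (S : Subset n) {v} → ¬ (v ∈ S) → suc (count S) ≤ count (⁅ v ⁆ ∪ S)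
  count-insert S {v} v∉S = begin
    suc (count S) ≡⟨ cong (_+ count S) (sym (count-⁅⁆ v)) ⟩
    count ⁅ v ⁆ + count S ≡⟨ sym (∑-distrib-+ (𝟙 ∘ ⁅ v ⁆) (𝟙 ∘ S)) ⟩
    sum (λ x → 𝟙 (⁅ v ⁆ x) + 𝟙 (S x)) ≤⟨ sum-mono pt ⟩
    count (⁅ v ⁆ ∪ S) ∎
    where
    open ≤-Reasoning
    pt : ∀ x → 𝟙 (⁅ v ⁆ x) + 𝟙 (S x) ≤ 𝟙 ((⁅ v ⁆ ∪ S) x)
    pt x with x ≟ v | S x in eq
    ... | yes refl | true  = contradiction (mem eq) v∉S
    ... | yes refl | false = ≤-refl
    ... | no _     | _     = ≤-refl

  -- Double counting of pairs (vertex, set containing it). The `suc` pays for `v`, which has no edge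
  -- to itself.
  count-cover : ∀ {n r} (S : Subset n) (v : Fin n) (N : Fin r → Subset n) →
    (∀ x → ¬ x ≡ v → ∃ λ j → x ∈ N j) → count S ≤ suc (sum λ j → count (N j ∩ S))
  count-cover S v N cover = begin
    count S ≤⟨ sum-mono pt ⟩
    sum (λ x → 𝟙 (⁅ v ⁆ x) + sum (λ j → 𝟙 ((N j ∩ S) x))) ≡⟨ ∑-distrib-+ (𝟙 ∘ ⁅ v ⁆) _ ⟩
    count ⁅ v ⁆ + sum (λ x → sum (λ j → 𝟙 ((N j ∩ S) x)))
      ≡⟨ cong₂ _+_ (count-⁅⁆ v) (∑-comm (λ x j → 𝟙 ((N j ∩ S) x))) ⟩
    suc (sum λ j → count (N j ∩ S)) ∎
    where
    open ≤-Reasoning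
    pt : ∀ x → 𝟙 (S x) ≤ 𝟙 (⁅ v ⁆ x) + sum (λ j → 𝟙 ((N j ∩ S) x))
    pt x with x ∈? S
    ... | no x∉S = ≤-trans (≤-reflexive (cong 𝟙 (∉⇒false x∉S))) z≤n
    ... | yes x∈S with x ≟ v
    ...   | yes _  = ≤-trans (𝟙≤1 (S x)) (s≤s z≤n)
    ...   | no x≢v with cover x x≢v
    ...     | j , x∈N = ≤-trans (≤-trans (𝟙≤1 (S x)) (≤-reflexive (sym (cong 𝟙 (_∈_.holds (∩-intro x∈N x∈S))))))
                                (≤-sum (λ j → 𝟙 ((N j ∩ S) x)) j)

  trim : ∀ {n} (S : Subset n) d → d ≤ count S → ∃ λ S' → S' ⊆ S × count S' ≡ d
  trim {n} S zero d≤ = (λ _ → false) , (λ { _ (mem ()) }) , trans (sum-const n 0) (*-zeroʳ n)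
  trim {suc n} S (suc d) d≤ with S zero in eq
  ... | false with trim (S ∘ suc) (suc d) d≤
  ...   | S' , S'⊆S , c = S″ , S″⊆S , c
    where
    S″ : Subset (suc n)
    S″ zero    = false
    S″ (suc x) = S' x
    S″⊆S : S″ ⊆ S
    S″⊆S (suc x) (mem p) = mem (_∈_.holds (S'⊆S x (mem p)))
  trim {suc n} S (suc d) (s≤s d≤) | true with trim (S ∘ suc) d d≤
  ...   | S' , S'⊆S , c = S″ , S″⊆S , cong suc c
    where
    S″ : Subset (suc n)
    S″ zero    = true
    S″ (suc x) = S' x
    S″⊆S : S″ ⊆ S
    S″⊆S zero    _       = mem eq
    S″⊆S (suc x) (mem p) = mem (_∈_.holds (S'⊆S x (mem p)))

  -- `HasMonoClique` asks for an embedding that preserves the order of the vertices, so a clique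
  -- found as a set is listed increasingly.
  enumerate : ∀ {n} (S : Subset n) k → k ≤ count S →
    Σ (Fin k → Fin n) λ e → (∀ a b → toℕ a < toℕ b → toℕ (e a) < toℕ (e b)) × (∀ a → e a ∈ S)
  enumerate S zero k≤ = (λ ()) , (λ ()) , (λ ())
  enumerate {suc n} S (suc k) k≤ with S zero in eq
  ... | false with enumerate (S ∘ suc) (suc k) k≤
  ...   | e , mono , e∈ = suc ∘ e , (λ a b lt → s≤s (mono a b lt)) , λ a → mem (_∈_.holds (e∈ a))
  enumerate {suc n} S (suc k) (s≤s k≤) | true with enumerate (S ∘ suc) k k≤
  ...   | e , mono , e∈ = e' , mono' , e'∈
    where
    e' : Fin (suc k) → Fin (suc n)
    e' zero    = zero
    e' (suc a) = suc (e a)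
    mono' : ∀ a b → toℕ a < toℕ b → toℕ (e' a) < toℕ (e' b)
    mono' zero    (suc b) _        = s≤s z≤n
    mono' (suc a) (suc b) (s≤s lt) = s≤s (mono a b lt)
    e'∈ : ∀ a → e' a ∈ S
    e'∈ zero    = mem eq
    e'∈ (suc a) = mem (_∈_.holds (e∈ a))

-- Cliques as vertex sets, and the translation from `Colouring`.

module Cliques where

  open import Defs
  open Counting
  open import Data.Bool using (false; _∧_; not)
  open import Data.Fin using (Fin; toℕ; _≟_)
  open import Data.Fin.Properties using (toℕ-injective)
  open import Data.Nat using (ℕ; suc; _≤_; _<_; z≤n; s≤s; _<?_)
  open import Data.Nat.Properties hiding (_≟_)
  open import Data.Product using (∃; _×_; _,_)
  open import Relation.Binary.PropositionalEquality
  open import Relation.Nullary using (yes; no; does; ¬_; contradiction)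
  open import Relation.Nullary.Decidable using (dec-true; dec-false)
  open import Data.Sum using (inj₁; inj₂)

  -- A colouring seen as a cover of the edges by `r` symmetric irreflexive relations; every degree
  -- estimate comes from this cover.
  record EdgeColouring (n r : ℕ) : Set where
    field
      N      : Fin r → Fin n → Subset n
      irrefl : ∀ {i x} → ¬ (x ∈ N i x)
      symm   : ∀ {i x y} → y ∈ N i x → x ∈ N i y
      cover  : ∀ x y → ¬ y ≡ x → ∃ λ i → y ∈ N i x

  module _ {n r : ℕ} (E : EdgeColouring n r) where
    open EdgeColouring E

    Clique : Fin r → ℕ → Subset n → Set
    Clique i m S = ∃ λ C → C ⊆ S × (∀ x y → x ∈ C → y ∈ C → ¬ x ≡ y → y ∈ N i x) × m ≤ count C

    clique-empty : ∀ {i S} → Clique i 0 S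
    clique-empty = (λ _ → false) , (λ { _ (mem ()) }) , (λ { _ _ (mem ()) }) , z≤n

    clique-⊆ : ∀ {i m S S'} → S ⊆ S' → Clique i m S → Clique i m S'
    clique-⊆ S⊆S' (C , C⊆S , mono , m≤) = C , (λ x x∈C → S⊆S' x (C⊆S x x∈C)) , mono , m≤

    clique-insert : ∀ {i m S S' v} → v ∈ S → S' ⊆ S → S' ⊆ N i v → Clique i m S' → Clique i (suc m) S
    clique-insert {i} {m} {S} {S'} {v} v∈S S'⊆S S'⊆N (C , C⊆S' , mono , m≤) =
      (⁅ v ⁆ ∪ C) , sub , mono' , ≤-trans (s≤s m≤) (count-insert C v∉C)
      where
      v∉C : ¬ (v ∈ C)
      v∉C v∈C = irrefl (S'⊆N v (C⊆S' v v∈C))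
      sub : (⁅ v ⁆ ∪ C) ⊆ S
      sub x p with ∪-elim p
      ... | inj₁ x≡v = subst (_∈ S) (sym (∈⁅⁆ x≡v)) v∈S
      ... | inj₂ x∈C  = S'⊆S x (C⊆S' x x∈C)
      mono' : ∀ x y → x ∈ (⁅ v ⁆ ∪ C) → y ∈ (⁅ v ⁆ ∪ C) → ¬ x ≡ y → y ∈ N i x
      mono' x y p q x≢y with ∪-elim p | ∪-elim q
      ... | inj₁ x≡v | inj₁ y≡v = contradiction (trans (∈⁅⁆ x≡v) (sym (∈⁅⁆ y≡v))) x≢y
      ... | inj₁ x≡v | inj₂ y∈C rewrite ∈⁅⁆ x≡v = S'⊆N y (C⊆S' y y∈C)
      ... | inj₂ x∈C | inj₁ y≡v rewrite ∈⁅⁆ y≡v = symm (S'⊆N x (C⊆S' x x∈C))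
      ... | inj₂ x∈C | inj₂ y∈C  = mono x y x∈C y∈C x≢y

    cover-count : ∀ (S : Subset n) v → count S ≤ suc (sum λ j → count (N j v ∩ S))
    cover-count S v = count-cover S v (λ j → N j v) (cover v)

  module _ {n r : ℕ} (c : Colouring r n) where

    -- Only the values of `c` at pairs in increasing order carry meaning, so the smaller vertex is
    -- always put first; this also makes the relation symmetric.
    edgeColour : Fin n → Fin n → Fin r
    edgeColour x y with toℕ x <? toℕ y
    ... | yes _ = c x y
    ... | no _  = c y x

    edgeColour-< : ∀ x y → toℕ x < toℕ y → edgeColour x y ≡ c x y
    edgeColour-< x y lt with toℕ x <? toℕ y
    ... | yes _ = refl
    ... | no ¬p = contradiction lt ¬p

    edgeColour-sym : ∀ x y → edgeColour x y ≡ edgeColour y x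
    edgeColour-sym x y with toℕ x <? toℕ y | toℕ y <? toℕ x
    ... | yes p | yes q = contradiction q (<-asym p)
    ... | yes _ | no _  = refl
    ... | no _  | yes _ = refl
    ... | no ¬p | no ¬q with toℕ-injective {i = x} {y} (≤-antisym (≮⇒≥ ¬q) (≮⇒≥ ¬p))
    ...   | refl = refl

    neighbours : Fin r → Fin n → Subset n
    neighbours i x y = not (does (x ≟ y)) ∧ does (edgeColour x y ≟ i)

    neighbours-colour : ∀ {i x y} → y ∈ neighbours i x → edgeColour x y ≡ i
    neighbours-colour {i} {x} {y} (mem p) with x ≟ y | edgeColour x y ≟ i
    ... | no _ | yes eq = eq

    neighbours-≢ : ∀ {i x y} → y ∈ neighbours i x → ¬ x ≡ y
    neighbours-≢ {i} {x} {y} (mem p) with x ≟ y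
    ... | no x≢y = x≢y

    neighbours-intro : ∀ {i x y} → ¬ x ≡ y → edgeColour x y ≡ i → y ∈ neighbours i x
    neighbours-intro {i} {x} {y} x≢y eq = mem (cong₂ _∧_ (cong not (dec-false (x ≟ y) x≢y)) (dec-true (edgeColour x y ≟ i) eq))

    edgeColouring : EdgeColouring n r
    edgeColouring = record
      { N      = neighbours
      ; irrefl = λ p → neighbours-≢ p refl
      ; symm   = λ {i} {x} {y} p → neighbours-intro (λ e → neighbours-≢ p (sym e)) (trans (edgeColour-sym y x) (neighbours-colour p))
      ; cover  = λ x y y≢x → edgeColour x y , neighbours-intro (λ e → y≢x (sym e)) refl
      }

    clique⇒mono : ∀ {i k S} → Clique edgeColouring i k S → HasMonoClique k c
    clique⇒mono {i} {k} (C , _ , mono , k≤) with enumerate C k k≤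
    ... | e , e-mono , e∈C = e , i , e-mono , λ a b lt →
      trans (sym (edgeColour-< (e a) (e b) (e-mono a b lt)))
        (neighbours-colour (mono (e a) (e b) (e∈C a) (e∈C b)
          (λ eq → <-irrefl (cong toℕ eq) (e-mono a b lt))))

-- The weighted off-diagonal Erdős-Szekeres bound.

module ErdosSzekeres where

  open Counting
  open Cliques
  open Powers
  open import Data.Fin using (Fin; zero; suc; _≟_)
  open import Data.Fin.Properties using (any?)
  open import Data.Nat using (ℕ; zero; suc; pred; _+_; _*_; _^_; _≤_; _<_; z≤n; s≤s)
  open import Data.Nat.Properties hiding (_≟_)
  import Data.Nat as ℕ
  open import Data.Nat.Tactic.RingSolver using (solve-∀)
  open import Data.Product using (∃; _,_)
  open import Data.Vec.Functional using (updateAt)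
  open import Data.Vec.Functional.Properties using (updateAt-updates; updateAt-minimal)
  open import Function using (_∘_)
  open import Relation.Binary.PropositionalEquality
  open import Relation.Nullary using (yes; no; contradiction)

  prodPow : ∀ {r} → (Fin r → ℕ) → (Fin r → ℕ) → ℕ
  prodPow {zero}  w κ = 1
  prodPow {suc r} w κ = w zero ^ κ zero * prodPow (w ∘ suc) (κ ∘ suc)

  drop : ∀ {r} → Fin r → (Fin r → ℕ) → (Fin r → ℕ)
  drop i κ = updateAt κ i pred

  prodPow-drop : ∀ {r} (w κ : Fin r → ℕ) i → 0 < κ i → prodPow w κ ≡ w i * prodPow w (drop i κ)
  prodPow-drop w κ zero pos with κ zero
  ... | suc m = *-assoc (w zero) (w zero ^ m) _
  prodPow-drop w κ (suc i) pos = begin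
    a * prodPow w' κ' ≡⟨ cong (a *_) (prodPow-drop w' κ' i pos) ⟩
    a * (w (suc i) * p) ≡⟨ swap a (w (suc i)) p ⟩
    w (suc i) * (a * p) ∎
    where
    open ≡-Reasoning
    w' = w ∘ suc
    κ' = κ ∘ suc
    a  = w zero ^ κ zero
    p  = prodPow w' (drop i κ')
    swap : ∀ a b c → a * (b * c) ≡ b * (a * c)
    swap = solve-∀

  sum-drop : ∀ {r} (κ : Fin r → ℕ) i → 0 < κ i → sum κ ≡ suc (sum (drop i κ))
  sum-drop κ i pos = +-cancelʳ-≡ (pred (κ i)) _ _ (begin
    sum κ + pred (κ i) ≡⟨ sum-updateAt κ i pred ⟨
    sum (drop i κ) + κ i ≡⟨ cong (sum (drop i κ) +_) (suc-pred (κ i) {{ℕ.>-nonZero pos}}) ⟨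
    sum (drop i κ) + suc (pred (κ i)) ≡⟨ +-suc _ _ ⟩
    suc (sum (drop i κ)) + pred (κ i) ∎)
    where open ≡-Reasoning

  prodPow-≤ : ∀ {r A} (w κ : Fin r → ℕ) → (∀ i → w i ≤ A) → prodPow w κ ≤ A ^ sum κ
  prodPow-≤ {zero}      w κ w≤A = ≤-refl
  prodPow-≤ {suc r} {A} w κ w≤A = begin
    w zero ^ κ zero * prodPow (w ∘ suc) (κ ∘ suc) ≤⟨ *-mono-≤ (^-monoˡ-≤ (κ zero) (w≤A zero)) (prodPow-≤ (w ∘ suc) (κ ∘ suc) (w≤A ∘ suc)) ⟩
    A ^ κ zero * A ^ sum (κ ∘ suc) ≡⟨ ^-distribˡ-+-* A (κ zero) _ ⟨
    A ^ sum κ ∎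
    where open ≤-Reasoning

  module _ {n r : ℕ} (E : EdgeColouring n r) (Goal : Set) where
    open EdgeColouring E

    -- The vertices chosen so far live inside these functions: `κ i` is what colour `i` still lacks,
    -- and supplying it within `W` completes the original clique.
    Needs : (Fin r → ℕ) → Subset n → Set
    Needs κ W = ∀ i → Clique E i (κ i) W → Goal

    needs-drop : ∀ {κ W v} i → 0 < κ i → v ∈ W → Needs κ W → Needs (drop i κ) (N i v ∩ W)
    needs-drop {κ} {W} {v} i pos v∈W needs j cl with j ≟ i
    ... | no j≢i  = needs j (clique-⊆ E (λ x → ∩-right {S = N i v})
                      (subst (λ m → Clique E j m _) (updateAt-minimal j i κ j≢i) cl))
    ... | yes refl = needs i (subst (λ m → Clique E i m W) (suc-pred (κ i) {{ℕ.>-nonZero pos}})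
                       (clique-insert E v∈W (λ x → ∩-right {S = N i v}) (λ x → ∩-left)
                         (subst (λ m → Clique E i m _) (updateAt-updates i κ) cl)))

    -- The choice w i / A of the colour densities is free, which yields off-diagonal bounds.
    erdős-szekeres : 2 ≤ r → ∀ {A} (w : Fin r → ℕ) → sum w ≤ A → ∀ s κ W → sum κ ≡ s →
      A ^ s < suc (count W) * prodPow w κ → Needs κ W → Goal
    erdős-szekeres 2≤r {A} w Σw≤A s κ W Σκ≡s big needs with any? (λ i → κ i ℕ.≟ 0)
    ... | yes (i , κi≡0) = needs i (subst (λ m → Clique E i m W) (sym κi≡0) (clique-empty E))
    erdős-szekeres 2≤r {A} w Σw≤A zero κ W Σκ≡s big needs | no none =
      contradiction (n≤0⇒n≡0 (subst (κ i₀ ≤_) Σκ≡s (≤-sum κ i₀))) (λ e → none (i₀ , e))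
      where
      i₀ : Fin r
      i₀ = Data.Fin.fromℕ< (≤-trans (s≤s z≤n) 2≤r)
    erdős-szekeres 2≤r {A} w Σw≤A (suc s) κ W Σκ≡s big needs | no none =
      found (inhabited W nonempty)
      where
      Π : ℕ
      Π = prodPow w κ
      κ>0 : ∀ i → 0 < κ i
      κ>0 i = n≢0⇒n>0 (λ e → none (i , e))
      nonempty : 0 < count W
      nonempty = n≢0⇒n>0 λ e → <⇒≱ (subst (λ c → A ^ suc s < suc c * Π) e big)
        (≤-trans (≤-reflexive (*-identityˡ Π))
          (subst (λ z → Π ≤ A ^ z) Σκ≡s (prodPow-≤ w κ (λ i → ≤-trans (≤-sum w i) Σw≤A))))
      found : ∃ (λ v → v ∈ W) → Goal
      found (v , v∈W) = recurse (pigeonhole (λ i → w i * A ^ s) (λ i → suc (d i) * Π) sums)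
        where
        d : Fin r → ℕ
        d i = count (N i v ∩ W)
        sums : sum (λ i → w i * A ^ s) < sum (λ i → suc (d i) * Π)
        sums = begin-strict
          sum (λ i → w i * A ^ s) ≡⟨ *-distribʳ-sum (A ^ s) w ⟨
          sum w * A ^ s ≤⟨ *-monoˡ-≤ (A ^ s) Σw≤A ⟩
          A ^ suc s <⟨ big ⟩
          suc (count W) * Π ≤⟨ *-monoˡ-≤ Π (s≤s (cover-count E W v)) ⟩
          -- One unit comes from the `suc` in `big`, one from `v` itself; the `r` units in the
          -- summands `suc (d i)` cover both.
          (2 + sum d) * Π ≤⟨ *-monoˡ-≤ Π (+-monoˡ-≤ (sum d) 2≤r) ⟩
          (r + sum d) * Π ≡⟨ cong (λ z → (z + sum d) * Π) (trans (sum-const r 1) (*-identityʳ r)) ⟨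
          (sum {r} (λ _ → 1) + sum d) * Π ≡⟨ cong (_* Π) (∑-distrib-+ (λ _ → 1) d) ⟨
          sum (λ i → suc (d i)) * Π ≡⟨ *-distribʳ-sum Π (λ i → suc (d i)) ⟩
          sum (λ i → suc (d i) * Π) ∎
          where open ≤-Reasoning
        recurse : ∃ (λ i → w i * A ^ s < suc (d i) * Π) → Goal
        recurse (i , lt) = erdős-szekeres 2≤r w Σw≤A s (drop i κ) (N i v ∩ W)
          (suc-injective (trans (sym (sum-drop κ i (κ>0 i))) Σκ≡s))
          (*-cancelˡ-< (w i) _ _ (subst (w i * A ^ s <_) eq lt))
          (needs-drop i (κ>0 i) v∈W needs)
          where
          swap : ∀ a b c → a * (b * c) ≡ b * (a * c)
          swap = solve-∀
          eq : suc (d i) * Π ≡ w i * (suc (d i) * prodPow w (drop i κ))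
          eq = trans (cong (suc (d i) *_) (prodPow-drop w κ i (κ>0 i)))
                     (swap (suc (d i)) (w i) (prodPow w (drop i κ)))

-- Ordered-field facts for rationals and the embedding of the naturals.

module RationalOrder where

  open import Data.Integer using (+_)
  import Data.Integer as ℤ
  import Data.Integer.Properties as ℤ
  open import Data.Nat as ℕ using (ℕ; suc)
  import Data.Nat.Properties as ℕ
  open import Data.Product using (∃; _×_; _,_)
  open import Data.Rational
  open import Data.Rational.Properties
  import Data.Rational.Unnormalised as ℚᵘ
  import Data.Rational.Unnormalised.Properties as ℚᵘ
  import Data.Sum
  open import Relation.Binary.PropositionalEquality
  open import Relation.Nullary.Decidable using (dec⇒maybe)
  open import Tactic.RingSolver using (solve-∀)
  open import Tactic.RingSolver.Core.AlmostCommutativeRing using (AlmostCommutativeRing; fromCommutativeRing)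

  ring : AlmostCommutativeRing _ _
  ring = fromCommutativeRing +-*-commutativeRing (λ x → dec⇒maybe (0ℚ ≟ x))

  -- Opaque, since unfolding would normalise the fraction.
  opaque
    ι : ℕ → ℚ
    ι n = + n / 1

    ι-def : ∀ n → ι n ≡ + n / 1
    ι-def n = refl

    ι-0 : ι 0 ≡ 0ℚ
    ι-0 = refl

    ι-1 : ι 1 ≡ 1ℚ
    ι-1 = refl

    ι-toℚᵘ : ∀ n → toℚᵘ (ι n) ℚᵘ.≃ ℚᵘ.mkℚᵘ (+ n) 0
    ι-toℚᵘ n = toℚᵘ-fromℚᵘ (ℚᵘ.mkℚᵘ (+ n) 0)

  ι-+ : ∀ m n → ι (m ℕ.+ n) ≡ ι m + ι n
  ι-+ m n = toℚᵘ-injective (ℚᵘ.≃-trans (ι-toℚᵘ (m ℕ.+ n))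
    (ℚᵘ.≃-sym (ℚᵘ.≃-trans (toℚᵘ-homo-+ (ι m) (ι n))
      (ℚᵘ.≃-trans (ℚᵘ.+-cong (ι-toℚᵘ m) (ι-toℚᵘ n))
        (ℚᵘ.*≡* (cong (ℤ._* ℤ.1ℤ) (cong₂ ℤ._+_ (ℤ.*-identityʳ (+ m)) (ℤ.*-identityʳ (+ n)))))))))

  ι-* : ∀ m n → ι (m ℕ.* n) ≡ ι m * ι n
  ι-* m n = toℚᵘ-injective (ℚᵘ.≃-trans (ι-toℚᵘ (m ℕ.* n))
    (ℚᵘ.≃-sym (ℚᵘ.≃-trans (toℚᵘ-homo-* (ι m) (ι n))
      (ℚᵘ.≃-trans (ℚᵘ.*-cong (ι-toℚᵘ m) (ι-toℚᵘ n))
        (ℚᵘ.*≡* (cong (ℤ._* ℤ.1ℤ) (sym (ℤ.pos-* m n))))))))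

  ι-mono : ∀ {m n} → m ℕ.≤ n → ι m ≤ ι n
  ι-mono {m} {n} m≤n = toℚᵘ-cancel-≤ (ℚᵘ.≤-trans (ℚᵘ.≤-reflexive (ι-toℚᵘ m))
    (ℚᵘ.≤-trans (ℚᵘ.*≤* (ℤ.*-monoʳ-≤-nonNeg ℤ.1ℤ (ℤ.+≤+ m≤n))) (ℚᵘ.≤-reflexive (ℚᵘ.≃-sym (ι-toℚᵘ n)))))

  ι-cancel : ∀ {m n} → ι m ≤ ι n → m ℕ.≤ n
  ι-cancel {m} {n} le with ℚᵘ.≤-trans (ℚᵘ.≤-reflexive (ℚᵘ.≃-sym (ι-toℚᵘ m)))
                            (ℚᵘ.≤-trans (toℚᵘ-mono-≤ le) (ℚᵘ.≤-reflexive (ι-toℚᵘ n)))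
  ... | ℚᵘ.*≤* p with ℤ.*-cancelʳ-≤-pos (+ m) (+ n) ℤ.1ℤ p
  ...   | ℤ.+≤+ q = q

  0≤ι : ∀ n → 0ℚ ≤ ι n
  0≤ι n = subst (_≤ ι n) ι-0 (ι-mono {0} {n} ℕ.z≤n)

  0≤1 : 0ℚ ≤ 1ℚ
  0≤1 = subst (0ℚ ≤_) ι-1 (0≤ι 1)

  ι-suc : ∀ n → ι (suc n) ≡ 1ℚ + ι n
  ι-suc n = trans (ι-+ 1 n) (cong (_+ ι n) ι-1)

  diff-≥0 : ∀ {p q} → p ≤ q → 0ℚ ≤ q - p
  diff-≥0 {p} {q} p≤q = subst (_≤ q - p) (+-inverseʳ p) (+-monoˡ-≤ (- p) p≤q)

  ≤-diff : ∀ {p q} → 0ℚ ≤ q - p → p ≤ q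
  ≤-diff {p} {q} le = subst₂ _≤_ (+-identityˡ p) (lemma q p) (+-monoˡ-≤ p le)
    where
    lemma : ∀ q p → q - p + p ≡ q
    lemma = solve-∀ ring

  ≤-by : ∀ {p q} d → q ≡ p + d → 0ℚ ≤ d → p ≤ q
  ≤-by {p} {q} d eq 0≤d = subst₂ _≤_ (+-identityʳ p) (sym eq) (+-monoʳ-≤ p 0≤d)

  +-nonneg : ∀ {p q} → 0ℚ ≤ p → 0ℚ ≤ q → 0ℚ ≤ p + q
  +-nonneg {p} {q} = +-mono-≤ {0ℚ} {p} {0ℚ} {q}

  *-monoˡ : ∀ {p q} r → 0ℚ ≤ r → p ≤ q → r * p ≤ r * q
  *-monoˡ r 0≤r = *-monoˡ-≤-nonNeg r {{nonNegative 0≤r}}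

  *-monoʳ : ∀ {p q} r → 0ℚ ≤ r → p ≤ q → p * r ≤ q * r
  *-monoʳ r 0≤r = *-monoʳ-≤-nonNeg r {{nonNegative 0≤r}}

  *-mono : ∀ {p q r s} → 0ℚ ≤ p → 0ℚ ≤ s → p ≤ q → r ≤ s → p * r ≤ q * s
  *-mono {p} {q} {r} {s} 0≤p 0≤s p≤q r≤s = ≤-trans (*-monoˡ p 0≤p r≤s) (*-monoʳ s 0≤s p≤q)

  *-nonneg : ∀ {p q} → 0ℚ ≤ p → 0ℚ ≤ q → 0ℚ ≤ p * q
  *-nonneg {p} {q} 0≤p 0≤q = subst (_≤ p * q) (*-zeroʳ p) (*-monoˡ p 0≤p 0≤q)

  *-pos : ∀ {p q} → 0ℚ < p → 0ℚ < q → 0ℚ < p * q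
  *-pos {p} {q} 0<p 0<q = subst (_< p * q) (*-zeroʳ p) (*-monoʳ-<-pos p {{positive 0<p}} 0<q)

  sq-nonneg : ∀ p → 0ℚ ≤ p * p
  sq-nonneg p with ≤-total 0ℚ p
  ... | Data.Sum.inj₁ 0≤p = *-nonneg 0≤p 0≤p
  ... | Data.Sum.inj₂ p≤0 = subst (0ℚ ≤_) (lemma p) (*-nonneg 0≤-p 0≤-p)
    where
    0≤-p : 0ℚ ≤ - p
    0≤-p = neg-antimono-≤ p≤0
    lemma : ∀ p → - p * - p ≡ p * p
    lemma = solve-∀ ring

  1≤ι : ∀ {n} → 0 ℕ.< n → 1ℚ ≤ ι n
  1≤ι {n} pos = subst (_≤ ι n) ι-1 (ι-mono {1} {n} pos)

  *-cancelˡ : ∀ {p q} r → 0ℚ < r → r * p ≤ r * q → p ≤ q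
  *-cancelˡ r 0<r = *-cancelˡ-≤-pos r {{positive 0<r}}

  0<ι : ∀ {n} → 0 ℕ.< n → 0ℚ < ι n
  0<ι {n} pos = <-≤-trans {0ℚ} {1ℚ} {ι n} (*<* (ℤ.+<+ (ℕ.s≤s ℕ.z≤n))) (1≤ι pos)

  reciprocal : ∀ p → 0ℚ < p → ∃ λ w → 0ℚ < w × w * p ≡ 1ℚ
  reciprocal p 0<p = w , positive⁻¹ w {{1/pos⇒pos p}} , *-inverseˡ p
    where
    instance
      p>0 : Positive p
      p>0 = positive 0<p
      p≢0 : NonZero p
      p≢0 = pos⇒nonZero p
    w = 1/ p

-- Shifted Chebyshev polynomials of degree a power of two.

module Chebyshev where

  open RationalOrder
  open import Data.Integer using (+_)
  open import Data.Nat as ℕ using (ℕ; zero; suc)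
  import Data.Nat.Properties as ℕ
  open import Data.Product using (_×_; _,_; proj₁; proj₂)
  open import Data.Rational
  open import Data.Rational.Properties
  open import Data.Sum using (inj₁; inj₂)
  open import Relation.Binary.PropositionalEquality
  open import Tactic.RingSolver using (solve-∀)

  -- 1 + q y = T₂ (1 + y) for the Chebyshev polynomial T₂ z = 2z² - 1, so 1 + iter J y = T_{2^J} (1 + y).
  q : ℚ → ℚ
  q y = ι 4 * y + ι 2 * (y * y)

  iter : ℕ → ℚ → ℚ
  iter zero    y = y
  iter (suc J) y = iter J (q y)

  iter-+ : ∀ i j y → iter (i ℕ.+ j) y ≡ iter j (iter i y)
  iter-+ zero    j y = refl
  iter-+ (suc i) j y = iter-+ i j (q y)

  -2ℚ : ℚ
  -2ℚ = - ι 2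

  -- `T₂` maps [-1, 1] to itself. The two bounds are the identities q y + 2 = 2 (1 + y)² and - q y =
  -- 2 (- y)(y + 2).
  iter-range : ∀ J {y} → -2ℚ ≤ y → y ≤ 0ℚ → (-2ℚ ≤ iter J y) × (iter J y ≤ 0ℚ)
  iter-range zero    lo hi = lo , hi
  iter-range (suc J) {y} lo hi = iter-range J
    (≤-by (ι 2 * ((1ℚ + y) * (1ℚ + y))) (lower y) (*-nonneg (0≤ι 2) (sq-nonneg (1ℚ + y))))
    (≤-by (ι 2 * (- y * (y + ι 2))) (upper y)
      (*-nonneg (0≤ι 2) (*-nonneg (neg-antimono-≤ hi) (subst (0ℚ ≤_) (shift y) (diff-≥0 lo)))))
    where
    opaque
      unfolding ι
      lower : ∀ y → ι 4 * y + ι 2 * (y * y) ≡ - ι 2 + ι 2 * ((1ℚ + y) * (1ℚ + y))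
      lower = solve-∀ ring
    opaque
      unfolding ι
      upper : ∀ y → 0ℚ ≡ ι 4 * y + ι 2 * (y * y) + ι 2 * (- y * (y + ι 2))
      upper = solve-∀ ring
    opaque
      unfolding ι
      shift : ∀ y → y - - ι 2 ≡ y + ι 2
      shift = solve-∀ ring

  4y≤q : ∀ y → ι 4 * y ≤ q y
  4y≤q y = ≤-by _ refl (*-nonneg (0≤ι 2) (sq-nonneg y))

  q-nonneg : ∀ {y} → 0ℚ ≤ y → 0ℚ ≤ q y
  q-nonneg {y} 0≤y = ≤-trans (*-nonneg (0≤ι 4) 0≤y) (4y≤q y)

  iter-nonneg : ∀ J {y} → 0ℚ ≤ y → 0ℚ ≤ iter J y
  iter-nonneg zero    0≤y = 0≤y
  iter-nonneg (suc J) 0≤y = iter-nonneg J (q-nonneg 0≤y)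

  -- 4^J is the slope of the polynomial at 0, and each `q` lies above its tangent there.
  iter-grows : ∀ J {y} → 0ℚ ≤ y → ι (4 ℕ.^ J) * y ≤ iter J y
  iter-grows zero    {y} 0≤y = ≤-reflexive (trans (cong (_* y) ι-1) (*-identityˡ y))
  iter-grows (suc J) {y} 0≤y = begin
    ι (4 ℕ.* 4 ℕ.^ J) * y ≡⟨ cong (_* y) (ι-* 4 (4 ℕ.^ J)) ⟩
    ι 4 * ι (4 ℕ.^ J) * y ≡⟨ swap (ι 4) (ι (4 ℕ.^ J)) y ⟩
    ι (4 ℕ.^ J) * (ι 4 * y) ≤⟨ *-monoˡ (ι (4 ℕ.^ J)) (0≤ι (4 ℕ.^ J)) (4y≤q y) ⟩
    ι (4 ℕ.^ J) * q y ≤⟨ iter-grows J (q-nonneg 0≤y) ⟩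
    iter J (q y) ∎
    where
    open ≤-Reasoning
    swap : ∀ a b c → a * b * c ≡ b * (a * c)
    swap = solve-∀ ring

  -- The hypothesis is a lower bound on 1/y + 1/6, which a step of q divides by at most 4.
  iter-bounded : ∀ m {y} → 0ℚ ≤ y → ι (6 ℕ.* 4 ℕ.^ m) * y ≤ ι 6 + y → ι 6 * iter m y ≤ ι 6 + iter m y
  iter-bounded zero    0≤y le = le
  iter-bounded (suc m) {y} 0≤y le = iter-bounded m (q-nonneg 0≤y)
    (*-cancelˡ (ι 2) (0<ι {2} (ℕ.s≤s ℕ.z≤n)) (begin
      ι 2 * (K * q y) ≡⟨ e₁ K y ⟩
      (ι 4 * K) * y * (ι 2 + y) ≡⟨ cong (λ z → z * y * (ι 2 + y)) (sym K-suc) ⟩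
      ι (6 ℕ.* 4 ℕ.^ suc m) * y * (ι 2 + y) ≤⟨ *-monoʳ (ι 2 + y) (+-nonneg (0≤ι 2) 0≤y) le ⟩
      (ι 6 + y) * (ι 2 + y) ≤⟨ ≤-by (ι 3 * (y * y)) (e₂ y) (*-nonneg (0≤ι 3) (sq-nonneg y)) ⟩
      ι 2 * (ι 6 + q y) ∎))
    where
    open ≤-Reasoning
    K = ι (6 ℕ.* 4 ℕ.^ m)
    K-suc : ι (6 ℕ.* 4 ℕ.^ suc m) ≡ ι 4 * K
    K-suc = trans (cong ι (trans (sym (ℕ.*-assoc 6 4 (4 ℕ.^ m))) (trans (cong (ℕ._* 4 ℕ.^ m) (ℕ.*-comm 6 4)) (ℕ.*-assoc 4 6 (4 ℕ.^ m)))))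
                  (ι-* 4 (6 ℕ.* 4 ℕ.^ m))
    opaque
      unfolding ι
      e₁ : ∀ K y → ι 2 * (K * (ι 4 * y + ι 2 * (y * y))) ≡ (ι 4 * K) * y * (ι 2 + y)
      e₁ = solve-∀ ring
    opaque
      unfolding ι
      e₂ : ∀ y → ι 2 * (ι 6 + (ι 4 * y + ι 2 * (y * y)))
               ≡ (ι 6 + y) * (ι 2 + y) + ι 3 * (y * y)
      e₂ = solve-∀ ring

  -- Since 2 T₂ z ≤ (2z)², a step of `q` at most squares `2 (1 + y)`: the number of bits doubles.
  iter-doubling : ∀ i a {y} → 0ℚ ≤ y → ι 2 * (1ℚ + y) ≤ ι (2 ℕ.^ a) →
    ι 2 * (1ℚ + iter i y) ≤ ι (2 ℕ.^ (a ℕ.* 2 ℕ.^ i))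
  iter-doubling zero    a 0≤y le = subst (λ z → _ ≤ ι (2 ℕ.^ z)) (sym (ℕ.*-identityʳ a)) le
  iter-doubling (suc i) a {y} 0≤y le =
    subst (λ z → ι 2 * (1ℚ + iter i (q y)) ≤ ι (2 ℕ.^ z)) expo (iter-doubling i (a ℕ.+ a) (q-nonneg 0≤y) (begin
      ι 2 * (1ℚ + q y) ≤⟨ ≤-by (ι 2) (e y) (0≤ι 2) ⟩
      ι 2 * (1ℚ + y) * (ι 2 * (1ℚ + y)) ≤⟨ *-mono 0≤2+2y (0≤ι (2 ℕ.^ a)) le le ⟩
      ι (2 ℕ.^ a) * ι (2 ℕ.^ a) ≡⟨ ι-* (2 ℕ.^ a) (2 ℕ.^ a) ⟨
      ι (2 ℕ.^ a ℕ.* 2 ℕ.^ a) ≡⟨ cong ι (ℕ.^-distribˡ-+-* 2 a a) ⟨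
      ι (2 ℕ.^ (a ℕ.+ a)) ∎))
    where
    open ≤-Reasoning
    0≤2+2y : 0ℚ ≤ ι 2 * (1ℚ + y)
    0≤2+2y = *-nonneg (0≤ι 2) (+-nonneg 0≤1 0≤y)
    opaque
      unfolding ι
      e : ∀ y → ι 2 * (1ℚ + y) * (ι 2 * (1ℚ + y))
              ≡ ι 2 * (1ℚ + (ι 4 * y + ι 2 * (y * y))) + ι 2
      e = solve-∀ ring
    expo : (a ℕ.+ a) ℕ.* 2 ℕ.^ i ≡ a ℕ.* 2 ℕ.^ suc i
    expo = trans (cong (ℕ._* 2 ℕ.^ i) (trans (cong (a ℕ.+_) (sym (ℕ.+-identityʳ a))) (ℕ.*-comm 2 a))) (ℕ.*-assoc a 2 (2 ℕ.^ i))

  -- The shift by 3 puts `G` between 1 and 3 on [-2, 0]: products of such factors stay at least 1,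
  -- while a negative argument contributes at most 3.
  G : ℕ → ℚ → ℚ
  G J y = ι 3 + iter J y

  G≥1 : ∀ J {y} → -2ℚ ≤ y → 1ℚ ≤ G J y
  G≥1 J {y} lo with ≤-total y 0ℚ
  ... | inj₁ hi  = subst (_≤ G J y) 3-2 (+-monoʳ-≤ (ι 3) (proj₁ (iter-range J lo hi)))
    where
    opaque
      unfolding ι
      3-2 : ι 3 + -2ℚ ≡ 1ℚ
      3-2 = refl
  ... | inj₂ 0≤y = ≤-trans (1≤ι {3} (ℕ.s≤s ℕ.z≤n)) (≤-by (iter J y) refl (iter-nonneg J 0≤y))

  G≤3 : ∀ J {y} → -2ℚ ≤ y → y ≤ 0ℚ → G J y ≤ ι 3
  G≤3 J {y} lo hi = subst (G J y ≤_) (+-identityʳ (ι 3)) (+-monoʳ-≤ (ι 3) (proj₂ (iter-range J lo hi)))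

  4^Jy≤G : ∀ J {y} → -2ℚ ≤ y → ι (4 ℕ.^ J) * y ≤ G J y
  4^Jy≤G J {y} lo with ≤-total y 0ℚ
  ... | inj₁ hi  = ≤-trans (subst (ι (4 ℕ.^ J) * y ≤_) (*-zeroʳ (ι (4 ℕ.^ J))) (*-monoˡ (ι (4 ℕ.^ J)) (0≤ι (4 ℕ.^ J)) hi))
                     (≤-trans 0≤1 (G≥1 J lo))
  ... | inj₂ 0≤y = ≤-trans (iter-grows J 0≤y) (≤-by (ι 3) (+-comm (ι 3) (iter J y)) (0≤ι 3))

  -- This is T_N(1 + y) ≈ exp(N √(2y)) with N = 2^(m+i). During the first `m` steps the value stays
  -- bounded; each of the remaining `i` steps doubles its bits, starting from 3.
  G-upper : ∀ m i {y} → -2ℚ ≤ y → ι (4 ℕ.^ (m ℕ.+ i)) * y ≤ ι (4 ℕ.^ i) → G (m ℕ.+ i) y ≤ ι (2 ℕ.^ (3 ℕ.* 2 ℕ.^ i))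
  G-upper m i {y} lo le with ≤-total y 0ℚ
  ... | inj₁ hi  = ≤-trans (G≤3 (m ℕ.+ i) lo hi) (ι-mono (ℕ.≤-trans (ℕ.m≤m+n 3 5) (ℕ.^-monoʳ-≤ 2 {3} 3≤)))
    where
    3≤ : 3 ℕ.≤ 3 ℕ.* 2 ℕ.^ i
    3≤ = ℕ.*-monoʳ-≤ 3 {1} (ℕ.m^n>0 2 i)
  ... | inj₂ 0≤y = *-cancelˡ (ι 2) (0<ι {2} (ℕ.s≤s ℕ.z≤n)) (begin
      ι 2 * (ι 3 + iter (m ℕ.+ i) y) ≡⟨ cong (λ z → ι 2 * (ι 3 + z)) (iter-+ m i y) ⟩
      ι 2 * (ι 3 + z') ≡⟨ e₁ z' ⟩
      ι 2 * (1ℚ + z') + ι 4 ≤⟨ +-mono-≤ doubled (ι-mono {4} {2 ℕ.^ b} four) ⟩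
      ι (2 ℕ.^ b) + ι (2 ℕ.^ b) ≡⟨ e₂ (ι (2 ℕ.^ b)) ⟩
      ι 2 * ι (2 ℕ.^ b) ∎)
    where
    open ≤-Reasoning
    b = 3 ℕ.* 2 ℕ.^ i
    z = iter m y
    z' = iter i z
    four : 4 ℕ.≤ 2 ℕ.^ b
    four = ℕ.≤-trans (ℕ.m≤m+n 4 4) (ℕ.^-monoʳ-≤ 2 {3} (ℕ.*-monoʳ-≤ 3 {1} (ℕ.m^n>0 2 i)))
    opaque
      unfolding ι
      e₁ : ∀ z → ι 2 * (ι 3 + z) ≡ ι 2 * (1ℚ + z) + ι 4
      e₁ = solve-∀ ring
    opaque
      unfolding ι
      e₂ : ∀ z → z + z ≡ ι 2 * z
      e₂ = solve-∀ ring
    opaque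
      unfolding ι
      e₃ : ∀ z → ι 5 * (ι 3 - z) ≡ (ι 6 + z - ι 6 * z) + ι 9
      e₃ = solve-∀ ring
    4^my≤1 : ι (4 ℕ.^ m) * y ≤ 1ℚ
    4^my≤1 = *-cancelˡ (ι (4 ℕ.^ i)) (0<ι (ℕ.m^n>0 4 i)) (begin
      ι (4 ℕ.^ i) * (ι (4 ℕ.^ m) * y) ≡⟨ *-assoc (ι (4 ℕ.^ i)) (ι (4 ℕ.^ m)) y ⟨
      ι (4 ℕ.^ i) * ι (4 ℕ.^ m) * y ≡⟨ cong (_* y) (trans (*-comm (ι (4 ℕ.^ i)) (ι (4 ℕ.^ m))) (sym (trans (cong ι (ℕ.^-distribˡ-+-* 4 m i)) (ι-* (4 ℕ.^ m) (4 ℕ.^ i))))) ⟩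
      ι (4 ℕ.^ (m ℕ.+ i)) * y ≤⟨ le ⟩
      ι (4 ℕ.^ i) ≡⟨ *-identityʳ (ι (4 ℕ.^ i)) ⟨
      ι (4 ℕ.^ i) * 1ℚ ∎)
    bounded₀ : ι (6 ℕ.* 4 ℕ.^ m) * y ≤ ι 6 + y
    bounded₀ = begin
      ι (6 ℕ.* 4 ℕ.^ m) * y ≡⟨ cong (_* y) (ι-* 6 (4 ℕ.^ m)) ⟩
      ι 6 * ι (4 ℕ.^ m) * y ≡⟨ *-assoc (ι 6) (ι (4 ℕ.^ m)) y ⟩
      ι 6 * (ι (4 ℕ.^ m) * y) ≤⟨ *-monoˡ (ι 6) (0≤ι 6) 4^my≤1 ⟩
      ι 6 * 1ℚ ≡⟨ *-identityʳ (ι 6) ⟩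
      ι 6 ≤⟨ ≤-by y refl 0≤y ⟩
      ι 6 + y ∎
    -- `iter-bounded` even gives z ≤ 6/5; the bound 3 is the one that makes `2 (1 + z)` at most 2^3.
    z≤3 : z ≤ ι 3
    z≤3 = ≤-diff (*-cancelˡ (ι 5) (0<ι {5} (ℕ.s≤s ℕ.z≤n))
      (subst₂ _≤_ (sym (*-zeroʳ (ι 5))) (sym (e₃ z)) (+-nonneg (diff-≥0 (iter-bounded m 0≤y bounded₀)) (0≤ι 9))))
    opaque
      unfolding ι
      2·4≡8 : ι 2 * (1ℚ + ι 3) ≡ ι 8
      2·4≡8 = refl
    doubled : ι 2 * (1ℚ + z') ≤ ι (2 ℕ.^ b)
    doubled = iter-doubling i 3 (iter-nonneg m 0≤y) (subst (ι 2 * (1ℚ + z) ≤_) 2·4≡8 (*-monoˡ (ι 2) (0≤ι 2) (+-monoʳ-≤ 1ℚ z≤3)))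

-- Positive semidefinite kernels and a polynomial that detects negative entries.

module Kernels where

  open RationalOrder
  open Chebyshev
  module ℕ = Counting
  open import Algebra.Bundles using (CommutativeRing)
  open import Data.Fin using (Fin; zero; suc)
  open import Data.Integer using (+_)
  open import Data.Nat as ℕ using (ℕ; zero; suc)
  import Data.Nat.Properties as ℕ
  open import Data.Rational
  open import Data.Rational.Properties
  open import Function using (_∘_)
  open import Relation.Binary.PropositionalEquality
  open import Tactic.RingSolver using (solve-∀)
  open import Algebra.Properties.Semiring.Sum (CommutativeRing.semiring +-*-commutativeRing) public
    using () renaming (sum to ∑; sum-cong-≗ to ∑-cong; ∑-distrib-+ to ∑-+; *-distribˡ-sum to *-distribˡ-∑; *-distribʳ-sum to *-distribʳ-∑)

  ∑-mono : ∀ {n} {f g : Fin n → ℚ} → (∀ i → f i ≤ g i) → ∑ f ≤ ∑ g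
  ∑-mono {zero}  f≤g = ≤-refl
  ∑-mono {suc n} f≤g = +-mono-≤ (f≤g zero) (∑-mono (f≤g ∘ suc))

  ∑-0 : ∀ n → ∑ {n} (λ _ → 0ℚ) ≡ 0ℚ
  ∑-0 zero    = refl
  ∑-0 (suc n) = trans (+-identityˡ _) (∑-0 n)

  ∑-ι : ∀ {n} (f : Fin n → ℕ) → ∑ (ι ∘ f) ≡ ι (ℕ.sum f)
  ∑-ι {zero}  f = sym ι-0
  ∑-ι {suc n} f = trans (cong (λ z → ι (f zero) + z) (∑-ι (f ∘ suc))) (sym (ι-+ (f zero) (ℕ.sum (f ∘ suc))))

  Kernel : ℕ → Set
  Kernel n = Fin n → Fin n → ℚ

  -- The cone generated by rank-one squares. With generators instead of a quadratic-form condition,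
  -- closure under products is an induction; `cong-≗` replaces function extensionality.
  data PSD {n} : Kernel n → Set where
    square : (f : Fin n → ℚ) → PSD (λ x y → f x * f y)
    null   : PSD (λ _ _ → 0ℚ)
    plus   : ∀ {K L} → PSD K → PSD L → PSD (λ x y → K x y + L x y)
    scale  : ∀ {K} c → 0ℚ ≤ c → PSD K → PSD (λ x y → c * K x y)
    cong-≗   : ∀ {K L} → (∀ x y → K x y ≡ L x y) → PSD K → PSD L

  -- Schur's product theorem: the entrywise product is bilinear, and the product of two squares is
  -- the square of the product.
  PSD-* : ∀ {n} {K L : Kernel n} → PSD K → PSD L → PSD (λ x y → K x y * L x y)
  PSD-* {n} {K} {L} (square f) L-psd = square-* L-psd
    where
    swap : ∀ a b c d → (a * b) * (c * d) ≡ (a * c) * (b * d)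
    swap = solve-∀ ring
    pull : ∀ a b c → b * (a * c) ≡ a * (b * c)
    pull = solve-∀ ring
    square-* : ∀ {L : Kernel n} → PSD L → PSD (λ x y → f x * f y * L x y)
    square-* (square g)      = cong-≗ (λ x y → swap (f x) (g x) (f y) (g y)) (square (λ x → f x * g x))
    square-* null            = cong-≗ (λ x y → sym (*-zeroʳ (f x * f y))) null
    square-* (plus p q)      = cong-≗ (λ x y → sym (*-distribˡ-+ (f x * f y) _ _)) (plus (square-* p) (square-* q))
    square-* (scale c 0≤c p) = cong-≗ (λ x y → sym (pull c (f x * f y) _)) (scale c 0≤c (square-* p))
    square-* (cong-≗ eq p)     = cong-≗ (λ x y → cong (f x * f y *_) (eq x y)) (square-* p)
  PSD-* {L = L} null L-psd = cong-≗ (λ x y → sym (*-zeroˡ (L x y))) null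
  PSD-* {L = L} (plus {K₁} {K₂} p q) L-psd =
    cong-≗ (λ x y → sym (*-distribʳ-+ (L x y) (K₁ x y) (K₂ x y))) (plus (PSD-* p L-psd) (PSD-* q L-psd))
  PSD-* {L = L} (scale {K} c 0≤c p) L-psd =
    cong-≗ (λ x y → sym (*-assoc c (K x y) (L x y))) (scale c 0≤c (PSD-* p L-psd))
  PSD-* {L = L} (cong-≗ eq p) L-psd = cong-≗ (λ x y → cong (_* L x y) (eq x y)) (PSD-* p L-psd)

  PSD-const : ∀ {n} c → 0ℚ ≤ c → PSD {n} (λ _ _ → c)
  PSD-const c 0≤c = cong-≗ (λ _ _ → *-identityʳ c) (scale c 0≤c (square (λ _ → 1ℚ)))

  PSD-∑ : ∀ {n m} (K : Fin m → Kernel n) → (∀ i → PSD (K i)) → PSD (λ x y → ∑ (λ i → K i x y))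
  PSD-∑ {m = zero}  K psd = null
  PSD-∑ {m = suc m} K psd = plus (psd zero) (PSD-∑ (K ∘ suc) (psd ∘ suc))

  -- The quadratic form at the all-ones vector; for a rank-one kernel it is (Σ f)². Restriction to a
  -- set is obtained by multiplying with the `square` of its indicator.
  PSD-sum : ∀ {n} {K : Kernel n} → PSD K → 0ℚ ≤ ∑ (λ x → ∑ (λ y → K x y))
  PSD-sum (square f) = subst (0ℚ ≤_)
    (trans (*-distribʳ-∑ (∑ f) f) (∑-cong λ x → *-distribˡ-∑ (f x) f)) (sq-nonneg (∑ f))
  PSD-sum {n} null = ≤-reflexive (sym (trans (∑-cong {n} (λ _ → ∑-0 n)) (∑-0 n)))
  PSD-sum {n} (plus {K} {L} p q) = subst (0ℚ ≤_)
    (sym (trans (∑-cong λ x → ∑-+ (K x) (L x)) (∑-+ (λ x → ∑ (K x)) (λ x → ∑ (L x))))) (+-nonneg (PSD-sum p) (PSD-sum q))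
  PSD-sum (scale {K} c 0≤c p) = subst (0ℚ ≤_)
    (trans (*-distribˡ-∑ c (λ x → ∑ (K x))) (∑-cong λ x → *-distribˡ-∑ c (K x))) (*-nonneg 0≤c (PSD-sum p))
  PSD-sum (cong-≗ eq p) = subst (0ℚ ≤_) (∑-cong λ x → ∑-cong λ y → eq x y) (PSD-sum p)

  PSD-iter : ∀ {n} J {K : Kernel n} → PSD K → PSD (λ x y → iter J (K x y))
  PSD-iter zero    psd = psd
  PSD-iter (suc J) psd = PSD-iter J (plus (scale (ι 4) (0≤ι 4) psd) (scale (ι 2) (0≤ι 2) (PSD-* psd psd)))

  PSD-G : ∀ {n} J {K : Kernel n} → PSD K → PSD (λ x y → G J (K x y))
  PSD-G J psd = plus (PSD-const (ι 3) (0≤ι 3)) (PSD-iter J psd)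

  Π : ∀ J {m} → (Fin m → ℚ) → ℚ
  Π J {zero}  y = 1ℚ
  Π J {suc m} y = G J (y zero) * Π J (y ∘ suc)

  -- Φ J y = Σ_i 4^J y_i ∏_{l ≠ i} G J (y_l)
  Φ : ∀ J {m} → (Fin m → ℚ) → ℚ
  Φ J {zero}  y = 0ℚ
  Φ J {suc m} y = ι (4 ℕ.^ J) * y zero * Π J (y ∘ suc) + G J (y zero) * Φ J (y ∘ suc)

  PSD-Π : ∀ {n} J {m} (K : Fin m → Kernel n) → (∀ i → PSD (K i)) → PSD (λ x y → Π J (λ i → K i x y))
  PSD-Π J {zero}  K psd = PSD-const 1ℚ 0≤1
  PSD-Π J {suc m} K psd = PSD-* (PSD-G J (psd zero)) (PSD-Π J (K ∘ suc) (psd ∘ suc))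

  PSD-Φ : ∀ {n} J {m} (K : Fin m → Kernel n) → (∀ i → PSD (K i)) → PSD (λ x y → Φ J (λ i → K i x y))
  PSD-Φ J {zero}  K psd = null
  PSD-Φ J {suc m} K psd = plus
    (PSD-* (scale (ι (4 ℕ.^ J)) (0≤ι (4 ℕ.^ J)) (psd zero)) (PSD-Π J (K ∘ suc) (psd ∘ suc)))
    (PSD-* (PSD-G J (psd zero)) (PSD-Φ J (K ∘ suc) (psd ∘ suc)))

  module _ (J : ℕ) where

    G≥0 : ∀ {y} → -2ℚ ≤ y → 0ℚ ≤ G J y
    G≥0 lo = ≤-trans 0≤1 (G≥1 J lo)

    Π≥1 : ∀ {m} {y : Fin m → ℚ} → (∀ i → -2ℚ ≤ y i) → 1ℚ ≤ Π J y
    Π≥1 {zero}  lo = ≤-refl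
    Π≥1 {suc m} lo = ≤-trans (≤-reflexive (sym (*-identityˡ 1ℚ)))
      (*-mono 0≤1 (≤-trans 0≤1 (Π≥1 (lo ∘ suc))) (G≥1 J (lo zero)) (Π≥1 (lo ∘ suc)))

    Π≥0 : ∀ {m} {y : Fin m → ℚ} → (∀ i → -2ℚ ≤ y i) → 0ℚ ≤ Π J y
    Π≥0 lo = ≤-trans 0≤1 (Π≥1 lo)

    Π-upper : ∀ b {m} {y : Fin m → ℚ} → (∀ i → -2ℚ ≤ y i) → (∀ i → G J (y i) ≤ ι (2 ℕ.^ b)) → Π J y ≤ ι (2 ℕ.^ (m ℕ.* b))
    Π-upper b {zero}  lo hi = ≤-reflexive (sym ι-1)
    Π-upper b {suc m} {y} lo hi = begin
      G J (y zero) * Π J (y ∘ suc) ≤⟨ *-mono (G≥0 (lo zero)) (0≤ι (2 ℕ.^ (m ℕ.* b))) (hi zero) (Π-upper b (lo ∘ suc) (hi ∘ suc)) ⟩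
      ι (2 ℕ.^ b) * ι (2 ℕ.^ (m ℕ.* b)) ≡⟨ ι-* (2 ℕ.^ b) (2 ℕ.^ (m ℕ.* b)) ⟨
      ι (2 ℕ.^ b ℕ.* 2 ℕ.^ (m ℕ.* b)) ≡⟨ cong ι (ℕ.^-distribˡ-+-* 2 b (m ℕ.* b)) ⟨
      ι (2 ℕ.^ (suc m ℕ.* b)) ∎
      where open ≤-Reasoning

    head-term : ∀ {m} {y : Fin (suc m) → ℚ} → (∀ i → -2ℚ ≤ y i) →
      ι (4 ℕ.^ J) * y zero * Π J (y ∘ suc) ≤ Π J y
    head-term lo = *-monoʳ _ (Π≥0 (lo ∘ suc)) (4^Jy≤G J (lo zero))

    -- Each of the `m` summands is at most the full product, because 4^J y ≤ G y.
    Φ≤mΠ : ∀ {m} {y : Fin m → ℚ} → (∀ i → -2ℚ ≤ y i) → Φ J y ≤ ι m * Π J y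
    Φ≤mΠ {zero}      lo = ≤-reflexive (sym (trans (cong (_* 1ℚ) ι-0) (*-zeroˡ 1ℚ)))
    Φ≤mΠ {suc m} {y} lo = begin
      ι (4 ℕ.^ J) * y zero * P + g * Φ J (y ∘ suc) ≤⟨ +-mono-≤ (head-term {y = y} lo) (*-monoˡ g (G≥0 (lo zero)) (Φ≤mΠ (lo ∘ suc))) ⟩
      g * P + g * (ι m * P) ≡⟨ e g P (ι m) ⟩
      (1ℚ + ι m) * (g * P) ≡⟨ cong (_* (g * P)) (ι-suc m) ⟨
      ι (suc m) * (g * P) ∎
      where
      open ≤-Reasoning
      g = G J (y zero)
      P = Π J (y ∘ suc)
      e : ∀ g P m → g * P + g * (m * P) ≡ (1ℚ + m) * (g * P)
      e = solve-∀ ring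

    -- A single very negative y_i, where G is at most 3, outweighs all other terms.
    Φ-negative : ∀ R {m} {y : Fin m → ℚ} → (∀ i → -2ℚ ≤ y i) → ∀ i → ι (4 ℕ.^ J) * y i ≤ - (ι 3 * ι R) →
      Φ J y + (1ℚ + ι R) * Π J y ≤ ι m * Π J y
    Φ-negative R {suc m} {y} lo zero neg = begin
      ι (4 ℕ.^ J) * y zero * P + g * Φ J (y ∘ suc) + (1ℚ + ι R) * (g * P)
        ≤⟨ +-monoˡ-≤ ((1ℚ + ι R) * (g * P)) (+-mono-≤ (*-monoʳ P (Π≥0 (lo ∘ suc)) x≤) (*-monoˡ g (G≥0 (lo zero)) (Φ≤mΠ (lo ∘ suc)))) ⟩
      - (g * ι R) * P + g * (ι m * P) + (1ℚ + ι R) * (g * P) ≡⟨ e g P (ι R) (ι m) ⟩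
      (1ℚ + ι m) * (g * P) ≡⟨ cong (_* (g * P)) (ι-suc m) ⟨
      ι (suc m) * (g * P) ∎
      where
      open ≤-Reasoning
      g = G J (y zero)
      P = Π J (y ∘ suc)
      e : ∀ g P R m → - (g * R) * P + g * (m * P) + (1ℚ + R) * (g * P) ≡ (1ℚ + m) * (g * P)
      e = solve-∀ ring
      4^J>0 : 0ℚ < ι (4 ℕ.^ J)
      4^J>0 = 0<ι (ℕ.m^n>0 4 J)
      y≤0 : y zero ≤ 0ℚ
      y≤0 = *-cancelˡ (ι (4 ℕ.^ J)) 4^J>0 (≤-trans neg (≤-trans (neg-antimono-≤ (*-nonneg (0≤ι 3) (0≤ι R)))
              (≤-reflexive (sym (*-zeroʳ (ι (4 ℕ.^ J)))))))
      x≤ : ι (4 ℕ.^ J) * y zero ≤ - (g * ι R)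
      x≤ = ≤-trans neg (neg-antimono-≤ (*-monoʳ (ι R) (0≤ι R) (G≤3 J (lo zero) y≤0)))
    Φ-negative R {suc m} {y} lo (suc i) neg = begin
      ι (4 ℕ.^ J) * y zero * P + g * Φ' + (1ℚ + ι R) * (g * P)
        ≡⟨ e₁ (ι (4 ℕ.^ J) * y zero * P) g Φ' (ι R) P ⟩
      ι (4 ℕ.^ J) * y zero * P + g * (Φ' + (1ℚ + ι R) * P)
        ≤⟨ +-mono-≤ (head-term {y = y} lo) (*-monoˡ g (G≥0 (lo zero)) (Φ-negative R (lo ∘ suc) i neg)) ⟩
      g * P + g * (ι m * P) ≡⟨ e₂ g P (ι m) ⟩
      (1ℚ + ι m) * (g * P) ≡⟨ cong (_* (g * P)) (ι-suc m) ⟨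
      ι (suc m) * (g * P) ∎
      where
      open ≤-Reasoning
      g = G J (y zero)
      P = Π J (y ∘ suc)
      Φ' = Φ J (y ∘ suc)
      e₁ : ∀ a g F R P → a + g * F + (1ℚ + R) * (g * P) ≡ a + g * (F + (1ℚ + R) * P)
      e₁ = solve-∀ ring
      e₂ : ∀ g P m → g * P + g * (m * P) ≡ (1ℚ + m) * (g * P)
      e₂ = solve-∀ ring

    -- Taking `R = m` in `Φ-negative` cancels `m Π` and leaves Φ ≤ - Π ≤ -1. This is the origin of
    -- the threshold -3r for a very negative kernel.
    Φ≤-1 : ∀ {m} {y : Fin m → ℚ} → (∀ i → -2ℚ ≤ y i) → ∀ i → ι (4 ℕ.^ J) * y i ≤ - (ι 3 * ι m) → Φ J y + 1ℚ ≤ 0ℚ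
    Φ≤-1 {m} {y} lo i neg = ≤-diff (subst (0ℚ ≤_) (e (Φ J y) (ι m) (Π J y))
        (+-nonneg (diff-≥0 (Φ-negative m lo i neg)) (diff-≥0 (Π≥1 lo))))
      where
      e : ∀ F m P → m * P - (F + (1ℚ + m) * P) + (P - 1ℚ) ≡ 0ℚ - (F + 1ℚ)
      e = solve-∀ ring

-- From positive definiteness to many good pairs or many large kernels.

module Geometric where

  open Chebyshev
  open Counting
  open Kernels
  open Powers
  open RationalOrder
  open import Data.Bool using (true; false; _∧_)
  open import Data.Fin using (Fin; zero; suc; toℕ; fromℕ<)
  open import Data.Fin.Properties using (any?; all?; ¬∀⟶∃¬; toℕ-fromℕ<)
  open import Data.Nat as ℕ using (ℕ; zero; suc; _+_; _*_; _^_; _<_; s≤s; z≤n)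
  open import Data.Nat.Properties as ℕ using ()
  open import Data.Nat.Tactic.RingSolver as ℕ using ()
  open import Data.Product using (∃; _×_; _,_)
  open import Data.Rational as ℚ using (ℚ; 0ℚ; 1ℚ; -_)
  import Data.Rational.Properties as ℚ
  open import Data.Sum using (_⊎_; inj₁; inj₂)
  open import Function using (_∘_)
  open import Relation.Binary.PropositionalEquality hiding (J)
  open import Relation.Nullary using (Dec; yes; no; does; ¬_; contradiction)
  open import Relation.Nullary.Decidable using (dec-true)
  open import Tactic.RingSolver using (solve-∀)

  -- The shares 1/2, 1/4, ... add up to at most 1; the recursion doubles `c` to pass to the tail.
  geometric-sum : ∀ {N M} c (u : Fin N → ℕ) → (∀ j → c * 2 ^ suc (toℕ j) * u j ℕ.≤ M) → c * sum u ℕ.≤ M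
  geometric-sum {zero}      c u u≤ = ℕ.≤-trans (ℕ.≤-reflexive (ℕ.*-zeroʳ c)) z≤n
  geometric-sum {suc N} {M} c u u≤ = ℕ.*-cancelˡ-≤ 2 (begin
    2 * (c * (u zero + s)) ≡⟨ e₁ c (u zero) s ⟩
    c * 2 * u zero + (c * 2) * s ≤⟨ ℕ.+-mono-≤ (u≤ zero) (geometric-sum (c * 2) (u ∘ suc) tail≤) ⟩
    M + M ≡⟨ cong (M +_) (ℕ.+-identityʳ M) ⟨
    2 * M ∎)
    where
    open ℕ.≤-Reasoning
    s = sum (u ∘ suc)
    e₁ : ∀ c a s → 2 * (c * (a + s)) ≡ c * 2 * a + (c * 2) * s
    e₁ = ℕ.solve-∀
    tail≤ : ∀ j → c * 2 * 2 ^ suc (toℕ j) * u (suc j) ℕ.≤ M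
    tail≤ j = ℕ.≤-trans (ℕ.≤-reflexive (cong (_* u (suc j)) (ℕ.*-assoc c 2 (2 ^ suc (toℕ j))))) (u≤ (suc j))

  does⇒ : ∀ {P : Set} (d : Dec P) → does d ≡ true → P
  does⇒ (yes p) _ = p

  𝟙-∧ : ∀ a c b → 𝟙 a * (c * 𝟙 b) ≡ c * 𝟙 (a ∧ b)
  𝟙-∧ true  c b = ℕ.+-identityʳ _
  𝟙-∧ false c b = sym (ℕ.*-zeroʳ c)

  weighted-count : ∀ {n} (X S : Subset n) c → sum (λ y → 𝟙 (X y) * (c * 𝟙 (S y))) ≡ c * count (X ∩ S)
  weighted-count X S c = trans (sum-cong-≗ λ y → 𝟙-∧ (X y) c (S y)) (sym (*-distribˡ-sum c (𝟙 ∘ (X ∩ S))))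

  module PairCounting {n r : ℕ} (i₀ N : ℕ) (X : Subset n) (K : Fin r → Kernel n)
    (psd : ∀ l → PSD (K l))
    (lo : ∀ l {x y} → x ∈ X → y ∈ X → -2ℚ ℚ.≤ K l x y)
    (hi : ∀ l {x y} → x ∈ X → y ∈ X → K l x y ℚ.≤ 1ℚ)
    (X≢∅ : 0 < count X) where

    J : ℕ
    J = N + i₀

    scaled : Fin r → Kernel n
    scaled l x y = ι (4 ^ J) ℚ.* K l x y

    opaque
      Good : Fin n → Subset n
      Good x y = does (all? λ l → - (ι 3 ℚ.* ι r) ℚ.≤? scaled l x y)

      Large : ℕ → Fin r → Fin n → Subset n
      Large i l x y = does (ι (4 ^ i) ℚ.≤? scaled l x y)

      good : ∀ {x y} → (∀ l → - (ι 3 ℚ.* ι r) ℚ.≤ scaled l x y) → y ∈ Good x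
      good {x} {y} g = mem (dec-true (all? λ l → - (ι 3 ℚ.* ι r) ℚ.≤? scaled l x y) g)

      good⇒ : ∀ {x y} → y ∈ Good x → ∀ l → - (ι 3 ℚ.* ι r) ℚ.≤ scaled l x y
      good⇒ {x} {y} (mem p) = does⇒ (all? λ l → - (ι 3 ℚ.* ι r) ℚ.≤? scaled l x y) p

      large : ∀ {i l x y} → ι (4 ^ i) ℚ.≤ scaled l x y → y ∈ Large i l x
      large {i} {l} {x} {y} le = mem (dec-true (ι (4 ^ i) ℚ.≤? scaled l x y) le)

      large⇒ : ∀ {i l x y} → y ∈ Large i l x → ι (4 ^ i) ℚ.≤ scaled l x y
      large⇒ {i} {l} {x} {y} (mem p) = does⇒ (ι (4 ^ i) ℚ.≤? scaled l x y) p

    -- `3 * 2 ^ i` bits for each of the `r` factors `G`, and `r` more bits for the factor r + 1 in φ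
    -- + 1 ≤ (r + 1) Π.
    A : ℕ → ℕ
    A i = 2 ^ (r * (3 * 2 ^ i) + r)

    -- An integer majorant of φ + 1 on `X`. A pair with a very negative kernel has φ + 1 ≤ 0 and
    -- needs no charge; any other pair is paid for by the level that its largest kernel reaches, or
    -- by `Good` if it reaches none.
    bound : Fin n → Fin n → ℕ
    bound x y = A i₀ * 𝟙 (Good x y)
      + sum (λ (j : Fin N) → sum (λ l → A (suc (toℕ j + i₀)) * 𝟙 (Large (toℕ j + i₀) l x y)))

    φ : Kernel n
    φ x y = Φ J (λ l → K l x y)

    φ+1≤A : ∀ {x y} → x ∈ X → y ∈ X → ∀ j → j ℕ.≤ N → (∀ l → scaled l x y ℚ.≤ ι (4 ^ (j + i₀))) →
      φ x y ℚ.+ 1ℚ ℚ.≤ ι (A (j + i₀))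
    φ+1≤A {x} {y} x∈X y∈X j j≤N small = begin
      φ x y ℚ.+ 1ℚ ≤⟨ ℚ.+-mono-≤ (Φ≤mΠ J lo') (Π≥1 J lo') ⟩
      ι r ℚ.* P ℚ.+ P ≡⟨ e (ι r) P ⟩
      (1ℚ ℚ.+ ι r) ℚ.* P ≡⟨ cong (ℚ._* P) (ι-suc r) ⟨
      ι (suc r) ℚ.* P ≤⟨ *-mono (0≤ι (suc r)) (0≤ι (2 ^ b)) (ι-mono (m<2^m r)) P≤ ⟩
      ι (2 ^ r) ℚ.* ι (2 ^ b) ≡⟨ ι-* (2 ^ r) (2 ^ b) ⟨
      ι (2 ^ r * 2 ^ b) ≡⟨ cong ι (trans (ℕ.*-comm (2 ^ r) (2 ^ b)) (sym (ℕ.^-distribˡ-+-* 2 b r))) ⟩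
      ι (2 ^ (b + r)) ∎
      where
      open ℚ.≤-Reasoning
      P = Π J (λ l → K l x y)
      b = r * (3 * 2 ^ (j + i₀))
      lo' : ∀ l → -2ℚ ℚ.≤ K l x y
      lo' l = lo l x∈X y∈X
      e : ∀ R P → R ℚ.* P ℚ.+ P ≡ (1ℚ ℚ.+ R) ℚ.* P
      e = solve-∀ ring
      J≡ : (N ℕ.∸ j) + (j + i₀) ≡ J
      J≡ = trans (sym (ℕ.+-assoc (N ℕ.∸ j) j i₀)) (cong (_+ i₀) (ℕ.m∸n+n≡m j≤N))
      P≤ : P ℚ.≤ ι (2 ^ b)
      P≤ = Π-upper J (3 * 2 ^ (j + i₀)) lo' λ l →
        subst (λ z → G z (K l x y) ℚ.≤ ι (2 ^ (3 * 2 ^ (j + i₀)))) J≡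
          (G-upper (N ℕ.∸ j) (j + i₀) (lo' l) (subst (λ z → ι (4 ^ z) ℚ.* K l x y ℚ.≤ ι (4 ^ (j + i₀))) (sym J≡) (small l)))

    φ+1≤bound : ∀ {x y} → x ∈ X → y ∈ X → φ x y ℚ.+ 1ℚ ℚ.≤ ι (bound x y)
    φ+1≤bound {x} {y} x∈X y∈X = cases (all? (λ l → - (ι 3 ℚ.* ι r) ℚ.≤? scaled l x y))
      where
      rest : ℕ
      rest = sum (λ (j : Fin N) → sum (λ l → A (suc (toℕ j + i₀)) * 𝟙 (Large (toℕ j + i₀) l x y)))
      top : ∀ l → scaled l x y ℚ.≤ ι (4 ^ J)
      top l = subst (scaled l x y ℚ.≤_) (ℚ.*-identityʳ (ι (4 ^ J))) (*-monoˡ (ι (4 ^ J)) (0≤ι (4 ^ J)) (hi l x∈X y∈X))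
      -- Level `J` always holds because K ≤ 1. The descent stops at the highest level whose
      -- threshold some kernel meets, and `A` of the next level bounds φ + 1 there.
      descend : ∀ j → j ℕ.≤ N → (∀ l → scaled l x y ℚ.≤ ι (4 ^ (j + i₀))) → φ x y ℚ.+ 1ℚ ℚ.≤ ι (A i₀ * 1 + rest)
      descend zero j≤N small = ℚ.≤-trans (φ+1≤A x∈X y∈X zero j≤N small)
        (ι-mono (ℕ.≤-trans (ℕ.≤-reflexive (sym (ℕ.*-identityʳ (A i₀)))) (ℕ.m≤m+n _ rest)))
      descend (suc j) j<N small = split (any? (λ l → ι (4 ^ (j + i₀)) ℚ.≤? scaled l x y))
        where
        open ℕ.≤-Reasoning
        j' = fromℕ< j<N
        split : Dec (∃ λ l → ι (4 ^ (j + i₀)) ℚ.≤ scaled l x y) → φ x y ℚ.+ 1ℚ ℚ.≤ ι (A i₀ * 1 + rest)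
        split (no none) = descend j (ℕ.<⇒≤ j<N) λ l → ℚ.<⇒≤ (ℚ.≰⇒> λ le → none (l , le))
        split (yes (l , le)) = ℚ.≤-trans (φ+1≤A x∈X y∈X (suc j) j<N small) (ι-mono (begin
          A (suc (j + i₀)) ≡⟨ ℕ.*-identityʳ _ ⟨
          A (suc (j + i₀)) * 1
            ≡⟨ cong (λ z → A (suc (j + i₀)) * 𝟙 z) (_∈_.holds (large {j + i₀} {l} le)) ⟨
          A (suc (j + i₀)) * 𝟙 (Large (j + i₀) l x y)
            ≡⟨ cong (λ z → A (suc (z + i₀)) * 𝟙 (Large (z + i₀) l x y)) (toℕ-fromℕ< j<N) ⟨
          A (suc (toℕ j' + i₀)) * 𝟙 (Large (toℕ j' + i₀) l x y)
            ≤⟨ ≤-sum (λ l → A (suc (toℕ j' + i₀)) * 𝟙 (Large (toℕ j' + i₀) l x y)) l ⟩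
          sum (λ l → A (suc (toℕ j' + i₀)) * 𝟙 (Large (toℕ j' + i₀) l x y))
            ≤⟨ ≤-sum (λ (j : Fin N) → sum (λ l → A (suc (toℕ j + i₀)) * 𝟙 (Large (toℕ j + i₀) l x y))) j' ⟩
          rest ≤⟨ ℕ.m≤n+m rest _ ⟩
          A i₀ * 1 + rest ∎))
      cases : Dec (∀ l → - (ι 3 ℚ.* ι r) ℚ.≤ scaled l x y) → φ x y ℚ.+ 1ℚ ℚ.≤ ι (bound x y)
      cases (yes g) = subst (λ z → φ x y ℚ.+ 1ℚ ℚ.≤ ι (A i₀ * 𝟙 z + rest)) (sym (_∈_.holds (good g))) (descend N ℕ.≤-refl top)
      cases (no ¬g) = ℚ.≤-trans (φ≤-1 (¬∀⟶∃¬ r _ (λ l → - (ι 3 ℚ.* ι r) ℚ.≤? scaled l x y) ¬g)) (0≤ι (bound x y))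
        where
        φ≤-1 : ∃ (λ l → ¬ (- (ι 3 ℚ.* ι r) ℚ.≤ scaled l x y)) → φ x y ℚ.+ 1ℚ ℚ.≤ 0ℚ
        φ≤-1 (l , neg) = Φ≤-1 J (λ l → lo l x∈X y∈X) l (ℚ.<⇒≤ (ℚ.≰⇒> neg))

    total : Fin n → ℕ
    total x = sum (λ y → 𝟙 (X y) * bound x y)

    total-expand : ∀ x → total x ≡ A i₀ * count (X ∩ Good x)
      + sum (λ (j : Fin N) → sum (λ l → A (suc (toℕ j + i₀)) * count (X ∩ Large (toℕ j + i₀) l x)))
    total-expand x = begin
      sum (λ y → 𝟙 (X y) * bound x y)
        ≡⟨ sum-cong-≗ (λ y → trans (ℕ.*-distribˡ-+ (𝟙 (X y)) _ _) (cong (g y +_)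
             (trans (*-distribˡ-sum {N} (𝟙 (X y)) _) (sum-cong-≗ {N} λ j → *-distribˡ-sum {r} (𝟙 (X y)) _)))) ⟩
      sum (λ y → g y + sum (λ j → sum (λ l → h j l y)))
        ≡⟨ ∑-distrib-+ g _ ⟩
      sum g + sum (λ y → sum (λ j → sum (λ l → h j l y)))
        ≡⟨ cong₂ _+_ (weighted-count X (Good x) (A i₀)) (trans (∑-comm (λ y j → sum (λ l → h j l y)))
            (sum-cong-≗ λ j → trans (∑-comm (λ y l → h j l y))
               (sum-cong-≗ λ l → weighted-count X (Large (toℕ j + i₀) l x) (A (suc (toℕ j + i₀)))))) ⟩
      _ ∎
      where
      open ≡-Reasoning
      g : Fin n → ℕ
      g y = 𝟙 (X y) * (A i₀ * 𝟙 (Good x y))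
      h : Fin N → Fin r → Fin n → ℕ
      h j l y = 𝟙 (X y) * (A (suc (toℕ j + i₀)) * 𝟙 (Large (toℕ j + i₀) l x y))

    -- Positive definiteness enters here: the sum of φ over X × X is non-negative, so adding 1 to
    -- every pair gives |X|² ≤ Σ (φ + 1) ≤ Σ `bound`.
    sum-total : count X * count X ℕ.≤ sum (λ x → 𝟙 (X x) * total x)
    sum-total = ι-cancel (begin
      ι (count X * count X) ≡⟨ cong ι square-count ⟩
      ι (sum λ x → sum λ y → 𝟙 (X x) * 𝟙 (X y)) ≡⟨ ∑∑-ι (λ x y → 𝟙 (X x) * 𝟙 (X y)) ⟨
      (∑ λ x → ∑ λ y → ι (𝟙 (X x) * 𝟙 (X y))) ≤⟨ ≤-by quad (ℚ.+-comm quad _) (PSD-sum (PSD-* (square (ι ∘ 𝟙 ∘ X)) (PSD-Φ J K psd))) ⟩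
      (∑ λ x → ∑ λ y → ι (𝟙 (X x)) ℚ.* ι (𝟙 (X y)) ℚ.* φ x y) ℚ.+ (∑ λ x → ∑ λ y → ι (𝟙 (X x) * 𝟙 (X y)))
        ≡⟨ ∑-+ {n} _ _ ⟨
      (∑ λ x → (∑ λ y → ι (𝟙 (X x)) ℚ.* ι (𝟙 (X y)) ℚ.* φ x y) ℚ.+ (∑ λ y → ι (𝟙 (X x) * 𝟙 (X y))))
        ≡⟨ ∑-cong {n} (λ x → sym (∑-+ {n} _ _)) ⟩
      (∑ λ x → ∑ λ y → ι (𝟙 (X x)) ℚ.* ι (𝟙 (X y)) ℚ.* φ x y ℚ.+ ι (𝟙 (X x) * 𝟙 (X y)))
        ≤⟨ ∑-mono (λ x → ∑-mono (λ y → pointwise x y)) ⟩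
      (∑ λ x → ∑ λ y → ι (𝟙 (X x) * (𝟙 (X y) * bound x y)))
        ≡⟨ ∑∑-ι (λ x y → 𝟙 (X x) * (𝟙 (X y) * bound x y)) ⟩
      ι (sum λ x → sum λ y → 𝟙 (X x) * (𝟙 (X y) * bound x y))
        ≡⟨ cong ι (sum-cong-≗ {n} λ x → sym (*-distribˡ-sum {n} (𝟙 (X x)) _)) ⟩
      ι (sum λ x → 𝟙 (X x) * total x) ∎)
      where
      open ℚ.≤-Reasoning
      quad : ℚ
      quad = ∑ λ x → ∑ λ y → ι (𝟙 (X x)) ℚ.* ι (𝟙 (X y)) ℚ.* φ x y
      ∑∑-ι : (f : Fin n → Fin n → ℕ) → (∑ λ x → ∑ λ y → ι (f x y)) ≡ ι (sum λ x → sum (f x))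
      ∑∑-ι f = trans (∑-cong λ x → ∑-ι (f x)) (∑-ι (λ x → sum (f x)))
      square-count : count X * count X ≡ sum (λ x → sum (λ y → 𝟙 (X x) * 𝟙 (X y)))
      square-count = trans (*-distribʳ-sum (count X) (𝟙 ∘ X)) (sum-cong-≗ λ x → *-distribˡ-sum (𝟙 (X x)) (𝟙 ∘ X))
      zero₁ : ∀ b F → 0ℚ ℚ.* b ℚ.* F ℚ.+ 0ℚ ≡ 0ℚ
      zero₁ = solve-∀ ring
      zero₂ : ∀ b F → b ℚ.* 0ℚ ℚ.* F ℚ.+ 0ℚ ≡ 0ℚ
      zero₂ = solve-∀ ring
      pointwise : ∀ x y → ι (𝟙 (X x)) ℚ.* ι (𝟙 (X y)) ℚ.* φ x y ℚ.+ ι (𝟙 (X x) * 𝟙 (X y))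
                        ℚ.≤ ι (𝟙 (X x) * (𝟙 (X y) * bound x y))
      pointwise x y with X x in ex | X y in ey
      ... | false | b     = ℚ.≤-reflexive (trans (cong₂ (λ u v → u ℚ.* ι (𝟙 b) ℚ.* φ x y ℚ.+ v) ι-0 ι-0)
                              (trans (zero₁ (ι (𝟙 b)) (φ x y)) (sym ι-0)))
      ... | true  | false = ℚ.≤-reflexive (trans (cong₂ (λ u v → ι 1 ℚ.* u ℚ.* φ x y ℚ.+ v) ι-0 ι-0)
                              (trans (zero₂ (ι 1) (φ x y)) (sym ι-0)))
      ... | true  | true  = begin
        ι 1 ℚ.* ι 1 ℚ.* φ x y ℚ.+ ι 1 ≡⟨ cong (λ u → u ℚ.* u ℚ.* φ x y ℚ.+ u) ι-1 ⟩
        1ℚ ℚ.* 1ℚ ℚ.* φ x y ℚ.+ 1ℚ ≡⟨ cong (ℚ._+ 1ℚ) (ℚ.*-identityˡ (φ x y)) ⟩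
        φ x y ℚ.+ 1ℚ ≤⟨ φ+1≤bound (mem ex) (mem ey) ⟩
        ι (bound x y) ≡⟨ cong ι (trans (sym (ℕ.+-identityʳ (bound x y))) (sym (ℕ.+-identityʳ _))) ⟩
        ι (1 * (1 * bound x y)) ∎

    -- A total of |X| is shared out: one half to `Good`, the part 2^-(2+j) to level `j`, divided
    -- further by 2^r ≥ r among the colours. If every share were missed, the total would fall short.
    Rich : Fin n → Set
    Rich x = (count X ℕ.≤ 2 * (A i₀ * count (X ∩ Good x)))
      ⊎ ∃ λ (j : Fin N) → ∃ λ l →
          count X ℕ.≤ 2 ^ (r + (2 + toℕ j)) * (A (suc (toℕ j + i₀)) * count (X ∩ Large (toℕ j + i₀) l x))

    total⇒rich : ∀ x → count X ℕ.≤ total x → Rich x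
    total⇒rich x le with count X ℕ.≤? 2 * (A i₀ * count (X ∩ Good x))
    ... | yes p = inj₁ p
    ... | no ¬p with any? (λ (j : Fin N) → any? λ l →
                  count X ℕ.≤? 2 ^ (r + (2 + toℕ j)) * (A (suc (toℕ j + i₀)) * count (X ∩ Large (toℕ j + i₀) l x)))
    ...   | yes q = inj₂ q
    ...   | no ¬q = contradiction (ℕ.*-monoʳ-≤ 2 (subst (count X ℕ.≤_) (total-expand x) le)) (ℕ.<⇒≱ (begin-strict
      2 * (c₀ + sum u) ≡⟨ ℕ.*-distribˡ-+ 2 c₀ (sum u) ⟩
      2 * c₀ + 2 * sum u <⟨ ℕ.+-mono-<-≤ (ℕ.≰⇒> ¬p) (geometric-sum 2 u u≤) ⟩
      count X + count X ≡⟨ cong (count X +_) (ℕ.+-identityʳ (count X)) ⟨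
      2 * count X ∎))
      where
      open ℕ.≤-Reasoning
      c₀ = A i₀ * count (X ∩ Good x)
      v : Fin N → Fin r → ℕ
      v j l = A (suc (toℕ j + i₀)) * count (X ∩ Large (toℕ j + i₀) l x)
      u : Fin N → ℕ
      u j = sum (v j)
      u≤ : ∀ j → 2 * 2 ^ suc (toℕ j) * u j ℕ.≤ count X
      u≤ j = ℕ.*-cancelˡ-≤ (2 ^ r) {{ℕ.m^n≢0 2 r}} (begin
        2 ^ r * (2 ^ (2 + toℕ j) * u j) ≡⟨ ℕ.*-assoc (2 ^ r) (2 ^ (2 + toℕ j)) (u j) ⟨
        2 ^ r * 2 ^ (2 + toℕ j) * u j ≡⟨ cong (_* u j) (sym (ℕ.^-distribˡ-+-* 2 r (2 + toℕ j))) ⟩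
        2 ^ (r + (2 + toℕ j)) * u j ≡⟨ *-distribˡ-sum (2 ^ (r + (2 + toℕ j))) (v j) ⟩
        sum (λ l → 2 ^ (r + (2 + toℕ j)) * v j l) ≤⟨ sum-mono (λ l → ℕ.<⇒≤ (ℕ.≰⇒> λ le → ¬q (j , l , le))) ⟩
        sum {r} (λ _ → count X) ≡⟨ sum-const r (count X) ⟩
        r * count X ≤⟨ ℕ.*-monoˡ-≤ (count X) (ℕ.<⇒≤ (m<2^m r)) ⟩
        2 ^ r * count X ∎)

    exists-rich : ∃ λ x → x ∈ X × Rich x
    -- `suc (total x)` makes the average inequality strict; the non-emptiness of `X` supplies the
    -- difference.
    exists-rich = from-pigeon (pigeonhole (λ x → 𝟙 (X x) * count X) (λ x → 𝟙 (X x) * suc (total x)) (begin-strict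
      sum (λ x → 𝟙 (X x) * count X) ≡⟨ *-distribʳ-sum (count X) (𝟙 ∘ X) ⟨
      count X * count X <⟨ ℕ.m<n+m (count X * count X) X≢∅ ⟩
      count X + count X * count X ≤⟨ ℕ.+-monoʳ-≤ (count X) sum-total ⟩
      count X + sum (λ x → 𝟙 (X x) * total x) ≡⟨ ∑-distrib-+ (𝟙 ∘ X) _ ⟨
      sum (λ x → 𝟙 (X x) + 𝟙 (X x) * total x) ≡⟨ sum-cong-≗ (λ x → sym (ℕ.*-suc (𝟙 (X x)) (total x))) ⟩
      sum (λ x → 𝟙 (X x) * suc (total x)) ∎))
      where
      open ℕ.≤-Reasoning
      from-pigeon : ∃ (λ x → 𝟙 (X x) * count X < 𝟙 (X x) * suc (total x)) → ∃ λ x → x ∈ X × Rich x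
      from-pigeon (x , lt) with X x in eq
      ... | true = x , mem eq , total⇒rich x (ℕ.≤-pred (subst₂ _<_ (ℕ.+-identityʳ _) (ℕ.+-identityʳ _) lt))

-- One step of the book: density kernels and its two outcomes.

module KeyLemma where

  open Chebyshev
  open Cliques
  open Counting
  open Geometric
  open Kernels
  open Powers
  open RationalOrder
  open import Data.Bool using (true; false; _∧_)
  open import Data.Fin using (Fin; zero; suc; toℕ)
  open import Data.Nat as ℕ using (ℕ; zero; suc; _^_)
  import Data.Nat.Properties as ℕ
  open import Data.Nat.Tactic.RingSolver as ℕ using ()
  open import Data.Product using (∃; _×_; _,_; proj₁; proj₂)
  open import Data.Rational
  open import Data.Rational.Properties
  open import Data.Sum using (_⊎_; inj₁; inj₂)
  open import Function using (_∘_)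
  open import Relation.Binary.PropositionalEquality hiding (J)
  open import Relation.Nullary using (yes; no; ¬_; contradiction)
  open import Tactic.RingSolver using (solve-∀)

  least-above : ∀ N {q} → q ≤ ι N → ∃ λ d → q ≤ ι d × (∀ m → q ≤ ι m → d ℕ.≤ m)
  least-above zero    q≤ = zero , q≤ , λ _ _ → ℕ.z≤n
  least-above (suc N) {q} q≤ with q ≤? ι N
  ... | yes q≤N = least-above N q≤N
  ... | no q≰N  = suc N , q≤ , λ m q≤m → ℕ.≰⇒> λ m≤N → q≰N (≤-trans q≤m (ι-mono m≤N))

  module OneColour {n : ℕ} (r J : ℕ) (r>0 : 0 ℕ.< r) (X Y : Subset n) (nbr : Fin n → Subset n) (P α : ℚ)
    (X≢∅ : 0 ℕ.< count X) (Y≢∅ : 0 ℕ.< count Y) (P>0 : 0ℚ < P) (α>0 : 0ℚ < α)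
    (α-large : ι (3 ℕ.* r) ≤ ι (4 ^ J) * α)
    (dense : ∀ {x} → x ∈ X → P * ι (count Y) ≤ ι (count (nbr x ∩ Y))) where

    private
      y : ℚ
      y = ι (count Y)
      y>0 : 0ℚ < y
      y>0 = 0<ι Y≢∅
      threshold : ∃ λ d → P * y ≤ ι d × (∀ m → P * y ≤ ι m → d ℕ.≤ m)
      threshold = least-above _ (dense (proj₂ (inhabited X X≢∅)))

    size : ℕ
    size = proj₁ threshold

    P·y≤size : P * y ≤ ι size
    P·y≤size = proj₁ (proj₂ threshold)

    private
      d : ℚ
      d = ι size
      d>0 : 0ℚ < d
      d>0 = <-≤-trans (*-pos P>0 y>0) P·y≤size
      choice : ∀ x → ∃ λ S → x ∈ X → S ⊆ (nbr x ∩ Y) × count S ≡ size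
      choice x with x ∈? X
      ... | no x∉X  = Y , λ x∈X → contradiction x∈X x∉X
      ... | yes x∈X with trim (nbr x ∩ Y) size (proj₂ (proj₂ threshold) _ (dense x∈X))
      ...   | S , S⊆ , c = S , λ _ → S⊆ , c

    -- Equal-sized subsets of the neighbourhoods make the kernel below a centred one.
    opaque
      M : Fin n → Subset n
      M x = proj₁ (choice x)

      M⊆ : ∀ {x} → x ∈ X → M x ⊆ (nbr x ∩ Y)
      M⊆ {x} x∈X = proj₁ (proj₂ (choice x) x∈X)

      M-size : ∀ {x} → x ∈ X → count (M x) ≡ size
      M-size {x} x∈X = proj₂ (proj₂ (choice x) x∈X)

    private
      χ : Subset n → Fin n → ℚ
      χ S v = ι (𝟙 (S v))

      -- The Gram kernel of the functions y χ(M x) - d on `Y`. They have mean zero there since all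
      -- `M x` have `d` elements, so only the intersection `M x ∩ M x'` survives.
      S : Kernel n
      S x x' = ∑ λ v → χ Y v * ((y * χ (M x) v - d) * (y * χ (M x') v - d))

      S-psd : PSD S
      S-psd = PSD-∑ _ λ v → scale (χ Y v) (0≤ι (𝟙 (Y v))) (square λ x → y * χ (M x) v - d)

      m : Fin n → Fin n → ℚ
      m x x' = ι (count (M x ∩ M x'))

      -- z / (d y) = m / d - d / y: the density of `M x'` inside `M x` minus its density inside `Y`.
      z : Kernel n
      z x x' = y * m x x' - d * d

      S≡yz : ∀ {x x'} → x ∈ X → x' ∈ X → S x x' ≡ y * z x x'
      S≡yz {x} {x'} x∈X x'∈X = begin
        S x x'
          ≡⟨ ∑-cong pointwise ⟩
        (∑ λ v → y * y * χ (M x ∩ M x') v + (- (y * d) * χ (M x) v + (- (y * d) * χ (M x') v + d * d * χ Y v)))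
          ≡⟨ trans (∑-+ {n} _ _) (cong (λ u → ∑ (λ v → y * y * χ (M x ∩ M x') v) + u)
               (trans (∑-+ {n} _ _) (cong (λ u → ∑ (λ v → - (y * d) * χ (M x) v) + u) (∑-+ {n} _ _)))) ⟩
        (∑ λ v → y * y * χ (M x ∩ M x') v) + ((∑ λ v → - (y * d) * χ (M x) v) + ((∑ λ v → - (y * d) * χ (M x') v) + (∑ λ v → d * d * χ Y v)))
          ≡⟨ cong₂ _+_ (total (y * y) (M x ∩ M x')) (cong₂ _+_ (total (- (y * d)) (M x)) (cong₂ _+_ (total (- (y * d)) (M x')) (total (d * d) Y))) ⟩
        y * y * m x x' + (- (y * d) * ι (count (M x)) + (- (y * d) * ι (count (M x')) + d * d * y))
          ≡⟨ cong₂ (λ u v → y * y * m x x' + (- (y * d) * ι u + (- (y * d) * ι v + d * d * y))) (M-size x∈X) (M-size x'∈X) ⟩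
        y * y * m x x' + (- (y * d) * d + (- (y * d) * d + d * d * y))
          ≡⟨ collect y d (m x x') ⟩
        y * z x x' ∎
        where
        open ≡-Reasoning
        collect : ∀ y d m → y * y * m + (- (y * d) * d + (- (y * d) * d + d * d * y)) ≡ y * (y * m - d * d)
        collect = solve-∀ ring
        total : ∀ c T → (∑ λ v → c * χ T v) ≡ c * ι (count T)
        total c T = trans (sym (*-distribˡ-∑ c (χ T))) (cong (c *_) (∑-ι (λ v → 𝟙 (T v))))
        expand : ∀ y d a b → 1ℚ * ((y * a - d) * (y * b - d)) ≡ y * y * (a * b) + (- (y * d) * a + (- (y * d) * b + d * d * 1ℚ))
        expand = solve-∀ ring
        vanish : ∀ y d t → 0ℚ * t ≡ y * y * 0ℚ + (- (y * d) * 0ℚ + (- (y * d) * 0ℚ + d * d * 0ℚ))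
        vanish = solve-∀ ring
        χ-∧ : ∀ a b → ι (𝟙 (a ∧ b)) ≡ ι (𝟙 a) * ι (𝟙 b)
        χ-∧ true  b = sym (trans (cong (_* ι (𝟙 b)) ι-1) (*-identityˡ _))
        χ-∧ false b = trans ι-0 (sym (trans (cong (_* ι (𝟙 b)) ι-0) (*-zeroˡ (ι (𝟙 b)))))
        outside : ∀ {x} → x ∈ X → ∀ v → ¬ (v ∈ Y) → χ (M x) v ≡ 0ℚ
        outside x∈X v v∉Y = trans (cong (ι ∘ 𝟙) (∉⇒false λ v∈M → v∉Y (∩-right {S = nbr _} (M⊆ x∈X v v∈M)))) ι-0
        pointwise : ∀ v → χ Y v * ((y * χ (M x) v - d) * (y * χ (M x') v - d))
          ≡ y * y * χ (M x ∩ M x') v + (- (y * d) * χ (M x) v + (- (y * d) * χ (M x') v + d * d * χ Y v))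
        pointwise v with v ∈? Y
        ... | yes (mem v∈Y) = begin
          χ Y v * t ≡⟨ cong (_* t) χY≡1 ⟩
          1ℚ * t ≡⟨ expand y d (χ (M x) v) (χ (M x') v) ⟩
          y * y * (χ (M x) v * χ (M x') v) + (- (y * d) * χ (M x) v + (- (y * d) * χ (M x') v + d * d * 1ℚ))
            ≡⟨ cong₂ (λ u w → y * y * u + (- (y * d) * χ (M x) v + (- (y * d) * χ (M x') v + d * d * w)))
                 (sym (χ-∧ (M x v) (M x' v))) (sym χY≡1) ⟩
          y * y * χ (M x ∩ M x') v + (- (y * d) * χ (M x) v + (- (y * d) * χ (M x') v + d * d * χ Y v)) ∎
          where
          t = (y * χ (M x) v - d) * (y * χ (M x') v - d)
          χY≡1 : χ Y v ≡ 1ℚ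
          χY≡1 = trans (cong (ι ∘ 𝟙) v∈Y) ι-1
        ... | no v∉Y = begin
          χ Y v * t ≡⟨ cong (_* t) χY≡0 ⟩
          0ℚ * t ≡⟨ vanish y d t ⟩
          y * y * 0ℚ + (- (y * d) * 0ℚ + (- (y * d) * 0ℚ + d * d * 0ℚ))
            ≡⟨ cong₂ (λ u w → y * y * u + (- (y * d) * 0ℚ + (- (y * d) * w + d * d * 0ℚ)))
                 (sym (trans (χ-∧ (M x v) (M x' v)) (trans (cong (_* χ (M x') v) (outside x∈X v v∉Y)) (*-zeroˡ (χ (M x') v)))))
                 (sym (outside x'∈X v v∉Y)) ⟩
          y * y * χ (M x ∩ M x') v + (- (y * d) * 0ℚ + (- (y * d) * χ (M x') v + d * d * 0ℚ))
            ≡⟨ cong₂ (λ u w → y * y * χ (M x ∩ M x') v + (- (y * d) * u + (- (y * d) * χ (M x') v + d * d * w)))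
                 (sym (outside x∈X v v∉Y)) (sym χY≡0) ⟩
          y * y * χ (M x ∩ M x') v + (- (y * d) * χ (M x) v + (- (y * d) * χ (M x') v + d * d * χ Y v)) ∎
          where
          t = (y * χ (M x) v - d) * (y * χ (M x') v - d)
          χY≡0 : χ Y v ≡ 0ℚ
          χY≡0 = trans (cong (ι ∘ 𝟙) (∉⇒false v∉Y)) ι-0

      Q : ℚ
      Q = ι (4 ^ J)
      R : ℚ
      R = ι 3 * ι r
      R>0 : 0ℚ < R
      R>0 = *-pos (0<ι {3} (ℕ.s≤s ℕ.z≤n)) (0<ι r>0)
      D : ℚ
      D = Q * (α * d * (y * y))
      D>0 : 0ℚ < D
      D>0 = *-pos (0<ι (ℕ.m^n>0 4 J)) (*-pos (*-pos α>0 d>0) (*-pos y>0 y>0))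
      w : ℚ
      w = proj₁ (reciprocal D D>0)
      w>0 : 0ℚ < w
      w>0 = proj₁ (proj₂ (reciprocal D D>0))
      wD≡1 : w * D ≡ 1ℚ
      wD≡1 = proj₂ (proj₂ (reciprocal D D>0))

    private
      c : ℚ
      c = α * d * y
      c>0 : 0ℚ < c
      c>0 = *-pos (*-pos α>0 d>0) y>0

    opaque
      -- Normalised so that 4^J K = 3r (m / d - d / y) / α. The level -3r is then a density loss of
      -- α, and the level 4^i a density gain of 4^i α / 3r.
      K : Kernel n
      K x x' = (R * w) * S x x'

      K-psd : PSD K
      K-psd = scale (R * w) (<⇒≤ (*-pos R>0 w>0)) S-psd

      scaled-K : ∀ {x x'} → x ∈ X → x' ∈ X → c * (Q * K x x') ≡ R * z x x'
      scaled-K {x} {x'} x∈X x'∈X = begin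
        c * (Q * ((R * w) * S x x')) ≡⟨ cong (λ s → c * (Q * ((R * w) * s))) (S≡yz x∈X x'∈X) ⟩
        c * (Q * ((R * w) * (y * z x x'))) ≡⟨ regroup α d y Q R w (z x x') ⟩
        (w * D) * (R * z x x') ≡⟨ cong (_* (R * z x x')) wD≡1 ⟩
        1ℚ * (R * z x x') ≡⟨ *-identityˡ _ ⟩
        R * z x x' ∎
        where
        open ≡-Reasoning
        regroup : ∀ α d y Q R w z → α * d * y * (Q * ((R * w) * (y * z))) ≡ (w * (Q * (α * d * (y * y)))) * (R * z)
        regroup = solve-∀ ring

    private
      size≤y : d ≤ y
      size≤y with inhabited X X≢∅
      ... | x , x∈X = ι-mono (subst (ℕ._≤ count Y) (M-size x∈X)
                        (count-mono {S = M x} {S' = Y} λ v v∈M → ∩-right {S = nbr x} (M⊆ x∈X v v∈M)))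

      m≤d : ∀ {x x'} → x ∈ X → m x x' ≤ d
      m≤d {x} {x'} x∈X = ι-mono (subst (count (M x ∩ M x') ℕ.≤_) (M-size x∈X)
                          (count-mono {S = M x ∩ M x'} {S' = M x} λ v → ∩-left {S = M x} {S' = M x'}))

      R≤Qα : R ≤ Q * α
      R≤Qα = subst (_≤ Q * α) (ι-* 3 r) α-large

      z≤dy : ∀ {x x'} → x ∈ X → z x x' ≤ d * y
      z≤dy {x} {x'} x∈X = ≤-diff (subst (0ℚ ≤_) (e y d (m x x'))
        (+-nonneg (*-nonneg (<⇒≤ y>0) (diff-≥0 (m≤d {x} {x'} x∈X))) (sq-nonneg d)))
        where
        e : ∀ y d m → y * (d - m) + d * d ≡ d * y - (y * m - d * d)
        e = solve-∀ ring

      -dy≤z : ∀ {x x'} → - (d * y) ≤ z x x'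
      -dy≤z {x} {x'} = ≤-diff (subst (0ℚ ≤_) (e y d (m x x'))
        (+-nonneg (*-nonneg (<⇒≤ y>0) (0≤ι (count (M x ∩ M x')))) (*-nonneg (<⇒≤ d>0) (diff-≥0 size≤y))))
        where
        e : ∀ y d m → y * m + d * (y - d) ≡ y * m - d * d - - (d * y)
        e = solve-∀ ring

      cQ>0 : 0ℚ < c * Q
      cQ>0 = *-pos c>0 (0<ι (ℕ.m^n>0 4 J))

      Rdy≤cQ : R * (d * y) ≤ c * Q
      Rdy≤cQ = subst (R * (d * y) ≤_) (e Q α d y) (*-monoʳ (d * y) (<⇒≤ (*-pos d>0 y>0)) R≤Qα)
        where
        e : ∀ Q α d y → Q * α * (d * y) ≡ α * d * y * Q
        e = solve-∀ ring

    -- Two densities differ by at most 1, so 4^J |K| ≤ 3r / α, which `α-large` bounds by 4^J. The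
    -- lower bound on `K` has the same reason.
    K≤1 : ∀ {x x'} → x ∈ X → x' ∈ X → K x x' ≤ 1ℚ
    K≤1 {x} {x'} x∈X x'∈X = *-cancelˡ (c * Q) cQ>0 (begin
      c * Q * K x x' ≡⟨ *-assoc c Q (K x x') ⟩
      c * (Q * K x x') ≡⟨ scaled-K x∈X x'∈X ⟩
      R * z x x' ≤⟨ *-monoˡ R (<⇒≤ R>0) (z≤dy {x} {x'} x∈X) ⟩
      R * (d * y) ≤⟨ Rdy≤cQ ⟩
      c * Q ≡⟨ *-identityʳ (c * Q) ⟨
      c * Q * 1ℚ ∎)
      where open ≤-Reasoning

    -2≤K : ∀ {x x'} → x ∈ X → x' ∈ X → -2ℚ ≤ K x x'
    -2≤K {x} {x'} x∈X x'∈X = ≤-trans -2≤-1 (*-cancelˡ (c * Q) cQ>0 (begin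
      c * Q * - 1ℚ ≡⟨ e₁ (c * Q) ⟩
      - (c * Q) ≤⟨ neg-antimono-≤ Rdy≤cQ ⟩
      - (R * (d * y)) ≡⟨ neg-distribʳ-* R (d * y) ⟩
      R * - (d * y) ≤⟨ *-monoˡ R (<⇒≤ R>0) (-dy≤z {x} {x'}) ⟩
      R * z x x' ≡⟨ scaled-K x∈X x'∈X ⟨
      c * (Q * K x x') ≡⟨ *-assoc c Q (K x x') ⟨
      c * Q * K x x' ∎))
      where
      open ≤-Reasoning
      e₁ : ∀ c → c * - 1ℚ ≡ - c
      e₁ = solve-∀ ring
      -2≤-1 : -2ℚ ≤ - 1ℚ
      -2≤-1 = neg-antimono-≤ (1≤ι {2} (ℕ.s≤s ℕ.z≤n))

    private
      m≤deg : ∀ {x x'} → x ∈ X → x' ∈ X → m x x' ≤ ι (count (nbr x' ∩ M x))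
      m≤deg {x} {x'} x∈X x'∈X = ι-mono (count-mono {S = M x ∩ M x'} {S' = nbr x' ∩ M x} λ v v∈ →
        ∩-intro {S = nbr x'} {S' = M x} (∩-left {S = nbr x'} {S' = Y} (M⊆ x'∈X v (∩-right {S = M x} {S' = M x'} v∈))) (∩-left {S = M x} {S' = M x'} v∈))

      -- Rounding the common size up is harmless: d / y ≥ P, so an excess β over d / y is at least
      -- an excess β over `P`.
      dense-from : ∀ {x x'} β → x ∈ X → x' ∈ X → β * d * y ≤ z x x' → (P + β) * ι (count (M x)) ≤ ι (count (nbr x' ∩ M x))
      dense-from {x} {x'} β x∈X x'∈X β≤ = subst (λ s → (P + β) * ι s ≤ ι (count (nbr x' ∩ M x))) (sym (M-size x∈X))
        (≤-trans (*-cancelˡ y y>0 (≤-diff (subst (0ℚ ≤_) (e y d P β (m x x'))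
          (+-nonneg (*-nonneg (<⇒≤ d>0) (diff-≥0 P·y≤size)) (diff-≥0 β≤)))))
          (m≤deg x∈X x'∈X))
        where
        e : ∀ y d P β m → d * (d - P * y) + (y * m - d * d - β * d * y) ≡ y * m - y * ((P + β) * d)
        e = solve-∀ ring

    good-dense : ∀ {x x'} → x ∈ X → x' ∈ X → - (ι 3 * ι r) ≤ Q * K x x' →
      (P - α) * ι (count (M x)) ≤ ι (count (nbr x' ∩ M x))
    good-dense {x} {x'} x∈X x'∈X -R≤ = dense-from (- α) x∈X x'∈X (*-cancelˡ R R>0 (begin
      R * (- α * d * y) ≡⟨ e R α d y ⟩
      α * d * y * - R ≤⟨ *-monoˡ c (<⇒≤ c>0) -R≤ ⟩
      c * (Q * K x x') ≡⟨ scaled-K x∈X x'∈X ⟩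
      R * z x x' ∎))
      where
      open ≤-Reasoning
      e : ∀ R α d y → R * (- α * d * y) ≡ α * d * y * - R
      e = solve-∀ ring

    large-dense : ∀ {x x'} i β → x ∈ X → x' ∈ X → ι (4 ^ i) ≤ Q * K x x' → ι (3 ℕ.* r) * β ≤ ι (4 ^ i) * α →
      (P + β) * ι (count (M x)) ≤ ι (count (nbr x' ∩ M x))
    large-dense {x} {x'} i β x∈X x'∈X 4^i≤ β≤ = dense-from β x∈X x'∈X (*-cancelˡ R R>0 (begin
      R * (β * d * y) ≡⟨ e₁ R β d y ⟩
      R * β * (d * y) ≤⟨ *-monoʳ (d * y) (<⇒≤ (*-pos d>0 y>0)) (subst (λ s → s * β ≤ ι (4 ^ i) * α) (ι-* 3 r) β≤) ⟩
      ι (4 ^ i) * α * (d * y) ≡⟨ e₂ (ι (4 ^ i)) α d y ⟩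
      c * ι (4 ^ i) ≤⟨ *-monoˡ c (<⇒≤ c>0) 4^i≤ ⟩
      c * (Q * K x x') ≡⟨ scaled-K x∈X x'∈X ⟩
      R * z x x' ∎))
      where
      open ≤-Reasoning
      e₁ : ∀ R β d y → R * (β * d * y) ≡ R * β * (d * y)
      e₁ = solve-∀ ring
      e₂ : ∀ q α d y → q * α * (d * y) ≡ α * d * y * q
      e₂ = solve-∀ ring

  module _ {n r : ℕ} (E : EdgeColouring n r) where
    open EdgeColouring E

    Dense : ℚ → Fin r → Subset n → Subset n → Set
    Dense p i X Y = ∀ {x} → x ∈ X → p * ι (count Y) ≤ ι (count (N i x ∩ Y))

    module _ (i₀ m : ℕ) (X : Subset n) (Y : Fin r → Subset n) (P α : Fin r → ℚ) where

      -- The density is kept in all colours at once, since the colour that `x` extends is chosen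
      -- only afterwards, as its majority colour in `X'`.
      record Preserving (Y' : Fin r → Subset n) : Set where
        field
          {X'}   : Subset n
          X'⊆X   : X' ⊆ X
          large  : count X ℕ.≤ 2 ^ (5 ℕ.* r ℕ.* 2 ^ i₀) ℕ.* count X'
          dense' : ∀ i → Dense (P i - α i) i X' (Y' i)

      record Boosting (Y' : Fin r → Subset n) : Set where
        field
          j      : Fin m
          l      : Fin r
          {X'}   : Subset n
          X'⊆X   : X' ⊆ X
          large  : count X ℕ.≤ 2 ^ (9 ℕ.* r ℕ.* 2 ^ (toℕ j ℕ.+ i₀)) ℕ.* count X'
          dense' : ∀ β → ι (3 ℕ.* r) * β ≤ ι (4 ^ (toℕ j ℕ.+ i₀)) * α l → Dense (P l + β) l X' (Y' l)

      record BookStep : Set where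
        field
          {x}  : Fin n
          x∈X  : x ∈ X
          Y'   : Fin r → Subset n
          Y'⊆N : ∀ i → Y' i ⊆ N i x
          Y'⊆Y : ∀ i → Y' i ⊆ Y i
          Y'≥  : ∀ i → P i * ι (count (Y i)) ≤ ι (count (Y' i))
          next : Preserving Y' ⊎ Boosting Y'

    module _ (2≤r : 2 ℕ.≤ r) (i₀ m : ℕ) (X : Subset n) (Y : Fin r → Subset n) (P α : Fin r → ℚ)
      (X≢∅ : 0 ℕ.< count X) (Y≢∅ : ∀ i → 0 ℕ.< count (Y i)) (P>0 : ∀ i → 0ℚ < P i) (α>0 : ∀ i → 0ℚ < α i)
      (α-large : ∀ i → ι (3 ℕ.* r) ≤ ι (4 ^ (m ℕ.+ i₀)) * α i)
      (dense : ∀ i → Dense (P i) i X (Y i)) where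

      private
        J : ℕ
        J = m ℕ.+ i₀

        r>0 : 0 ℕ.< r
        r>0 = ℕ.≤-trans (ℕ.s≤s ℕ.z≤n) 2≤r

        module C (i : Fin r) = OneColour r J r>0 X (Y i) (N i) (P i) (α i) X≢∅ (Y≢∅ i) (P>0 i) (α>0 i) (α-large i) (dense i)

        module PC = PairCounting i₀ m X C.K C.K-psd (λ l → C.-2≤K l) (λ l → C.K≤1 l) X≢∅

        preserving-bits : 1 ℕ.+ (r ℕ.* (3 ℕ.* 2 ^ i₀) ℕ.+ r) ℕ.≤ 5 ℕ.* r ℕ.* 2 ^ i₀
        preserving-bits = begin
          1 ℕ.+ (r ℕ.* (3 ℕ.* T) ℕ.+ r) ≤⟨ ℕ.+-mono-≤ 1≤rT (ℕ.+-monoʳ-≤ (r ℕ.* (3 ℕ.* T)) r≤rT) ⟩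
          r ℕ.* T ℕ.+ (r ℕ.* (3 ℕ.* T) ℕ.+ r ℕ.* T) ≡⟨ e r T ⟩
          5 ℕ.* r ℕ.* T ∎
          where
          open ℕ.≤-Reasoning
          T = 2 ^ i₀
          r≤rT : r ℕ.≤ r ℕ.* T
          r≤rT = ℕ.m≤m*n r T {{ℕ.m^n≢0 2 i₀}}
          1≤rT : 1 ℕ.≤ r ℕ.* T
          1≤rT = ℕ.≤-trans r>0 r≤rT
          e : ∀ r T → r ℕ.* T ℕ.+ (r ℕ.* (3 ℕ.* T) ℕ.+ r ℕ.* T) ≡ 5 ℕ.* r ℕ.* T
          e = ℕ.solve-∀

        -- `r + (2 + j)` bits are the share of this level in `Rich`; the rest are the bits of `A`
        -- one level higher, since a pair at level `j` is only known to stay below level `j + 1`.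
        boosting-bits : ∀ j → r ℕ.+ (2 ℕ.+ j) ℕ.+ (r ℕ.* (3 ℕ.* 2 ^ suc (j ℕ.+ i₀)) ℕ.+ r) ℕ.≤ 9 ℕ.* r ℕ.* 2 ^ (j ℕ.+ i₀)
        boosting-bits j = begin
          r ℕ.+ (2 ℕ.+ j) ℕ.+ (r ℕ.* (3 ℕ.* (2 ℕ.* T)) ℕ.+ r)
            ≤⟨ ℕ.+-mono-≤ (ℕ.+-mono-≤ r≤rT 2+j≤rT) (ℕ.+-monoʳ-≤ (r ℕ.* (3 ℕ.* (2 ℕ.* T))) r≤rT) ⟩
          r ℕ.* T ℕ.+ r ℕ.* T ℕ.+ (r ℕ.* (3 ℕ.* (2 ℕ.* T)) ℕ.+ r ℕ.* T)
            ≡⟨ e r T ⟩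
          9 ℕ.* r ℕ.* T ∎
          where
          open ℕ.≤-Reasoning
          T = 2 ^ (j ℕ.+ i₀)
          r≤rT : r ℕ.≤ r ℕ.* T
          r≤rT = ℕ.m≤m*n r T {{ℕ.m^n≢0 2 (j ℕ.+ i₀)}}
          j<T : j ℕ.< T
          j<T = ℕ.≤-<-trans (ℕ.m≤m+n j i₀) (m<2^m (j ℕ.+ i₀))
          2+j≤rT : 2 ℕ.+ j ℕ.≤ r ℕ.* T
          2+j≤rT = begin
            1 ℕ.+ suc j ≤⟨ ℕ.+-mono-≤ (ℕ.m^n>0 2 (j ℕ.+ i₀)) j<T ⟩
            T ℕ.+ T ≡⟨ cong (T ℕ.+_) (ℕ.+-identityʳ T) ⟨
            2 ℕ.* T ≤⟨ ℕ.*-monoˡ-≤ T 2≤r ⟩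
            r ℕ.* T ∎
          e : ∀ r T → r ℕ.* T ℕ.+ r ℕ.* T ℕ.+ (r ℕ.* (3 ℕ.* (2 ℕ.* T)) ℕ.+ r ℕ.* T) ≡ 9 ℕ.* r ℕ.* T
          e = ℕ.solve-∀

        pow-≤ : ∀ {a} e₁ e₂ {e} c → a ℕ.≤ 2 ^ e₁ ℕ.* (2 ^ e₂ ℕ.* c) → e₁ ℕ.+ e₂ ℕ.≤ e → a ℕ.≤ 2 ^ e ℕ.* c
        pow-≤ {a} e₁ e₂ {e} c a≤ bits = begin
          a ≤⟨ a≤ ⟩
          2 ^ e₁ ℕ.* (2 ^ e₂ ℕ.* c) ≡⟨ ℕ.*-assoc (2 ^ e₁) (2 ^ e₂) c ⟨
          2 ^ e₁ ℕ.* 2 ^ e₂ ℕ.* c ≡⟨ cong (ℕ._* c) (ℕ.^-distribˡ-+-* 2 e₁ e₂) ⟨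
          2 ^ (e₁ ℕ.+ e₂) ℕ.* c ≤⟨ ℕ.*-monoˡ-≤ c (ℕ.^-monoʳ-≤ 2 bits) ⟩
          2 ^ e ℕ.* c ∎
          where open ℕ.≤-Reasoning

      book-step : BookStep i₀ m X Y P α
      book-step = from PC.exists-rich
        where
        from : ∃ (λ x → x ∈ X × PC.Rich x) → BookStep i₀ m X Y P α
        from (x , x∈X , rich) = record
          { x∈X  = x∈X
          ; Y'   = λ i → C.M i x
          ; Y'⊆N = λ i v v∈M → ∩-left {S = N i x} {S' = Y i} (C.M⊆ i x∈X v v∈M)
          ; Y'⊆Y = λ i v v∈M → ∩-right {S = N i x} {S' = Y i} (C.M⊆ i x∈X v v∈M)
          ; Y'≥  = λ i → subst (λ s → P i * ι (count (Y i)) ≤ ι s) (sym (C.M-size i x∈X)) (C.P·y≤size i)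
          ; next = next rich
          }
          where
          next : PC.Rich x → Preserving i₀ m X Y P α (λ i → C.M i x) ⊎ Boosting i₀ m X Y P α (λ i → C.M i x)
          next (inj₁ le) = inj₁ record
            { X'     = X ∩ PC.Good x
            ; X'⊆X   = λ v → ∩-left {S = X} {S' = PC.Good x}
            ; large  = pow-≤ 1 (r ℕ.* (3 ℕ.* 2 ^ i₀) ℕ.+ r) (count (X ∩ PC.Good x)) le preserving-bits
            ; dense' = λ i v∈ → C.good-dense i x∈X (∩-left {S = X} {S' = PC.Good x} v∈) (PC.good⇒ (∩-right {S = X} {S' = PC.Good x} v∈) i)
            }
          next (inj₂ (j , l , le)) = inj₂ record
            { j      = j
            ; l      = l
            ; X'     = X ∩ L
            ; X'⊆X   = λ v → ∩-left {S = X} {S' = L}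
            ; large  = pow-≤ (r ℕ.+ (2 ℕ.+ toℕ j)) (r ℕ.* (3 ℕ.* 2 ^ suc (toℕ j ℕ.+ i₀)) ℕ.+ r) (count (X ∩ L)) le (boosting-bits (toℕ j))
            ; dense' = λ β β≤ v∈ → C.large-dense l (toℕ j ℕ.+ i₀) β x∈X (∩-left {S = X} {S' = L} v∈)
                         (PC.large⇒ {toℕ j ℕ.+ i₀} {l} (∩-right {S = X} {S' = L} v∈)) β≤
            }
            where
            L = PC.Large (toℕ j ℕ.+ i₀) l x

-- Densities guaranteed during the book, as a function of steps and boosts.

module DensityProfile where

  open RationalOrder
  open import Data.Nat as ℕ using (ℕ; zero; suc; _^_)
  import Data.Nat.Properties as ℕ
  open import Data.Nat.Tactic.RingSolver as ℕ using ()
  open import Data.Product using (proj₁; proj₂)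
  import Data.Integer
  open import Data.Rational
  open import Data.Rational.Properties
  open import Relation.Binary.PropositionalEquality
  open import Relation.Nullary using (yes; no; contradiction)
  open import Tactic.RingSolver using (solve-∀)

  -- p a h is the density guaranteed to a colour with a steps left to take and total boost h.
  -- Taking a step costs α h, and a boost by λ gains at most λ α h / 3r.
  module Profile (r t Z' : ℕ) (r>0 : 0 ℕ.< r) (t>0 : 0 ℕ.< t) where

    -- `C` is tuned to `p-boost`: with u = 1/(2C) and a boost of at most `C`, the density rises by
    -- at most 2t · 2 u x α, and 3r · 2t · 2u = 1.
    Z C : ℕ
    Z = 3 ℕ.+ Z'
    C = 6 ℕ.* (r ℕ.* t)

    rZt : ℕ
    rZt = r ℕ.* Z ℕ.* t

    private
      rZt>0 : 0 ℕ.< rZt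
      rZt>0 = ℕ.*-mono-≤ {1} {r ℕ.* Z} (ℕ.*-mono-≤ {1} {r} {1} {Z} r>0 (ℕ.s≤s ℕ.z≤n)) t>0
      C>0 : 0 ℕ.< C
      C>0 = ℕ.*-mono-≤ {1} {6} {1} (ℕ.s≤s ℕ.z≤n) (ℕ.*-mono-≤ r>0 t>0)
      2C>0 : 0ℚ < ι (2 ℕ.* C)
      2C>0 = 0<ι (ℕ.*-mono-≤ {1} {2} {1} (ℕ.s≤s ℕ.z≤n) C>0)

    opaque
      u v : ℚ
      u = proj₁ (reciprocal (ι (2 ℕ.* C)) 2C>0)
      v = proj₁ (reciprocal (ι rZt) (0<ι rZt>0))

      u>0 : 0ℚ < u
      u>0 = proj₁ (proj₂ (reciprocal (ι (2 ℕ.* C)) 2C>0))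

      v>0 : 0ℚ < v
      v>0 = proj₁ (proj₂ (reciprocal (ι rZt) (0<ι rZt>0)))

      u·2C≡1 : u * ι (2 ℕ.* C) ≡ 1ℚ
      u·2C≡1 = proj₂ (proj₂ (reciprocal (ι (2 ℕ.* C)) 2C>0))

      v·rZt≡1 : v * ι rZt ≡ 1ℚ
      v·rZt≡1 = proj₂ (proj₂ (reciprocal (ι rZt) (0<ι rZt>0)))

    growth : ℕ → ℚ
    growth zero    = 1ℚ
    growth (suc h) = (1ℚ + u) * growth h

    private
      u≥0 : 0ℚ ≤ u
      u≥0 = <⇒≤ u>0
      v≥0 : 0ℚ ≤ v
      v≥0 = <⇒≤ v>0
      1+u≥1 : 1ℚ ≤ 1ℚ + u
      1+u≥1 = ≤-by u refl u≥0

    growth≥1 : ∀ h → 1ℚ ≤ growth h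
    growth≥1 zero    = ≤-refl
    growth≥1 (suc h) = subst (_≤ growth (suc h)) (*-identityˡ 1ℚ)
      (*-mono 0≤1 (≤-trans 0≤1 (growth≥1 h)) 1+u≥1 (growth≥1 h))

    growth≥0 : ∀ h → 0ℚ ≤ growth h
    growth≥0 h = ≤-trans 0≤1 (growth≥1 h)

    growth-+ : ∀ a b → growth (a ℕ.+ b) ≡ growth a * growth b
    growth-+ zero    b = sym (*-identityˡ (growth b))
    growth-+ (suc a) b = trans (cong ((1ℚ + u) *_) (growth-+ a b)) (sym (*-assoc (1ℚ + u) (growth a) (growth b)))

    growth-mono : ∀ {a b} → a ℕ.≤ b → growth a ≤ growth b
    growth-mono {a} {b} a≤b = subst (λ z → growth a ≤ growth z) (ℕ.m+[n∸m]≡n a≤b)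
      (subst₂ _≤_ (*-identityʳ (growth a)) (sym (growth-+ a (b ℕ.∸ a))) (*-monoˡ (growth a) (growth≥0 a) (growth≥1 (b ℕ.∸ a))))

    bernoulli : ∀ h → 1ℚ + ι h * u ≤ growth h
    bernoulli zero    = ≤-reflexive (trans (cong (λ z → 1ℚ + z * u) ι-0) (trans (cong (λ z → 1ℚ + z) (*-zeroˡ u)) (+-identityʳ 1ℚ)))
    bernoulli (suc h) = begin
      1ℚ + ι (suc h) * u ≡⟨ cong (λ z → 1ℚ + z * u) (ι-suc h) ⟩
      1ℚ + (1ℚ + ι h) * u ≤⟨ ≤-by (ι h * (u * u)) (e u (ι h)) (*-nonneg (0≤ι h) (sq-nonneg u)) ⟩
      (1ℚ + u) * (1ℚ + ι h * u) ≤⟨ *-monoˡ (1ℚ + u) (≤-trans 0≤1 1+u≥1) (bernoulli h) ⟩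
      growth (suc h) ∎
      where
      open ≤-Reasoning
      e : ∀ u h → (1ℚ + u) * (1ℚ + h * u) ≡ 1ℚ + (1ℚ + h) * u + h * (u * u)
      e = solve-∀ ring

    -- Bernoulli's inequality gives (1 + 1/(2C))^(2C) ≥ 2.
    growth-doubles : ∀ j → ι (2 ^ j) ≤ growth (2 ℕ.* C ℕ.* j)
    growth-doubles zero    = subst (λ z → ι 1 ≤ growth z) (sym (ℕ.*-zeroʳ (2 ℕ.* C))) (≤-reflexive ι-1)
    growth-doubles (suc j) = begin
      ι (2 ^ suc j) ≡⟨ ι-* 2 (2 ^ j) ⟩
      ι 2 * ι (2 ^ j) ≤⟨ *-mono (0≤ι 2) (growth≥0 (2 ℕ.* C ℕ.* j)) two (growth-doubles j) ⟩
      growth (2 ℕ.* C) * growth (2 ℕ.* C ℕ.* j) ≡⟨ growth-+ (2 ℕ.* C) (2 ℕ.* C ℕ.* j) ⟨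
      growth (2 ℕ.* C ℕ.+ 2 ℕ.* C ℕ.* j) ≡⟨ cong growth (ℕ.*-suc (2 ℕ.* C) j) ⟨
      growth (2 ℕ.* C ℕ.* suc j) ∎
      where
      open ≤-Reasoning
      two : ι 2 ≤ growth (2 ℕ.* C)
      two = subst (_≤ growth (2 ℕ.* C))
        (trans (cong (λ z → 1ℚ + z) (trans (*-comm (ι (2 ℕ.* C)) u) u·2C≡1))
               (trans (cong (λ z → 1ℚ + z) (sym ι-1)) (sym (ι-suc 1))))
        (bernoulli (2 ℕ.* C))

    private
      2uλ : ℕ → ℚ
      2uλ x = ι 2 * (u * ι x)

      2uλ≤1 : ∀ {x} → x ℕ.≤ C → 2uλ x ≤ 1ℚ
      2uλ≤1 {x} x≤C = begin
        ι 2 * (u * ι x) ≤⟨ *-monoˡ (ι 2) (0≤ι 2) (*-monoˡ u u≥0 (ι-mono x≤C)) ⟩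
        ι 2 * (u * ι C) ≡⟨ e (ι 2) u (ι C) ⟩
        u * (ι 2 * ι C) ≡⟨ cong (u *_) (sym (ι-* 2 C)) ⟩
        u * ι (2 ℕ.* C) ≡⟨ u·2C≡1 ⟩
        1ℚ ∎
        where
        open ≤-Reasoning
        e : ∀ a u c → a * (u * c) ≡ u * (a * c)
        e = solve-∀ ring

    -- By induction, (1 + u)(1 + 2ux) ≤ 1 + 2u(x + 1) as long as 2ux ≤ 1; this is what x ≤ C
    -- ensures.
    growth-upper : ∀ x → x ℕ.≤ C → growth x ≤ 1ℚ + ι 2 * (u * ι x)
    growth-upper zero    x≤C = ≤-by (ι 2 * (u * ι 0)) refl (*-nonneg (0≤ι 2) (*-nonneg u≥0 (0≤ι 0)))
    growth-upper (suc x) x≤C = begin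
      (1ℚ + u) * growth x ≤⟨ *-monoˡ (1ℚ + u) (≤-trans 0≤1 1+u≥1) (growth-upper x (ℕ.<⇒≤ x≤C)) ⟩
      (1ℚ + u) * (1ℚ + ι 2 * (u * ι x)) ≤⟨ ≤-by (u * (1ℚ - 2uλ x)) (e u (ι x)) (*-nonneg u≥0 (diff-≥0 (2uλ≤1 (ℕ.<⇒≤ x≤C)))) ⟩
      1ℚ + ι 2 * (u * (1ℚ + ι x)) ≡⟨ cong (λ z → 1ℚ + ι 2 * (u * z)) (ι-suc x) ⟨
      1ℚ + ι 2 * (u * ι (suc x)) ∎
      where
      open ≤-Reasoning
      opaque
        unfolding ι
        e : ∀ u x → 1ℚ + ι 2 * (u * (1ℚ + x)) ≡ (1ℚ + u) * (1ℚ + ι 2 * (u * x)) + u * (1ℚ - ι 2 * (u * x))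
        e = solve-∀ ring

    p : ℕ → ℕ → ℚ
    p a h = v * (ι (t ℕ.* Z') + growth h * ι (t ℕ.+ a))

    α : ℕ → ℚ
    α h = v * growth h

    α>0 : ∀ h → 0ℚ < α h
    α>0 h = *-pos v>0 (<-≤-trans (*<* (Data.Integer.+<+ (ℕ.s≤s ℕ.z≤n))) (growth≥1 h))

    p-step : ∀ a h → p (suc a) h - α h ≡ p a h
    p-step a h = trans (cong (λ z → v * (ι (t ℕ.* Z') + growth h * z) - v * growth h) (trans (cong ι (ℕ.+-suc t a)) (ι-suc (t ℕ.+ a))))
      (e v (ι (t ℕ.* Z')) (growth h) (ι (t ℕ.+ a)))
      where
      e : ∀ v z g s → v * (z + g * (1ℚ + s)) - v * g ≡ v * (z + g * s)
      e = solve-∀ ring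

    p-boost : ∀ a h x Λ → a ℕ.≤ t → x ℕ.≤ C → x ℕ.≤ Λ → ι (3 ℕ.* r) * (p a (h ℕ.+ x) - p a h) ≤ ι Λ * α h
    p-boost a h x Λ a≤t x≤C x≤Λ = begin
      ι (3 ℕ.* r) * (p a (h ℕ.+ x) - p a h)
        ≡⟨ cong (λ z → ι (3 ℕ.* r) * (v * (ι (t ℕ.* Z') + z * T) - p a h)) (growth-+ h x) ⟩
      ι (3 ℕ.* r) * (v * (ι (t ℕ.* Z') + g * growth x * T) - v * (ι (t ℕ.* Z') + g * T))
        ≡⟨ e₁ (ι (3 ℕ.* r)) v (ι (t ℕ.* Z')) g (growth x) T ⟩
      ι (3 ℕ.* r) * (v * g) * (T * (growth x - 1ℚ))
        ≤⟨ *-monoˡ _ (*-nonneg (0≤ι (3 ℕ.* r)) (*-nonneg v≥0 (growth≥0 h)))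
             (*-mono (0≤ι (t ℕ.+ a)) (*-nonneg (0≤ι 2) (*-nonneg u≥0 (0≤ι x))) (ι-mono (ℕ.+-monoʳ-≤ t a≤t)) inc) ⟩
      ι (3 ℕ.* r) * (v * g) * (ι (t ℕ.+ t) * (ι 2 * (u * ι x)))
        ≡⟨ e₂ (ι (3 ℕ.* r)) v g (ι (t ℕ.+ t)) (ι 2) u (ι x) ⟩
      u * (ι (3 ℕ.* r) * ι (t ℕ.+ t) * ι 2) * ι x * (v * g)
        ≡⟨ cong (λ z → u * z * ι x * (v * g)) (trans (cong (_* ι 2) (sym (ι-* (3 ℕ.* r) (t ℕ.+ t)))) (sym (ι-* (3 ℕ.* r ℕ.* (t ℕ.+ t)) 2))) ⟩
      u * ι (3 ℕ.* r ℕ.* (t ℕ.+ t) ℕ.* 2) * ι x * (v * g)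
        ≡⟨ cong (λ z → u * ι z * ι x * (v * g)) (count≡ r t) ⟩
      u * ι (2 ℕ.* C) * ι x * (v * g)
        ≡⟨ cong (λ z → z * ι x * (v * g)) u·2C≡1 ⟩
      1ℚ * ι x * (v * g)
        ≡⟨ cong (_* (v * g)) (*-identityˡ (ι x)) ⟩
      ι x * α h
        ≤⟨ *-monoʳ (α h) (<⇒≤ (α>0 h)) (ι-mono x≤Λ) ⟩
      ι Λ * α h ∎
      where
      open ≤-Reasoning
      T = ι (t ℕ.+ a)
      g = growth h
      e₁ : ∀ R v z g x T → R * (v * (z + g * x * T) - v * (z + g * T)) ≡ R * (v * g) * (T * (x - 1ℚ))
      e₁ = solve-∀ ring
      e₂ : ∀ R v g T w u x → R * (v * g) * (T * (w * (u * x))) ≡ u * (R * T * w) * x * (v * g)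
      e₂ = solve-∀ ring
      count≡ : ∀ r t → 3 ℕ.* r ℕ.* (t ℕ.+ t) ℕ.* 2 ≡ 2 ℕ.* (6 ℕ.* (r ℕ.* t))
      count≡ = ℕ.solve-∀
      inc : growth x - 1ℚ ≤ ι 2 * (u * ι x)
      inc = ≤-diff (subst (0ℚ ≤_) (e₃ (growth x) (2uλ x)) (diff-≥0 (growth-upper x x≤C)))
        where
        e₃ : ∀ g w → 1ℚ + w - g ≡ w - (g - 1ℚ)
        e₃ = solve-∀ ring

    -- The floor (1 - 2/Z)/r, reached with no steps left and no boost. It bounds the loss of `Y` in
    -- every step, boosts included.
    p-lower : ∀ a h → ι (suc Z') ≤ ι (r ℕ.* Z) * p a h
    p-lower a h = begin
      ι (suc Z') ≡⟨ *-identityˡ (ι (suc Z')) ⟨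
      1ℚ * ι (suc Z') ≡⟨ cong (_* ι (suc Z')) v·rZt≡1 ⟨
      v * ι rZt * ι (suc Z') ≡⟨ cong₂ (λ x y → v * x * y) (ι-* (r ℕ.* Z) t) (ι-suc Z') ⟩
      v * (ι (r ℕ.* Z) * ι t) * (1ℚ + ι Z') ≡⟨ e v (ι (r ℕ.* Z)) (ι t) (ι Z') ⟩
      ι (r ℕ.* Z) * (v * (ι t * ι Z' + 1ℚ * ι t)) ≡⟨ cong (λ z → ι (r ℕ.* Z) * (v * (z + 1ℚ * ι t))) (ι-* t Z') ⟨
      ι (r ℕ.* Z) * (v * (ι (t ℕ.* Z') + 1ℚ * ι t))
        ≤⟨ *-monoˡ (ι (r ℕ.* Z)) (0≤ι (r ℕ.* Z)) (*-monoˡ v v≥0 (+-monoʳ-≤ (ι (t ℕ.* Z'))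
             (*-mono 0≤1 (0≤ι (t ℕ.+ a)) (growth≥1 h) (ι-mono (ℕ.m≤m+n t a))))) ⟩
      ι (r ℕ.* Z) * p a h ∎
      where
      open ≤-Reasoning
      e : ∀ v R t z → v * (R * t) * (1ℚ + z) ≡ R * (v * (t * z + 1ℚ * t))
      e = solve-∀ ring

    p>0 : ∀ a h → 0ℚ < p a h
    p>0 a h = *-cancelˡ-<-nonNeg (ι (r ℕ.* Z)) {{nonNegative (0≤ι (r ℕ.* Z))}}
      (subst (_< ι (r ℕ.* Z) * p a h) (sym (*-zeroʳ (ι (r ℕ.* Z)))) (<-≤-trans (0<ι {suc Z'} (ℕ.s≤s ℕ.z≤n)) (p-lower a h)))

    -- (1 - 1/Z)/r, the density that a balanced set offers. The gap 1/(rZ) down to the floor is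
    -- spent evenly over `t` unboosted steps.
    p-start : ι (r ℕ.* Z) * p t 0 ≡ ι (2 ℕ.+ Z')
    p-start = begin
      ι (r ℕ.* Z) * (v * (ι (t ℕ.* Z') + 1ℚ * ι (t ℕ.+ t))) ≡⟨ cong₂ (λ x y → ι (r ℕ.* Z) * (v * (x + 1ℚ * y))) (ι-* t Z') (ι-+ t t) ⟩
      ι (r ℕ.* Z) * (v * (ι t * ι Z' + 1ℚ * (ι t + ι t))) ≡⟨ e v (ι (r ℕ.* Z)) (ι t) (ι Z') ⟩
      v * (ι (r ℕ.* Z) * ι t) * (1ℚ + (1ℚ + ι Z')) ≡⟨ cong₂ (λ x y → v * x * y) (sym (ι-* (r ℕ.* Z) t)) (trans (cong (λ z → 1ℚ + z) (sym (ι-suc Z'))) (sym (ι-suc (suc Z')))) ⟩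
      v * ι rZt * ι (2 ℕ.+ Z') ≡⟨ cong (_* ι (2 ℕ.+ Z')) v·rZt≡1 ⟩
      1ℚ * ι (2 ℕ.+ Z') ≡⟨ *-identityˡ (ι (2 ℕ.+ Z')) ⟩
      ι (2 ℕ.+ Z') ∎
      where
      open ≡-Reasoning
      e : ∀ v R t z → R * (v * (t * z + 1ℚ * (t + t))) ≡ v * (R * t) * (1ℚ + (1ℚ + z))
      e = solve-∀ ring

    α-large : ∀ J → 3 ℕ.* r ℕ.* rZt ℕ.≤ 4 ^ J → ∀ h → ι (3 ℕ.* r) ≤ ι (4 ^ J) * α h
    α-large J le h = begin
      ι (3 ℕ.* r) ≡⟨ *-identityʳ (ι (3 ℕ.* r)) ⟨
      ι (3 ℕ.* r) * 1ℚ ≡⟨ cong (ι (3 ℕ.* r) *_) v·rZt≡1 ⟨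
      ι (3 ℕ.* r) * (v * ι rZt) ≡⟨ e (ι (3 ℕ.* r)) v (ι rZt) ⟩
      ι (3 ℕ.* r) * ι rZt * (v * 1ℚ) ≡⟨ cong (_* (v * 1ℚ)) (ι-* (3 ℕ.* r) rZt) ⟨
      ι (3 ℕ.* r ℕ.* rZt) * (v * 1ℚ) ≤⟨ *-mono (0≤ι (3 ℕ.* r ℕ.* rZt)) (<⇒≤ (α>0 h)) (ι-mono le) (*-monoˡ v v≥0 (growth≥1 h)) ⟩
      ι (4 ^ J) * α h ∎
      where
      open ≤-Reasoning
      e : ∀ R v z → R * (v * z) ≡ R * z * (v * 1ℚ)
      e = solve-∀ ring

    -- A larger `h` would make the growth at least 2^(ℓ+1) ≥ 2rZ and hence the density at least 2.
    boost-bound : ∀ ℓ → r ℕ.* Z ℕ.≤ 2 ^ ℓ → ∀ a h → p a h ≤ 1ℚ → h ℕ.≤ 2 ℕ.* C ℕ.* suc ℓ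
    boost-bound ℓ rZ≤ a h p≤1 with h ℕ.≤? 2 ℕ.* C ℕ.* suc ℓ
    ... | yes le = le
    ... | no ¬le = contradiction (ι-cancel {2} {1} (begin
      ι 2 ≡⟨ *-identityʳ (ι 2) ⟨
      ι 2 * 1ℚ ≡⟨ cong (ι 2 *_) v·rZt≡1 ⟨
      ι 2 * (v * ι rZt) ≡⟨ cong (λ z → ι 2 * (v * z)) (ι-* (r ℕ.* Z) t) ⟩
      ι 2 * (v * (ι (r ℕ.* Z) * ι t)) ≤⟨ *-monoˡ (ι 2) (0≤ι 2) (*-monoˡ v v≥0 (*-monoʳ (ι t) (0≤ι t) (ι-mono rZ≤))) ⟩
      ι 2 * (v * (ι (2 ^ ℓ) * ι t)) ≡⟨ e (ι 2) v (ι (2 ^ ℓ)) (ι t) ⟩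
      v * (0ℚ + ι 2 * ι (2 ^ ℓ) * ι t) ≡⟨ cong (λ z → v * (0ℚ + z * ι t)) (ι-* 2 (2 ^ ℓ)) ⟨
      v * (0ℚ + ι (2 ^ suc ℓ) * ι t)
        ≤⟨ *-monoˡ v v≥0 (+-mono-≤ (0≤ι (t ℕ.* Z')) (*-mono (0≤ι (2 ^ suc ℓ)) (0≤ι (t ℕ.+ a))
             (≤-trans (growth-doubles (suc ℓ)) (growth-mono (ℕ.<⇒≤ (ℕ.≰⇒> ¬le)))) (ι-mono (ℕ.m≤m+n t a)))) ⟩
      p a h ≤⟨ p≤1 ⟩
      1ℚ ≡⟨ ι-1 ⟨
      ι 1 ∎)) λ { (ℕ.s≤s ()) }
      where
      open ≤-Reasoning
      e : ∀ w v x t → w * (v * (x * t)) ≡ v * (0ℚ + w * x * t)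
      e = solve-∀ ring

-- The book algorithm and its accounting.

module Book where

  open Cliques
  open Counting
  open DensityProfile
  open Powers
  open KeyLemma
  open RationalOrder
  open import Data.Fin using (Fin; zero; suc; toℕ; _≟_; fromℕ<)
  open import Data.Fin.Properties using (any?; toℕ<n)
  open import Data.Nat as ℕ using (ℕ; zero; suc; _+_; _*_; _∸_; _^_; _≤_; _<_; z≤n; s≤s; _⊓_)
  open import Data.Nat.Properties hiding (_≟_)
  open import Data.Nat.Tactic.RingSolver using (solve-∀)
  open import Data.Product using (∃; _,_)
  open import Data.Rational as ℚ using (ℚ)
  import Data.Rational.Properties as ℚ
  open import Data.Sum using (inj₁; inj₂)
  import Tactic.RingSolver
  open import Function using (_∘_)
  open import Relation.Binary.PropositionalEquality hiding (J)
  open import Relation.Nullary using (Dec; yes; no; ¬_; contradiction)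

  sum-decrease : ∀ {n} (f f' : Fin n → ℕ) j δ → f' j + δ ≤ f j → (∀ i → ¬ i ≡ j → f' i ≤ f i) → sum f' + δ ≤ sum f
  sum-decrease f f' zero δ at-j away = begin
    f' zero + sum (f' ∘ suc) + δ ≡⟨ e (f' zero) (sum (f' ∘ suc)) δ ⟩
    f' zero + δ + sum (f' ∘ suc) ≤⟨ +-mono-≤ at-j (sum-mono λ i → away (suc i) λ ()) ⟩
    sum f ∎
    where
    open ≤-Reasoning
    e : ∀ a b c → a + b + c ≡ a + c + b
    e = solve-∀
  sum-decrease f f' (suc j) δ at-j away = begin
    f' zero + sum (f' ∘ suc) + δ ≡⟨ +-assoc (f' zero) _ δ ⟩
    f' zero + (sum (f' ∘ suc) + δ)
      ≤⟨ +-mono-≤ (away zero λ ()) (sum-decrease (f ∘ suc) (f' ∘ suc) j δ at-j λ i i≢j → away (suc i) λ e → i≢j (Data.Fin.Properties.suc-injective e)) ⟩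
    sum f ∎
    where open ≤-Reasoning

  module BookAlgorithm {n r : ℕ} (E : EdgeColouring n r) (Goal : Set) (2≤r : 2 ≤ r)
    (i₀ m t Z' ℓ y₀ : ℕ) (Y₀ : Subset n) (κ' : Fin r → ℕ) (t>0 : 0 < t) (y₀>0 : 0 < y₀)
    (J-large : 3 * r * (r * (3 + Z') * t) ≤ 4 ^ (m + i₀))
    (J-small : 2 ^ i₀ * 2 ^ (m + i₀) ≤ 6 * (r * t))
    (ℓ-large : r * (3 + Z') ≤ 2 ^ ℓ) where

    open EdgeColouring E

    r>0 : 0 < r
    r>0 = ≤-trans (s≤s z≤n) 2≤r

    open Profile r t Z' r>0 t>0 hiding (u; v; u>0; v>0)

    -- `γ` is the number of bits that `X` loses in a colour step: `5 * r * μ` by the key lemma and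
    -- `suc r` for passing to the majority colour of `x`.
    H γ μ : ℕ
    H = 2 * C * suc ℓ
    μ = 2 ^ i₀
    γ = suc r + 5 * r * μ

    -- `need` conceals the `c` vertices already chosen in colour `i`, joined in that colour to all
    -- of X ∪ Y. `size` says that each of the `c` colour steps and `s` boosts kept at least the
    -- fraction (Z' + 1)/(rZ) of `Y`.
    record ColourState (X : Subset n) (i : Fin r) : Set where
      field
        Y       : Subset n
        Y⊆Y₀    : Y ⊆ Y₀
        a c h s : ℕ
        c+a≡t   : c + a ≡ t
        h≤H     : h ≤ H
        s-few   : s * 4 ^ i₀ ≤ h
        size    : suc Z' ^ (c + s) * y₀ ≤ (r * Z) ^ (c + s) * count Y
        dense   : Dense E (p a h) i X Y
        need    : Clique E i (a + κ' i) (X ∪ Y) → Goal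

    open ColourState

    restrict : ∀ {X X' i} → X' ⊆ X → ColourState X i → ColourState X' i
    restrict {X} {X'} X'⊆X st = record
      { Y = Y st ; Y⊆Y₀ = Y⊆Y₀ st ; a = a st ; c = c st ; h = h st ; s = s st
      ; c+a≡t = c+a≡t st ; h≤H = h≤H st ; s-few = s-few st ; size = size st
      ; dense = λ x∈X' → dense st (X'⊆X _ x∈X')
      ; need  = λ cl → need st (clique-⊆ E (∪-mono {S' = Y st} X'⊆X (λ _ v∈Y → v∈Y)) cl)
      }

    modify : ∀ {X} j → ColourState X j → (∀ i → ColourState X i) → ∀ i → ColourState X i
    modify j new old i with i ≟ j
    ... | yes refl = new
    ... | no _     = old i

    sum-modify : ∀ {X X'} (φ : ∀ {X i} → ColourState X i → ℕ) j (new : ColourState X' j) (cs : ∀ i → ColourState X i)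
      (X'⊆X : X' ⊆ X) (φ-restrict : ∀ i → φ (restrict X'⊆X (cs i)) ≡ φ (cs i)) δ → φ new + δ ≤ φ (cs j) →
      sum (λ i → φ (modify j new (λ i → restrict X'⊆X (cs i)) i)) + δ ≤ sum (λ i → φ (cs i))
    sum-modify φ j new cs X'⊆X φ-restrict δ le = sum-decrease (λ i → φ (cs i)) _ j δ at-j away
      where
      at-j : φ (modify j new (λ i → restrict X'⊆X (cs i)) j) + δ ≤ φ (cs j)
      at-j with j ≟ j
      ... | yes refl = le
      ... | no j≢j   = contradiction refl j≢j
      away : ∀ i → ¬ i ≡ j → φ (modify j new (λ i → restrict X'⊆X (cs i)) i) ≤ φ (cs i)
      away i i≢j with i ≟ j
      ... | yes i≡j = contradiction i≡j i≢j
      ... | no _    = ≤-reflexive (φ-restrict i)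

    slack : ∀ {X i} → ColourState X i → ℕ
    slack st = H ∸ h st

    -- A potential for the bits of `X` still to be spent: `γ` for every missing step, and 9r/μ for
    -- every unit of boost still possible; multiplied by `μ` to stay integral.
    Budget : ∀ {X} → ℕ → (∀ i → ColourState X i) → Set
    Budget B cs = μ * γ * sum (λ i → a (cs i)) + 9 * r * sum (λ i → slack (cs i)) ≤ μ * B

    Finish : Set
    Finish = ∀ j (Y : Subset n) s → Y ⊆ Y₀ → s * 4 ^ i₀ ≤ H → suc Z' ^ (t + s) * y₀ ≤ (r * Z) ^ (t + s) * count Y →
      (Clique E j (κ' j) Y → Goal) → Goal

    instance
      μ≢0 : ℕ.NonZero μ
      μ≢0 = m^n≢0 2 i₀

    size⇒Y≢∅ : ∀ {X i} (st : ColourState X i) → 0 < count (Y st)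
    size⇒Y≢∅ st = n≢0⇒n>0 λ Y≡0 → <⇒≱ (*-mono-≤ {1} {suc Z' ^ (c st + s st)} {1} (m^n>0 (suc Z') (c st + s st)) y₀>0)
      (≤-trans (size st) (≤-reflexive (trans (cong ((r * Z) ^ (c st + s st) *_) Y≡0) (*-zeroʳ ((r * Z) ^ (c st + s st))))))

    shrink-size : ∀ {q} {Y Y' : Subset n} a h e → p a h ℚ.* ι (count Y) ℚ.≤ ι (count Y') → e ≡ q →
      suc Z' ^ q * y₀ ≤ (r * Z) ^ q * count Y → suc Z' ^ suc e * y₀ ≤ (r * Z) ^ suc e * count Y'
    shrink-size {q} {Y} {Y'} a h e p≤ refl size = begin
      suc Z' * suc Z' ^ q * y₀ ≡⟨ *-assoc (suc Z') (suc Z' ^ q) y₀ ⟩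
      suc Z' * (suc Z' ^ q * y₀) ≤⟨ *-monoʳ-≤ (suc Z') size ⟩
      suc Z' * ((r * Z) ^ q * count Y) ≡⟨ swap (suc Z') ((r * Z) ^ q) (count Y) ⟩
      (r * Z) ^ q * (suc Z' * count Y) ≤⟨ *-monoʳ-≤ ((r * Z) ^ q) step≤ ⟩
      (r * Z) ^ q * (r * Z * count Y') ≡⟨ swap' ((r * Z) ^ q) (r * Z) (count Y') ⟩
      r * Z * (r * Z) ^ q * count Y' ∎
      where
      open ≤-Reasoning
      swap : ∀ a b c → a * (b * c) ≡ b * (a * c)
      swap = solve-∀
      swap' : ∀ a b c → a * (b * c) ≡ b * a * c
      swap' = solve-∀
      step≤ : suc Z' * count Y ≤ r * Z * count Y'
      step≤ = ι-cancel (ℚ.≤-trans (ℚ.≤-reflexive (ι-* (suc Z') (count Y)))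
        (ℚ.≤-trans (*-monoʳ (ι (count Y)) (0≤ι (count Y)) (p-lower a h))
          (ℚ.≤-trans (ℚ.≤-reflexive (ℚ.*-assoc (ι (r * Z)) (p a h) (ι (count Y))))
            (ℚ.≤-trans (*-monoˡ (ι (r * Z)) (0≤ι (r * Z)) p≤) (ℚ.≤-reflexive (sym (ι-* (r * Z) (count Y'))))))))

    pow-cancel : ∀ B b c {x y} → B ≡ c + b → 2 ^ B ≤ x → x ≤ 2 ^ b * y → 2 ^ c ≤ y
    pow-cancel B b c {x} {y} refl big le = *-cancelˡ-≤ (2 ^ b) {{m^n≢0 2 b}}
      (≤-trans (≤-reflexive (trans (*-comm (2 ^ b) (2 ^ c)) (sym (^-distribˡ-+-* 2 c b)))) (≤-trans big le))

    module _ (finish : Finish) where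

      -- The exponent B, with 2^B ≤ |X|, strictly decreases, so it bounds the number of steps.
      run : ∀ fuel B X (cs : ∀ i → ColourState X i) → B ≤ fuel → 2 ^ B ≤ count X → Budget B cs → Goal

      module Step (fuel B : ℕ) (X : Subset n) (cs : ∀ i → ColourState X i) (B≤ : B ≤ suc fuel)
        (big : 2 ^ B ≤ count X) (budget : Budget B cs) (a>0 : ∀ i → 0 < a (cs i))
        (bk : BookStep E i₀ m X (λ i → Y (cs i)) (λ i → p (a (cs i)) (h (cs i))) (λ i → α (h (cs i)))) where

        open BookStep bk

        Σa ΣH : ℕ
        Σa = sum (λ i → a (cs i))
        ΣH = sum (λ i → slack (cs i))

        -- Some colour still has a step to take, so the budget contains its cost and `B ∸ γ` is a
        -- genuine difference.
        γ≤B : γ ≤ B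
        γ≤B = *-cancelˡ-≤ μ (begin
          μ * γ ≡⟨ *-identityʳ (μ * γ) ⟨
          μ * γ * 1 ≤⟨ *-monoʳ-≤ (μ * γ) (≤-trans (a>0 i) (≤-sum (λ i → a (cs i)) i)) ⟩
          μ * γ * Σa ≤⟨ m≤m+n (μ * γ * Σa) _ ⟩
          μ * γ * Σa + 9 * r * ΣH ≤⟨ budget ⟩
          μ * B ∎)
          where
          open ≤-Reasoning
          i : Fin r
          i = fromℕ< r>0

        colour-step : Preserving E i₀ m X (λ i → Y (cs i)) (λ i → p (a (cs i)) (h (cs i))) (λ i → α (h (cs i))) Y' → Goal
        -- Exceeding `u ∸ 1` means having at least `u` neighbours. The vertex `x` and the strictness
        -- are paid for by |X'| ≥ 2^(r+1) u ≥ (r + 2) u.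
        colour-step pr = choose (pigeonhole (λ _ → 2 ^ (B ∸ γ) ∸ 1) (λ j → count (N j x ∩ X')) many)
          where
          open Preserving pr
          u : ℕ
          u = 2 ^ (B ∸ γ)
          u>0 : 0 < u
          u>0 = m^n>0 2 (B ∸ γ)
          X'-large : 2 ^ suc r * u ≤ count X'
          X'-large = ≤-trans (≤-reflexive (sym (^-distribˡ-+-* 2 (suc r) (B ∸ γ))))
            (pow-cancel B (5 * r * μ) (suc r + (B ∸ γ)) B≡ big large)
            where
            rearrange : ∀ a b c → a + b + c ≡ a + c + b
            rearrange = solve-∀
            B≡ : B ≡ suc r + (B ∸ γ) + 5 * r * μ
            B≡ = trans (sym (m+[n∸m]≡n γ≤B)) (rearrange (suc r) (5 * r * μ) (B ∸ γ))
          r+2≤2^ : 2 + r ≤ 2 ^ suc r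
          r+2≤2^ = subst (2 + r ≤_) (cong (2 ^ r +_) (sym (+-identityʳ (2 ^ r))))
            (+-mono-≤ (m^n>0 2 r) (m<2^m r))
          many : sum {r} (λ _ → u ∸ 1) < sum (λ j → count (N j x ∩ X'))
          many = ℕ.s≤s⁻¹ (begin
            2 + sum {r} (λ _ → u ∸ 1) ≡⟨ cong (2 +_) (sum-const r (u ∸ 1)) ⟩
            2 + r * (u ∸ 1) ≤⟨ +-mono-≤ (*-monoʳ-≤ 2 u>0) (*-monoʳ-≤ r (m∸n≤m u 1)) ⟩
            2 * u + r * u ≡⟨ *-distribʳ-+ u 2 r ⟨
            (2 + r) * u ≤⟨ *-monoˡ-≤ u r+2≤2^ ⟩
            2 ^ suc r * u ≤⟨ X'-large ⟩
            count X' ≤⟨ cover-count E X' x ⟩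
            suc (sum (λ j → count (N j x ∩ X'))) ∎)
            where open ≤-Reasoning
          choose : ∃ (λ j → u ∸ 1 < count (N j x ∩ X')) → Goal
          choose (j , u≤) = run fuel (B ∸ γ) (N j x ∩ X') (modify j new (λ i → restrict X″⊆X (cs i)))
            (≤-trans (∸-monoʳ-≤ B (s≤s {n = r + 5 * r * μ} z≤n)) (∸-monoˡ-≤ 1 B≤))
            (subst (_≤ count (N j x ∩ X')) (m+[n∸m]≡n u>0) u≤)
            budget'
            where
            X″⊆X : (N j x ∩ X') ⊆ X
            X″⊆X v v∈ = X'⊆X v (∩-right {S = N j x} {S' = X'} v∈)
            st = cs j
            suc-a' : suc (a st ∸ 1) ≡ a st
            suc-a' = m+[n∸m]≡n (a>0 j)
            sub : ((N j x ∩ X') ∪ Y' j) ⊆ (X ∪ Y st)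
            sub = ∪-mono X″⊆X (Y'⊆Y j)
            subN : ((N j x ∩ X') ∪ Y' j) ⊆ N j x
            subN = ∪-least (λ v → ∩-left {S = N j x} {S' = X'}) (Y'⊆N j)
            new : ColourState (N j x ∩ X') j
            new = record
              { Y = Y' j ; Y⊆Y₀ = ⊆-trans (Y'⊆Y j) (Y⊆Y₀ st) ; a = a st ∸ 1 ; c = suc (c st) ; h = h st ; s = s st
              ; c+a≡t = trans (sym (+-suc (c st) (a st ∸ 1))) (trans (cong (c st +_) suc-a') (c+a≡t st))
              ; h≤H   = h≤H st
              ; s-few = s-few st
              ; size  = shrink-size {c st + s st} {Y st} {Y' j} (a st) (h st) (c st + s st) (Y'≥ j) refl (size st)
              ; dense = λ x∈ → subst (λ z → z ℚ.* ι (count (Y' j)) ℚ.≤ _)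
                  (trans (cong (λ z → p z (h st) ℚ.- α (h st)) (sym suc-a')) (p-step (a st ∸ 1) (h st)))
                  (dense' j (∩-right {S = N j x} {S' = X'} x∈))
              ; need  = λ cl → need st (subst (λ z → Clique E j (z + κ' j) (X ∪ Y st)) suc-a'
                  (clique-insert E (∪-left {S = X} {S' = Y st} x∈X) sub subN cl))
              }
            budget' : Budget (B ∸ γ) (modify j new (λ i → restrict X″⊆X (cs i)))
            budget' = +-cancelʳ-≤ (μ * γ) _ _ (begin
              μ * γ * Σa' + 9 * r * ΣH' + μ * γ ≡⟨ e (μ * γ) Σa' (9 * r * ΣH') ⟩
              μ * γ * (Σa' + 1) + 9 * r * ΣH' ≤⟨ +-mono-≤
                (*-monoʳ-≤ (μ * γ) (sum-modify a j new cs X″⊆X (λ _ → refl) 1 (≤-reflexive (trans (+-comm (a st ∸ 1) 1) suc-a'))))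
                (*-monoʳ-≤ (9 * r) (≤-trans (m≤m+n ΣH' 0) (sum-modify slack j new cs X″⊆X (λ _ → refl) 0 (≤-reflexive (+-identityʳ (slack st)))))) ⟩
              μ * γ * Σa + 9 * r * ΣH ≤⟨ budget ⟩
              μ * B ≡⟨ cong (μ *_) (m∸n+n≡m γ≤B) ⟨
              μ * (B ∸ γ + γ) ≡⟨ *-distribˡ-+ μ (B ∸ γ) γ ⟩
              μ * (B ∸ γ) + μ * γ ∎)
              where
              open ≤-Reasoning
              Σa' = sum (λ i → a (modify j new (λ i → restrict X″⊆X (cs i)) i))
              ΣH' = sum (λ i → slack (modify j new (λ i → restrict X″⊆X (cs i)) i))
              e : ∀ g a b → g * a + b + g ≡ g * (a + 1) + b
              e = solve-∀

        boost-step : Boosting E i₀ m X (λ i → Y (cs i)) (λ i → p (a (cs i)) (h (cs i))) (λ i → α (h (cs i))) Y' → Goal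
        boost-step bo = run fuel (B ∸ cost) X' (modify l new (λ i → restrict X'⊆X (cs i)))
          (≤-trans (∸-monoʳ-≤ B cost>0) (∸-monoˡ-≤ 1 B≤))
          X'-large
          budget'
          where
          open Boosting bo
          st = cs l
          i : ℕ
          i = toℕ j + i₀
          -- Beyond C the boost is no longer bounded linearly by the density gained, hence the cap.
          x' : ℕ
          x' = 4 ^ i ⊓ C
          cost : ℕ
          cost = 9 * r * 2 ^ i
          cost>0 : 0 < cost
          cost>0 = *-mono-≤ {1} {9 * r} (*-mono-≤ {1} {9} {1} (s≤s z≤n) r>0) (m^n>0 2 i)
          i≤J : i ≤ m + i₀
          i≤J = +-monoˡ-≤ i₀ (<⇒≤ (toℕ<n j))
          2^i≤ : 2 ^ i ≤ 2 ^ (m + i₀)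
          2^i≤ = ^-monoʳ-≤ 2 i≤J
          μ≤2^i : μ ≤ 2 ^ i
          μ≤2^i = ^-monoʳ-≤ 2 (m≤n+m i₀ (toℕ j))
          -- The exchange rate of the budget: the cost is proportional to 2^i, the boost to 4^i ≥ μ
          -- 2^i. The cap does not spoil this, because `J-small` puts μ 2^i below `C` for all
          -- levels.
          μ2^i≤x' : μ * 2 ^ i ≤ x'
          μ2^i≤x' = ⊓-glb (≤-trans (*-monoˡ-≤ (2 ^ i) μ≤2^i) (≤-reflexive (sym (4^≡2^*2^ i))))
                          (≤-trans (*-monoʳ-≤ μ 2^i≤) J-small)
          4^i₀≤x' : 4 ^ i₀ ≤ x'
          4^i₀≤x' = ≤-trans (≤-reflexive (4^≡2^*2^ i₀)) (≤-trans (*-monoʳ-≤ μ μ≤2^i) μ2^i≤x')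
          a≤t : a st ≤ t
          a≤t = subst (a st ≤_) (c+a≡t st) (m≤n+m (a st) (c st))
          X'≢∅ : 0 < count X'
          X'≢∅ = n≢0⇒n>0 λ e → <⇒≱ (≤-trans (m^n>0 2 B) big)
            (≤-trans large (≤-reflexive (trans (cong (2 ^ (9 * r * 2 ^ i) *_) e) (*-zeroʳ (2 ^ (9 * r * 2 ^ i))))))
          β : ℚ
          β = p (a st) (h st + x') ℚ.- p (a st) (h st)
          boosted : Dense E (p (a st) (h st + x')) l X' (Y' l)
          boosted x∈ = subst (λ z → z ℚ.* ι (count (Y' l)) ℚ.≤ _) (cancel (p (a st) (h st)) (p (a st) (h st + x')))
            (dense' β (p-boost (a st) (h st) x' (4 ^ i) a≤t (m⊓n≤n (4 ^ i) C) (m⊓n≤m (4 ^ i) C)) x∈)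
            where
            cancel : ∀ p q → p ℚ.+ (q ℚ.- p) ≡ q
            cancel = Tactic.RingSolver.solve-∀ ring
          Y'>0 : ℚ.0ℚ ℚ.< ι (count (Y' l))
          Y'>0 = ℚ.<-≤-trans (*-pos (p>0 (a st) (h st)) (0<ι (size⇒Y≢∅ st))) (Y'≥ l)
          -- At any vertex of the non-empty `X'`, `boosted` bounds a true density in the non-empty
          -- `Y' l` from below, so `p` is at most 1.
          h'≤H : h st + x' ≤ H
          h'≤H = boost-bound ℓ ℓ-large (a st) (h st + x') (p≤1 (inhabited X' X'≢∅))
            where
            p≤1 : ∃ (λ v → v ∈ X') → p (a st) (h st + x') ℚ.≤ ℚ.1ℚ
            p≤1 (v , v∈X') = *-cancelˡ (ι (count (Y' l))) Y'>0 (ℚ.≤-trans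
              (ℚ.≤-reflexive (ℚ.*-comm (ι (count (Y' l))) (p (a st) (h st + x'))))
              (ℚ.≤-trans (boosted v∈X') (ℚ.≤-trans (ι-mono (count-mono {S = N l v ∩ Y' l} {S' = Y' l} λ w → ∩-right {S = N l v} {S' = Y' l}))
                (ℚ.≤-reflexive (sym (ℚ.*-identityʳ (ι (count (Y' l)))))))))
          x'≤slack : x' ≤ slack st
          x'≤slack = m+n≤o⇒m≤o∸n x' (subst (_≤ H) (+-comm (h st) x') h'≤H)
          μcost : ∀ {y} → x' ≤ y → μ * cost ≤ 9 * r * y
          μcost {y} x'≤y = begin
            μ * (9 * r * 2 ^ i) ≡⟨ swap μ (9 * r) (2 ^ i) ⟩
            9 * r * (μ * 2 ^ i) ≤⟨ *-monoʳ-≤ (9 * r) (≤-trans μ2^i≤x' x'≤y) ⟩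
            9 * r * y ∎
            where
            open ≤-Reasoning
            swap : ∀ a b c → a * (b * c) ≡ b * (a * c)
            swap = solve-∀
          cost≤B : cost ≤ B
          cost≤B = *-cancelˡ-≤ μ (begin
            μ * cost ≤⟨ μcost x'≤slack ⟩
            9 * r * slack st ≤⟨ *-monoʳ-≤ (9 * r) (≤-sum (λ i → slack (cs i)) l) ⟩
            9 * r * ΣH ≤⟨ m≤n+m (9 * r * ΣH) (μ * γ * Σa) ⟩
            μ * γ * Σa + 9 * r * ΣH ≤⟨ budget ⟩
            μ * B ∎)
            where open ≤-Reasoning
          X'-large : 2 ^ (B ∸ cost) ≤ count X'
          X'-large = pow-cancel B cost (B ∸ cost) (sym (m∸n+n≡m cost≤B)) big large
          new : ColourState X' l
          new = record
            { Y = Y' l ; Y⊆Y₀ = ⊆-trans (Y'⊆Y l) (Y⊆Y₀ st) ; a = a st ; c = c st ; h = h st + x' ; s = suc (s st)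
            ; c+a≡t = c+a≡t st
            ; h≤H   = h'≤H
            ; s-few = ≤-trans (+-mono-≤ 4^i₀≤x' (s-few st)) (≤-reflexive (+-comm x' (h st)))
            ; size  = subst (λ z → suc Z' ^ z * y₀ ≤ (r * Z) ^ z * count (Y' l)) (sym (+-suc (c st) (s st)))
                (shrink-size {c st + s st} {Y st} {Y' l} (a st) (h st) (c st + s st) (Y'≥ l) refl (size st))
            ; dense = boosted
            ; need  = λ cl → need st (clique-⊆ E (∪-mono X'⊆X (Y'⊆Y l)) cl)
            }
          budget' : Budget (B ∸ cost) (modify l new (λ i → restrict X'⊆X (cs i)))
          budget' = +-cancelʳ-≤ (μ * cost) _ _ (begin
            μ * γ * Σa' + 9 * r * ΣH' + μ * cost ≤⟨ +-monoʳ-≤ _ (μcost ≤-refl) ⟩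
            μ * γ * Σa' + 9 * r * ΣH' + 9 * r * x' ≡⟨ e (μ * γ * Σa') (9 * r) ΣH' x' ⟩
            μ * γ * Σa' + 9 * r * (ΣH' + x') ≤⟨ +-mono-≤
              (*-monoʳ-≤ (μ * γ) (≤-trans (m≤m+n Σa' 0) (sum-modify a l new cs X'⊆X (λ _ → refl) 0 (≤-reflexive (+-identityʳ (a st))))))
              (*-monoʳ-≤ (9 * r) (sum-modify slack l new cs X'⊆X (λ _ → refl) x' slack')) ⟩
            μ * γ * Σa + 9 * r * ΣH ≤⟨ budget ⟩
            μ * B ≡⟨ cong (μ *_) (m∸n+n≡m cost≤B) ⟨
            μ * (B ∸ cost + cost) ≡⟨ *-distribˡ-+ μ (B ∸ cost) cost ⟩
            μ * (B ∸ cost) + μ * cost ∎)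
            where
            open ≤-Reasoning
            Σa' = sum (λ i → a (modify l new (λ i → restrict X'⊆X (cs i)) i))
            ΣH' = sum (λ i → slack (modify l new (λ i → restrict X'⊆X (cs i)) i))
            e : ∀ a b c d → a + b * c + b * d ≡ a + b * (c + d)
            e = solve-∀
            slack' : H ∸ (h st + x') + x' ≤ slack st
            slack' = ≤-reflexive (trans (cong (_+ x') (sym (∸-+-assoc H (h st) x'))) (m∸n+n≡m x'≤slack))

        go : Goal
        go with next
        ... | inj₁ pr = colour-step pr
        ... | inj₂ bo = boost-step bo

      run fuel B X cs B≤ big budget = by-cases (any? (λ i → a (cs i) ℕ.≟ 0)) fuel B≤
        where
        by-cases : Dec (∃ λ i → a (cs i) ≡ 0) → ∀ fuel → B ≤ fuel → Goal
        by-cases (yes (j , a≡0)) _ _ = finish j (Y st) (s st) (Y⊆Y₀ st) (≤-trans (s-few st) (h≤H st))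
          (subst (λ z → suc Z' ^ (z + s st) * y₀ ≤ (r * Z) ^ (z + s st) * count (Y st)) c≡t (size st))
          (λ cl → need st (subst (λ z → Clique E j (z + κ' j) (X ∪ Y st)) (sym a≡0)
            (clique-⊆ E (λ v → ∪-right {S = X} {S' = Y st}) cl)))
          where
          st = cs j
          c≡t : c st ≡ t
          c≡t = trans (sym (+-identityʳ (c st))) (trans (cong (c st +_) (sym a≡0)) (c+a≡t st))
        -- With no colour finished the left side of the budget is positive, while `B` has run out.
        by-cases (no none) zero B≤0 = contradiction budget (<⇒≱ (begin-strict
          μ * B ≡⟨ cong (μ *_) (n≤0⇒n≡0 B≤0) ⟩
          μ * 0 ≡⟨ *-zeroʳ μ ⟩
          0 <⟨ *-mono-≤ {1} {μ * γ} (*-mono-≤ (m^n>0 2 i₀) (s≤s {n = r + 5 * r * μ} z≤n))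
                                    (≤-trans (n≢0⇒n>0 λ e → none (i , e)) (≤-sum (λ i → a (cs i)) i)) ⟩
          μ * γ * sum (λ i → a (cs i)) ≤⟨ m≤m+n _ _ ⟩
          _ ∎))
          where
          open ≤-Reasoning
          i : Fin r
          i = fromℕ< r>0
        by-cases (no none) (suc fuel) B≤ = Step.go fuel B X cs B≤ big budget (λ i → n≢0⇒n>0 λ e → none (i , e))
          (book-step E 2≤r i₀ m X (λ i → Y (cs i)) (λ i → p (a (cs i)) (h (cs i))) (λ i → α (h (cs i)))
                (≤-trans (m^n>0 2 B) big) (λ i → size⇒Y≢∅ (cs i)) (λ i → p>0 (a (cs i)) (h (cs i))) (λ i → α>0 (h (cs i)))
                (λ i → α-large (m + i₀) J-large (h (cs i))) (λ i → dense (cs i)))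

-- Reaching a set with almost equal colour densities.

module BalancedColourings where

  open Cliques
  open Counting
  open ErdosSzekeres
  open Powers
  open import Data.Fin using (Fin; zero; suc; _≟_)
  open import Data.Fin.Properties using (any?)
  open import Data.Nat as ℕ using (ℕ; zero; suc; _+_; _*_; _^_; _≤_; _<_; z≤n; s≤s; _≤?_)
  open import Data.Nat.Properties hiding (_≟_; _≤?_)
  open import Data.Nat.Tactic.RingSolver using (solve-∀)
  open import Data.Product using (∃; _×_; _,_)
  open import Data.Vec.Functional using (updateAt)
  open import Data.Vec.Functional.Properties using (updateAt-updates; updateAt-minimal)
  import Data.Sum
  open import Function using (const)
  open import Relation.Binary.PropositionalEquality
  open import Relation.Nullary using (yes; no; _×-dec_; contradiction)

  -- If some colour is sparse at a vertex of W then another colour is dense there, and passing to its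
  -- neighbourhood loses less than the factor r of the Erdős–Szekeres step.
  module Balancing {n r : ℕ} (E : EdgeColouring n r) (Goal : Set) (Z₀ : ℕ) (0<r : 0 < r) where
    open EdgeColouring E

    -- A colour below (1 - 1/Z)/r, where Z = Z₀ + 1, leaves a surplus of 1/(rZ) to the others, so
    -- one of them gains a relative 1/(rZ) or more. The factor 2 absorbs the missing vertex `v`.
    A : ℕ
    A = 2 * r * suc Z₀

    SparseAt : Subset n → Fin n → Fin r → Set
    SparseAt W v i = r * suc Z₀ * count (N i v ∩ W) < Z₀ * count W

    Balanced : Subset n → Set
    Balanced W = ∀ i {v} → v ∈ W → Z₀ * count W ≤ r * suc Z₀ * count (N i v ∩ W)

    balanced? : ∀ W → (∃ λ v → ∃ λ i → v ∈ W × SparseAt W v i) Data.Sum.⊎ Balanced W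
    balanced? W with any? (λ v → any? λ i → (v ∈? W) ×-dec (suc (r * suc Z₀ * count (N i v ∩ W)) ≤? Z₀ * count W))
    ... | yes sparse = Data.Sum.inj₁ sparse
    ... | no none    = Data.Sum.inj₂ λ i v∈W → ≮⇒≥ λ lt → none (_ , i , v∈W , lt)

    dense-colour : ∀ {W v i} → A ≤ count W → SparseAt W v i → ∃ λ l → suc A * count W < r * A * count (N l v ∩ W)
    dense-colour {W} {v} {i} A≤w sparse = conclude (pigeonhole g f sums)
      where
      w : ℕ
      w = count W
      d f g : Fin r → ℕ
      d l = count (N l v ∩ W)
      f l = r * A * d l
      -- The threshold of `i` is one that sparsity forbids it to exceed. The 2rw thereby saved pays
      -- the extra `w` in each other threshold and the `r * A ≤ r * w` lost with `v`.
      g = updateAt (λ _ → suc A * w) i (const (2 * r * Z₀ * w))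
      w>0 : 0 < w
      w>0 = ≤-trans (*-mono-≤ {1} {2 * r} (*-mono-≤ {1} {2} {1} (s≤s z≤n) 0<r) (s≤s {n = Z₀} z≤n)) A≤w
      sums : sum g < sum f
      sums = +-cancelʳ-< (suc A * w) _ _ (+-cancelʳ-< (r * A) _ _ (begin-strict
        sum g + suc A * w + r * A ≡⟨ cong (_+ r * A) (sum-updateAt (λ _ → suc A * w) i (const (2 * r * Z₀ * w))) ⟩
        sum {r} (λ _ → suc A * w) + 2 * r * Z₀ * w + r * A ≡⟨ cong (λ z → z + 2 * r * Z₀ * w + r * A) (sum-const r (suc A * w)) ⟩
        r * (suc A * w) + 2 * r * Z₀ * w + r * A ≡⟨ e₁ r A w Z₀ ⟩
        r * A + (r * A * w + r * w + 2 * r * Z₀ * w) <⟨ +-monoˡ-< _ (≤-<-trans (*-monoʳ-≤ r A≤w) (m<m+n (r * w) w>0)) ⟩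
        r * w + w + (r * A * w + r * w + 2 * r * Z₀ * w) ≡⟨ e₂ r w Z₀ (r * A * w) ⟩
        r * A * w + suc A * w ≤⟨ +-monoˡ-≤ (suc A * w) (*-monoʳ-≤ (r * A) (cover-count E W v)) ⟩
        r * A * suc (sum d) + suc A * w ≡⟨ cong (_+ suc A * w) (*-suc (r * A) (sum d)) ⟩
        r * A + r * A * sum d + suc A * w ≡⟨ cong (λ z → r * A + z + suc A * w) (*-distribˡ-sum (r * A) d) ⟩
        r * A + sum f + suc A * w ≡⟨ e₃ (r * A) (sum f) (suc A * w) ⟩
        sum f + suc A * w + r * A ∎))
        where
        open ≤-Reasoning
        e₁ : ∀ r A w z → r * (suc A * w) + 2 * r * z * w + r * A ≡ r * A + (r * A * w + r * w + 2 * r * z * w)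
        e₁ = solve-∀
        e₂ : ∀ r w z x → r * w + w + (x + r * w + 2 * r * z * w) ≡ x + suc (2 * r * suc z) * w
        e₂ = solve-∀
        e₃ : ∀ a b c → a + b + c ≡ b + c + a
        e₃ = solve-∀
      conclude : ∃ (λ l → g l < f l) → ∃ λ l → suc A * w < r * A * d l
      conclude (l , lt) with l ≟ i
      ... | no l≢i   = l , subst (_< f l) (updateAt-minimal l i (λ _ → suc A * w) l≢i) lt
      ... | yes refl = contradiction (subst (_< f l) (updateAt-updates i (λ _ → suc A * w)) lt) (<⇒≱ (s≤s (begin
        r * (2 * r * suc Z₀) * d i ≡⟨ e₁ r (suc Z₀) (d i) ⟩
        2 * r * (r * suc Z₀ * d i) ≤⟨ *-monoʳ-≤ (2 * r) (<⇒≤ sparse) ⟩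
        2 * r * (Z₀ * w) ≡⟨ *-assoc (2 * r) Z₀ w ⟨
        2 * r * Z₀ * w ∎)))
        where
        open ≤-Reasoning
        e₁ : ∀ r z d → r * (2 * r * z) * d ≡ 2 * r * (r * z * d)
        e₁ = solve-∀

    -- After `s` steps, |W| ≥ n₀ r^-s (1 + 1/A)^s: `size` records the gain over Erdős-Szekeres.
    -- `k≤κ+s` keeps every colour close to its original demand.
    record Stage (n₀ k s : ℕ) (κ : Fin r → ℕ) (W : Subset n) : Set where
      field
        κ≤k   : ∀ i → κ i ≤ k
        k≤κ+s : ∀ i → k ≤ κ i + s
        total : sum κ + s ≡ r * k
        size  : n₀ * suc A ^ s ≤ count W * (r * A) ^ s
        needs : Needs E Goal κ W

    size⇒large : ∀ {n₀ k s κ W} → Stage n₀ k s κ W → n₀ ≤ count W * r ^ s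
    size⇒large {n₀} {s = s} {W = W} st = *-cancelˡ-≤ (A ^ s) {{A^s≢0}} (begin
      A ^ s * n₀ ≡⟨ *-comm (A ^ s) n₀ ⟩
      n₀ * A ^ s ≤⟨ *-monoʳ-≤ n₀ (^-monoˡ-≤ s (n≤1+n A)) ⟩
      n₀ * suc A ^ s ≤⟨ Stage.size st ⟩
      count W * (r * A) ^ s ≡⟨ cong (count W *_) (^-*-distrib r A s) ⟩
      count W * (r ^ s * A ^ s) ≡⟨ e (count W) (r ^ s) (A ^ s) ⟩
      A ^ s * (count W * r ^ s) ∎)
      where
      open ≤-Reasoning
      A^s≢0 : ℕ.NonZero (A ^ s)
      A^s≢0 = m^n≢0 A s {{ℕ.>-nonZero (*-mono-≤ {1} {2 * r} (*-mono-≤ {1} {2} {1} (s≤s z≤n) 0<r) (s≤s {n = Z₀} z≤n))}}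
      e : ∀ a b c → a * (b * c) ≡ c * (a * b)
      e = solve-∀

    -- At most `S` steps are made. `A * r ^ S ≤ n₀` keeps `W` large enough for `dense-colour` at
    -- each of them, and `S ≤ k` prevents a colour from being used up.
    balance : ∀ {n₀ k} S → S ≤ k → A * r ^ S ≤ n₀ →
      (∀ {κ W} → Stage n₀ k S κ W → Goal) →
      (∀ {s κ W} → s ≤ S → Stage n₀ k s κ W → Balanced W → Goal) →
      ∀ f s {κ W} → f + s ≡ S → Stage n₀ k s κ W → Goal
    balance S S≤k n₀-large long even zero    s refl st = long st
    balance {n₀} {k} S S≤k n₀-large long even (suc f) s {κ} {W} eq st = by-balance (balanced? W)
      where
      s<S : s < S
      s<S = subst (s <_) eq (s≤s (m≤n+m s f))
      A≤W : A ≤ count W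
      A≤W = *-cancelˡ-≤ (r ^ s) {{m^n≢0 r s {{ℕ.>-nonZero 0<r}}}} (begin
        r ^ s * A ≡⟨ *-comm (r ^ s) A ⟩
        A * r ^ s ≤⟨ *-monoʳ-≤ A (^-monoʳ-≤ r {{ℕ.>-nonZero 0<r}} (<⇒≤ s<S)) ⟩
        A * r ^ S ≤⟨ n₀-large ⟩
        n₀ ≤⟨ size⇒large st ⟩
        count W * r ^ s ≡⟨ *-comm (count W) (r ^ s) ⟩
        r ^ s * count W ∎)
        where open ≤-Reasoning
      open Stage st
      by-balance : (∃ λ v → ∃ λ i → v ∈ W × SparseAt W v i) Data.Sum.⊎ Balanced W → Goal
      by-balance (Data.Sum.inj₂ bal) = even (<⇒≤ s<S) st bal
      by-balance (Data.Sum.inj₁ (v , i , v∈W , sparse)) = descend (dense-colour A≤W sparse)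
        where
        descend : ∃ (λ l → suc A * count W < r * A * count (N l v ∩ W)) → Goal
        descend (l , lt) = balance S S≤k n₀-large long even f (suc s) {drop l κ} {N l v ∩ W} (trans (+-suc f s) eq) record
          { κ≤k   = λ i → ≤-trans (drop≤ i) (κ≤k i)
          ; k≤κ+s = k≤
          ; total = trans (+-suc (sum (drop l κ)) s) (trans (cong (_+ s) (sym (sum-drop κ l κl>0))) total)
          ; size  = size'
          ; needs = needs-drop E Goal l κl>0 v∈W needs
          }
          where
          κl>0 : 0 < κ l
          κl>0 = n≢0⇒n>0 λ κl≡0 → <⇒≱ (<-≤-trans s<S S≤k) (subst (λ z → k ≤ z + s) κl≡0 (k≤κ+s l))
          drop≤ : ∀ i → drop l κ i ≤ κ i
          drop≤ i with i ≟ l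
          ... | yes refl = ≤-trans (≤-reflexive (updateAt-updates l κ)) pred[n]≤n
          ... | no i≢l   = ≤-reflexive (updateAt-minimal i l κ i≢l)
          k≤ : ∀ i → k ≤ drop l κ i + suc s
          k≤ i with i ≟ l
          ... | yes refl = ≤-trans (k≤κ+s l) (≤-reflexive (sym (trans (cong (_+ suc s) (updateAt-updates l κ))
                             (trans (+-suc _ s) (cong (_+ s) (suc-pred (κ l) {{ℕ.>-nonZero κl>0}}))))))
          ... | no i≢l   = ≤-trans (k≤κ+s i) (≤-trans (+-monoʳ-≤ (κ i) (n≤1+n s)) (≤-reflexive (cong (_+ suc s) (sym (updateAt-minimal i l κ i≢l)))))
          size' : n₀ * suc A ^ suc s ≤ count (N l v ∩ W) * (r * A) ^ suc s
          size' = begin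
            n₀ * (suc A * suc A ^ s) ≡⟨ e₁ n₀ (suc A) (suc A ^ s) ⟩
            suc A * (n₀ * suc A ^ s) ≤⟨ *-monoʳ-≤ (suc A) size ⟩
            suc A * (count W * (r * A) ^ s) ≡⟨ *-assoc (suc A) (count W) _ ⟨
            suc A * count W * (r * A) ^ s ≤⟨ *-monoˡ-≤ ((r * A) ^ s) (<⇒≤ lt) ⟩
            r * A * count (N l v ∩ W) * (r * A) ^ s ≡⟨ e₂ (r * A) (count (N l v ∩ W)) ((r * A) ^ s) ⟩
            count (N l v ∩ W) * (r * A * (r * A) ^ s) ∎
            where
            open ≤-Reasoning
            e₁ : ∀ a b c → a * (b * c) ≡ b * (a * c)
            e₁ = solve-∀
            e₂ : ∀ a b c → a * b * c ≡ b * (a * c)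
            e₂ = solve-∀

-- Bounding the partial sums of the exponential series by powers of two.

module Exponential where

  open import Defs
  open RationalOrder
  import Data.Integer as ℤ
  import Data.Integer.Properties as ℤ
  open import Data.Nat as ℕ using (ℕ; zero; suc; _^_)
  import Data.Nat.Properties as ℕ
  open import Data.Rational
  open import Data.Rational.Properties
  import Data.Rational.Unnormalised as ℚᵘ
  import Data.Rational.Unnormalised.Properties as ℚᵘ
  open import Relation.Binary.PropositionalEquality
  open import Tactic.RingSolver using (solve-∀)

  -- coeff K i is the coefficient of z^i in (1 - z/2)^(-K), which dominates that of e^(Kz/2).
  coeff : ℕ → ℕ → ℚ
  coeff K       zero    = 1ℚ
  coeff zero    (suc i) = 0ℚ
  coeff (suc K) (suc i) = ½ * coeff (suc K) i + coeff K (suc i)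

  coeff≥0 : ∀ K i → 0ℚ ≤ coeff K i
  coeff≥0 K       zero    = 0≤1
  coeff≥0 zero    (suc i) = ≤-refl
  coeff≥0 (suc K) (suc i) = +-nonneg (*-nonneg {½} 0≤½ (coeff≥0 (suc K) i)) (coeff≥0 K (suc i))
    where
    0≤½ : 0ℚ ≤ ½
    0≤½ = nonNegative⁻¹ ½

  partialSum : ℕ → ℕ → ℚ
  partialSum K zero    = 0ℚ
  partialSum K (suc N) = partialSum K N + coeff K N

  partialSum-zero : ∀ N → partialSum 0 N ≤ 1ℚ
  partialSum-zero zero          = 0≤1
  partialSum-zero (suc zero)    = ≤-refl
  partialSum-zero (suc (suc N)) = subst (_≤ 1ℚ) (sym (+-identityʳ _)) (partialSum-zero (suc N))

  -- The coefficient form of (1 - z/2) F_{K+1} = F_K for F_K = (1 - z/2)^(-K), summed up.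
  partialSum-suc : ∀ K N → partialSum (suc K) (suc N) ≡ ½ * partialSum (suc K) N + partialSum K (suc N)
  partialSum-suc K zero    = refl
  partialSum-suc K (suc N) = trans (cong (_+ coeff (suc K) (suc N)) (partialSum-suc K N))
    (regroup ½ (partialSum (suc K) N) (partialSum K (suc N)) (coeff (suc K) N) (coeff K (suc N)))
    where
    regroup : ∀ h S T c d → h * S + T + (h * c + d) ≡ h * (S + c) + (T + d)
    regroup = solve-∀ ring

  -- The value of (1 - z/2)^(-K) at z = 1 is 2^K, and all coefficients are non-negative.
  partialSum-bound : ∀ K N → partialSum K N ≤ ι (2 ^ K)
  partialSum-bound zero    N       = ≤-trans (partialSum-zero N) (≤-reflexive (sym ι-1))
  partialSum-bound (suc K) zero    = 0≤ι (2 ^ suc K)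
  partialSum-bound (suc K) (suc N) = begin
    partialSum (suc K) (suc N) ≡⟨ partialSum-suc K N ⟩
    ½ * partialSum (suc K) N + partialSum K (suc N) ≤⟨ +-mono-≤ (*-monoˡ-≤-nonNeg ½ (partialSum-bound (suc K) N)) (partialSum-bound K (suc N)) ⟩
    ½ * ι (2 ^ suc K) + ι (2 ^ K) ≡⟨ cong (λ z → ½ * z + ι (2 ^ K)) (ι-* 2 (2 ^ K)) ⟩
    ½ * (ι 2 * ι (2 ^ K)) + ι (2 ^ K) ≡⟨ e (ι (2 ^ K)) ⟩
    ι 2 * ι (2 ^ K) ≡⟨ ι-* 2 (2 ^ K) ⟨
    ι (2 ^ suc K) ∎
    where
    open ≤-Reasoning
    opaque
      unfolding ι
      e : ∀ x → ½ * (ι 2 * x) + x ≡ ι 2 * x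
      e = solve-∀ ring

  -- The derivative of (1 - z/2)^(-K) is (K/2)(1 - z/2)^(-K-1), which dominates K/2 times the
  -- series. The series of e^(Kz/2) satisfies the same recurrence with equality, hence the
  -- domination.
  coeff-ratio : ∀ K i → ½ * ι K * coeff K i ≤ ι (suc i) * coeff K (suc i)
  coeff-ratio zero    i = ≤-trans (≤-reflexive (trans (cong (λ z → ½ * z * coeff 0 i) ι-0) (*-zeroˡ (coeff 0 i))))
    (≤-reflexive (sym (*-zeroʳ (ι (suc i)))))
  coeff-ratio (suc K) zero = begin
    ½ * ι (suc K) * 1ℚ ≡⟨ cong (λ z → ½ * z * 1ℚ) (ι-suc K) ⟩
    ½ * (1ℚ + ι K) * 1ℚ ≡⟨ e (ι K) ⟩
    ½ * 1ℚ + ½ * ι K * 1ℚ ≤⟨ +-monoʳ-≤ (½ * 1ℚ) (coeff-ratio K zero) ⟩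
    ½ * 1ℚ + ι 1 * coeff K 1 ≡⟨ cong (λ z → ½ * 1ℚ + z) (trans (cong (_* coeff K 1) ι-1) (*-identityˡ (coeff K 1))) ⟩
    ½ * 1ℚ + coeff K 1 ≡⟨ trans (sym (*-identityˡ _)) (cong (_* coeff (suc K) 1) (sym ι-1)) ⟩
    ι 1 * coeff (suc K) 1 ∎
    where
    open ≤-Reasoning
    e : ∀ k → ½ * (1ℚ + k) * 1ℚ ≡ ½ * 1ℚ + ½ * k * 1ℚ
    e = solve-∀ ring
  coeff-ratio (suc K) (suc i) = begin
    ½ * ι (suc K) * (½ * a + b) ≡⟨ cong (λ z → ½ * z * (½ * a + b)) (ι-suc K) ⟩
    ½ * (1ℚ + ι K) * (½ * a + b)
      ≤⟨ ≤-by (½ * (½ * a) + ½ * (ι (suc i) * (½ * a + b) - ½ * ι (suc K) * a))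
           (trans (e (ι K) (ι (suc i)) a b)
             (cong (λ z → ½ * (1ℚ + ι K) * (½ * a + b) + (½ * (½ * a) + ½ * (ι (suc i) * (½ * a + b) - ½ * z * a))) (sym (ι-suc K))))
           (+-nonneg (*-nonneg {½} 0≤½ (*-nonneg {½} 0≤½ (coeff≥0 (suc K) i))) (*-nonneg {½} 0≤½ (diff-≥0 (coeff-ratio (suc K) i)))) ⟩
    ½ * (½ * a + b) + ½ * ι (suc i) * (½ * a + b) + ½ * ι K * b
      ≤⟨ +-monoʳ-≤ (½ * (½ * a + b) + ½ * ι (suc i) * (½ * a + b)) (coeff-ratio K (suc i)) ⟩
    ½ * (½ * a + b) + ½ * ι (suc i) * (½ * a + b) + ι (suc (suc i)) * coeff K (suc (suc i))
      ≡⟨ cong (λ z → ½ * (½ * a + b) + ½ * ι (suc i) * (½ * a + b) + z * coeff K (suc (suc i))) (ι-suc (suc i)) ⟩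
    ½ * (½ * a + b) + ½ * ι (suc i) * (½ * a + b) + (1ℚ + ι (suc i)) * coeff K (suc (suc i))
      ≡⟨ f (½ * a + b) (ι (suc i)) (coeff K (suc (suc i))) ⟩
    (1ℚ + ι (suc i)) * coeff (suc K) (suc (suc i))
      ≡⟨ cong (_* coeff (suc K) (suc (suc i))) (ι-suc (suc i)) ⟨
    ι (suc (suc i)) * coeff (suc K) (suc (suc i)) ∎
    where
    open ≤-Reasoning
    a = coeff (suc K) i
    b = coeff K (suc i)
    0≤½ : 0ℚ ≤ ½
    0≤½ = nonNegative⁻¹ ½
    e : ∀ k i a b → ½ * (½ * a + b) + ½ * i * (½ * a + b) + ½ * k * b
      ≡ ½ * (1ℚ + k) * (½ * a + b) + (½ * (½ * a) + ½ * (i * (½ * a + b) - ½ * (1ℚ + k) * a))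
    e = solve-∀ ring
    f : ∀ s i c → ½ * s + ½ * i * s + (1ℚ + i) * c ≡ (1ℚ + i) * (½ * s + c)
    f = solve-∀ ring

  module _ (x : ℚ) (0≤x : 0ℚ ≤ x) (M : ℕ) (x≤M : x ≤ ι M) where

    expTerm≥0 : ∀ i → 0ℚ ≤ expTerm x i
    expTerm≥0 zero    = 0≤1
    expTerm≥0 (suc i) = *-nonneg (expTerm≥0 i) (*-nonneg 0≤x (nonNegative⁻¹ (ℤ.+ 1 / suc i) {{normalize-nonNeg 1 (suc i)}}))

    ι·1/ : ∀ i → ι (suc i) * (ℤ.+ 1 / suc i) ≡ 1ℚ
    ι·1/ i = toℚᵘ-injective (ℚᵘ.≃-trans (toℚᵘ-homo-* (ι (suc i)) (ℤ.+ 1 / suc i))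
      (ℚᵘ.≃-trans (ℚᵘ.*-cong (ι-toℚᵘ (suc i)) (toℚᵘ-fromℚᵘ (ℚᵘ.mkℚᵘ (ℤ.+ 1) i)))
        (ℚᵘ.*≡* (cong ℤ.+_ (trans (ℕ.*-identityʳ _) (trans (ℕ.*-identityʳ _) (sym (trans (ℕ.+-identityʳ _) (ℕ.+-identityʳ _)))))))))

    expTerm≤coeff : ∀ i → expTerm x i ≤ coeff (2 ℕ.* M) i
    expTerm≤coeff zero    = ≤-refl
    expTerm≤coeff (suc i) = *-cancelˡ (ι (suc i)) (0<ι {suc i} (ℕ.s≤s ℕ.z≤n)) (begin
      ι (suc i) * (expTerm x i * (x * (ℤ.+ 1 / suc i))) ≡⟨ e₁ (ι (suc i)) (expTerm x i) x (ℤ.+ 1 / suc i) ⟩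
      ι (suc i) * (ℤ.+ 1 / suc i) * (expTerm x i * x) ≡⟨ cong (_* (expTerm x i * x)) (ι·1/ i) ⟩
      1ℚ * (expTerm x i * x) ≡⟨ *-identityˡ _ ⟩
      expTerm x i * x ≤⟨ *-mono (expTerm≥0 i) (0≤ι M) (expTerm≤coeff i) x≤M ⟩
      coeff (2 ℕ.* M) i * ι M ≡⟨ e₂ (coeff (2 ℕ.* M) i) (ι M) ⟩
      ½ * (ι 2 * ι M) * coeff (2 ℕ.* M) i ≡⟨ cong (λ z → ½ * z * coeff (2 ℕ.* M) i) (ι-* 2 M) ⟨
      ½ * ι (2 ℕ.* M) * coeff (2 ℕ.* M) i ≤⟨ coeff-ratio (2 ℕ.* M) i ⟩
      ι (suc i) * coeff (2 ℕ.* M) (suc i) ∎)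
      where
      open ≤-Reasoning
      e₁ : ∀ s t x u → s * (t * (x * u)) ≡ s * u * (t * x)
      e₁ = solve-∀ ring
      opaque
        unfolding ι
        e₂ : ∀ c m → c * m ≡ ½ * (ι 2 * m) * c
        e₂ = solve-∀ ring

    -- Using 4 in place of e costs a constant in the exponent, for which δ has room, and turns the
    -- target into a power of two.
    expPartial≤4^ : ∀ N → expPartial x N ≤ ι (2 ^ (2 ℕ.* M))
    expPartial≤4^ N = ≤-trans (go N) (partialSum-bound (2 ℕ.* M) N)
      where
      go : ∀ N → expPartial x N ≤ partialSum (2 ℕ.* M) N
      go zero    = ≤-refl
      go (suc N) = +-mono-≤ (go N) (expTerm≤coeff N)

  fraction≤ : ∀ k d .{{_ : ℕ.NonZero d}} M → k ℕ.≤ M ℕ.* d → ℤ.+ k / d ≤ ι M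
  fraction≤ k (suc d) M k≤ = toℚᵘ-cancel-≤ (ℚᵘ.≤-trans (ℚᵘ.≤-reflexive (toℚᵘ-fromℚᵘ (ℚᵘ.mkℚᵘ (ℤ.+ k) d)))
    (ℚᵘ.≤-trans (ℚᵘ.*≤* (subst₂ ℤ._≤_ (sym (ℤ.*-identityʳ (ℤ.+ k))) (ℤ.pos-* M (suc d)) (ℤ.+≤+ k≤)))
      (ℚᵘ.≤-reflexive (ℚᵘ.≃-sym (ι-toℚᵘ M)))))

  δk≥0 : ∀ r k hr → 0ℚ ≤ δk r k hr
  δk≥0 (suc r') k hr = nonNegative⁻¹ _ {{normalize-nonNeg k (2 ^ 160 ℕ.* suc r' ^ 12)
    {{ℕ.m*n≢0 (2 ^ 160) (suc r' ^ 12) {{ℕ.m^n≢0 2 160}} {{ℕ.m^n≢0 (suc r') 12}}}}}}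

  δk≤ : ∀ r k hr M → k ℕ.≤ M ℕ.* (2 ^ 160 ℕ.* r ^ 12) → δk r k hr ≤ ι M
  δk≤ (suc r') k hr M k≤ = fraction≤ k (2 ^ 160 ℕ.* suc r' ^ 12)
    {{ℕ.m*n≢0 (2 ^ 160) (suc r' ^ 12) {{ℕ.m^n≢0 2 160}} {{ℕ.m^n≢0 (suc r') 12}}}} M k≤

-- Integer estimates for (1 + 1/M)^x and the skewed weights.

module PowerBounds where

  open Counting
  open ErdosSzekeres using (prodPow)
  open Powers
  open import Data.Fin using (Fin; zero; suc)
  open import Data.Nat as ℕ using (ℕ; zero; suc; _+_; _*_; _∸_; _^_; _≤_; _<_; z≤n; s≤s)
  open import Data.Nat.Properties
  open import Data.Nat.Tactic.RingSolver using (solve-∀)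
  open import Data.Vec.Functional using (updateAt)
  open import Function using (_∘_; const)
  open import Relation.Binary.PropositionalEquality

  bernoulli : ∀ M x → (M + x) * M ^ x ≤ suc M ^ x * M
  bernoulli M zero    = ≤-reflexive (trans (*-identityʳ (M + 0)) (trans (+-identityʳ M) (sym (*-identityˡ M))))
  bernoulli M (suc x) = begin
    (M + suc x) * (M * M ^ x) ≤⟨ m≤m+n _ (x * M ^ x) ⟩
    (M + suc x) * (M * M ^ x) + x * M ^ x ≡⟨ e M x (M ^ x) ⟩
    suc M * ((M + x) * M ^ x) ≤⟨ *-monoʳ-≤ (suc M) (bernoulli M x) ⟩
    suc M * (suc M ^ x * M) ≡⟨ *-assoc (suc M) (suc M ^ x) M ⟨
    suc M ^ suc x * M ∎
    where
    open ≤-Reasoning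
    e : ∀ M x p → (M + suc x) * (M * p) + x * p ≡ suc M * ((M + x) * p)
    e = solve-∀

  -- (1 + 1/M)^M ≥ 2 by Bernoulli, applied `y` times; the remaining factors are at least 1.
  pow-lower : ∀ {M} y x → 0 < M → M * y ≤ x → 2 ^ y * M ^ x ≤ suc M ^ x
  pow-lower {M} y x M>0 My≤x = begin
    2 ^ y * M ^ x ≡⟨ cong (λ z → 2 ^ y * M ^ z) (m+[n∸m]≡n My≤x) ⟨
    2 ^ y * M ^ (M * y + d) ≡⟨ cong (2 ^ y *_) (^-distribˡ-+-* M (M * y) d) ⟩
    2 ^ y * (M ^ (M * y) * M ^ d) ≡⟨ *-assoc (2 ^ y) (M ^ (M * y)) (M ^ d) ⟨
    2 ^ y * M ^ (M * y) * M ^ d ≡⟨ cong (λ z → 2 ^ y * z * M ^ d) (sym (^-*-assoc M M y)) ⟩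
    2 ^ y * (M ^ M) ^ y * M ^ d ≡⟨ cong (_* M ^ d) (^-*-distrib 2 (M ^ M) y) ⟨
    (2 * M ^ M) ^ y * M ^ d ≤⟨ *-mono-≤ (^-monoˡ-≤ y double) (^-monoˡ-≤ d (n≤1+n M)) ⟩
    (suc M ^ M) ^ y * suc M ^ d ≡⟨ cong (_* suc M ^ d) (^-*-assoc (suc M) M y) ⟩
    suc M ^ (M * y) * suc M ^ d ≡⟨ ^-distribˡ-+-* (suc M) (M * y) d ⟨
    suc M ^ (M * y + d) ≡⟨ cong (suc M ^_) (m+[n∸m]≡n My≤x) ⟩
    suc M ^ x ∎
    where
    open ≤-Reasoning
    d = x ∸ M * y
    e : ∀ M p → M * (2 * p) ≡ (M + M) * p
    e = solve-∀
    double : 2 * M ^ M ≤ suc M ^ M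
    double = *-cancelˡ-≤ M {{ℕ.>-nonZero M>0}} (≤-trans (≤-reflexive (e M (M ^ M)))
      (≤-trans (bernoulli M M) (≤-reflexive (*-comm (suc M ^ M) M))))

  -- (1 + 1/g)^h ≤ 1 + 2h/g ≤ 2 for 2h ≤ g; then `y` blocks of length `h` cover `q`.
  pow-upper : ∀ {g} h y q → 2 * h ≤ g → q ≤ h * y → suc g ^ q ≤ 2 ^ y * g ^ q
  pow-upper {g} zero y q _ q≤0 rewrite n≤0⇒n≡0 q≤0 = ≤-trans (m^n>0 2 y) (≤-reflexive (sym (*-identityʳ (2 ^ y))))
  pow-upper {g} h@(suc _) y q 2h≤g q≤ = *-cancelʳ-≤ _ _ (g ^ d) {{m^n≢0 g d {{g≢0}}}} (begin
    suc g ^ q * g ^ d ≤⟨ *-monoʳ-≤ (suc g ^ q) (^-monoˡ-≤ d (n≤1+n g)) ⟩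
    suc g ^ q * suc g ^ d ≡⟨ ^-distribˡ-+-* (suc g) q d ⟨
    suc g ^ (q + d) ≡⟨ cong (suc g ^_) (m+[n∸m]≡n q≤) ⟩
    suc g ^ (h * y) ≡⟨ ^-*-assoc (suc g) h y ⟨
    (suc g ^ h) ^ y ≤⟨ ^-monoˡ-≤ y double ⟩
    (2 * g ^ h) ^ y ≡⟨ ^-*-distrib 2 (g ^ h) y ⟩
    2 ^ y * (g ^ h) ^ y ≡⟨ cong (2 ^ y *_) (^-*-assoc g h y) ⟩
    2 ^ y * g ^ (h * y) ≡⟨ cong (λ z → 2 ^ y * g ^ z) (m+[n∸m]≡n q≤) ⟨
    2 ^ y * g ^ (q + d) ≡⟨ cong (2 ^ y *_) (^-distribˡ-+-* g q d) ⟩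
    2 ^ y * (g ^ q * g ^ d) ≡⟨ *-assoc (2 ^ y) (g ^ q) (g ^ d) ⟨
    2 ^ y * g ^ q * g ^ d ∎)
    where
    open ≤-Reasoning
    d = h * y ∸ q
    g>0 : 0 < g
    g>0 = ≤-trans (s≤s z≤n) 2h≤g
    g≢0 : ℕ.NonZero g
    g≢0 = ℕ.>-nonZero g>0
    linear : ∀ x → 2 * x ≤ g → suc g ^ x * g ≤ (g + 2 * x) * g ^ x
    linear zero    _   = ≤-reflexive (trans (*-identityˡ g) (sym (trans (*-identityʳ (g + 0)) (+-identityʳ g))))
    linear (suc x) 2x≤ = begin
      suc g * suc g ^ x * g ≡⟨ *-assoc (suc g) (suc g ^ x) g ⟩
      suc g * (suc g ^ x * g) ≤⟨ *-monoʳ-≤ (suc g) (linear x 2x≤g) ⟩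
      suc g * ((g + 2 * x) * g ^ x) ≡⟨ e₁ g x (g ^ x) ⟩
      (g * (g + 2 * x + 1) + 2 * x) * g ^ x ≤⟨ *-monoˡ-≤ (g ^ x) (+-monoʳ-≤ (g * (g + 2 * x + 1)) 2x≤g) ⟩
      (g * (g + 2 * x + 1) + g) * g ^ x ≡⟨ e₂ g x (g ^ x) ⟩
      (g + 2 * suc x) * (g * g ^ x) ∎
      where
      2x≤g : 2 * x ≤ g
      2x≤g = ≤-trans (*-monoʳ-≤ 2 (n≤1+n x)) 2x≤
      e₁ : ∀ g x p → suc g * ((g + 2 * x) * p) ≡ (g * (g + 2 * x + 1) + 2 * x) * p
      e₁ = solve-∀
      e₂ : ∀ g x p → (g * (g + 2 * x + 1) + g) * p ≡ (g + 2 * suc x) * (g * p)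
      e₂ = solve-∀
    e₃ : ∀ g p → (g + g) * p ≡ 2 * p * g
    e₃ = solve-∀
    double : suc g ^ h ≤ 2 * g ^ h
    double = *-cancelʳ-≤ _ _ g {{g≢0}} (≤-trans (linear h 2h≤g)
      (≤-trans (*-monoˡ-≤ (g ^ h) (+-monoʳ-≤ g 2h≤g)) (≤-reflexive (e₃ g (g ^ h)))))

  skew : ∀ {r} → Fin r → ℕ → ℕ → Fin r → ℕ
  skew j u v = updateAt (λ _ → u) j (const v)

  sum-skew : ∀ {r} (j : Fin (suc r)) u v → sum (skew j u v) ≡ v + r * u
  sum-skew {r} j u v = +-cancelʳ-≡ u _ _ (trans (sum-updateAt (λ _ → u) j (const v))
    (trans (cong (_+ v) (sum-const (suc r) u)) (e u v (r * u))))
    where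
    e : ∀ u v x → u + x + v ≡ v + x + u
    e = solve-∀

  prodPow-const : ∀ {r} u (κ : Fin r → ℕ) → prodPow (λ _ → u) κ ≡ u ^ sum κ
  prodPow-const {zero}  u κ = refl
  prodPow-const {suc r} u κ = trans (cong (u ^ κ zero *_) (prodPow-const u (κ ∘ suc))) (sym (^-distribˡ-+-* u (κ zero) (sum (κ ∘ suc))))

  prodPow-skew : ∀ {r} (j : Fin r) u v (κ : Fin r → ℕ) → prodPow (skew j u v) κ * u ^ κ j ≡ v ^ κ j * u ^ sum κ
  prodPow-skew zero u v κ = begin
    v ^ κ zero * prodPow (λ _ → u) (κ ∘ suc) * u ^ κ zero ≡⟨ cong (λ z → v ^ κ zero * z * u ^ κ zero) (prodPow-const u (κ ∘ suc)) ⟩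
    v ^ κ zero * u ^ sum (κ ∘ suc) * u ^ κ zero ≡⟨ e (v ^ κ zero) (u ^ sum (κ ∘ suc)) (u ^ κ zero) ⟩
    v ^ κ zero * (u ^ κ zero * u ^ sum (κ ∘ suc)) ≡⟨ cong (v ^ κ zero *_) (^-distribˡ-+-* u (κ zero) _) ⟨
    v ^ κ zero * u ^ sum κ ∎
    where
    open ≡-Reasoning
    e : ∀ a b c → a * b * c ≡ a * (c * b)
    e = solve-∀
  prodPow-skew (suc j) u v κ = begin
    u ^ κ zero * prodPow (skew j u v) (κ ∘ suc) * u ^ κ (suc j) ≡⟨ *-assoc (u ^ κ zero) _ _ ⟩
    u ^ κ zero * (prodPow (skew j u v) (κ ∘ suc) * u ^ κ (suc j)) ≡⟨ cong (u ^ κ zero *_) (prodPow-skew j u v (κ ∘ suc)) ⟩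
    u ^ κ zero * (v ^ κ (suc j) * u ^ sum (κ ∘ suc)) ≡⟨ e (u ^ κ zero) (v ^ κ (suc j)) (u ^ sum (κ ∘ suc)) ⟩
    v ^ κ (suc j) * (u ^ κ zero * u ^ sum (κ ∘ suc)) ≡⟨ cong (v ^ κ (suc j) *_) (^-distribˡ-+-* u (κ zero) _) ⟨
    v ^ κ (suc j) * u ^ sum κ ∎
    where
    open ≡-Reasoning
    e : ∀ a b c → a * (b * c) ≡ b * (a * c)
    e = solve-∀

  -- (1 + 1/RL)^R (1 - 1/L) ≥ 1 - 1/L², so over κ' rounds the skewing loses only 2^x₂, while it gains 2^y
  -- from the d surplus factors 1 + 1/RL.
  skew-gain : ∀ R N κ' d x₂ y → 0 < R → 0 < N → κ' ≤ N * N * x₂ → R * (2 * N) * y ≤ d →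
    2 ^ y * (R * (2 * N)) ^ (suc R * κ' + d) ≤
    2 ^ x₂ * (suc (R * (2 * N)) ^ (R * κ' + d) * (R * (2 * N) ∸ R) ^ κ')
  skew-gain R N κ' d x₂ y R>0 N>0 κ'≤ d≥ = begin
    2 ^ y * M ^ (suc R * κ' + d) ≡⟨ cong (2 ^ y *_) (^-distribˡ-+-* M (suc R * κ') d) ⟩
    2 ^ y * (M ^ (suc R * κ') * M ^ d) ≡⟨ e₁ (2 ^ y) (M ^ (suc R * κ')) (M ^ d) ⟩
    M ^ (suc R * κ') * (2 ^ y * M ^ d) ≤⟨ *-mono-≤ rounds (pow-lower y d M>0 d≥) ⟩
    2 ^ x₂ * (suc M ^ R * v) ^ κ' * suc M ^ d ≡⟨ cong (λ z → 2 ^ x₂ * z * suc M ^ d)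
                                                              (trans (^-*-distrib (suc M ^ R) v κ') (cong (_* v ^ κ') (^-*-assoc (suc M) R κ'))) ⟩
    2 ^ x₂ * (suc M ^ (R * κ') * v ^ κ') * suc M ^ d ≡⟨ e₂ (2 ^ x₂) (suc M ^ (R * κ')) (v ^ κ') (suc M ^ d) ⟩
    2 ^ x₂ * (suc M ^ (R * κ') * suc M ^ d * v ^ κ') ≡⟨ cong (λ z → 2 ^ x₂ * (z * v ^ κ')) (^-distribˡ-+-* (suc M) (R * κ') d) ⟨
    2 ^ x₂ * (suc M ^ (R * κ' + d) * v ^ κ') ∎
    where
    open ≤-Reasoning
    L M v V : ℕ
    L = 2 * N
    M = R * L
    v = M ∸ R
    V = L * L ∸ 1
    L>0 : 0 < L
    L>0 = *-mono-≤ {1} {2} {1} (s≤s z≤n) N>0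
    M>0 : 0 < M
    M>0 = *-mono-≤ R>0 L>0
    e₁ : ∀ a b c → a * (b * c) ≡ b * (a * c)
    e₁ = solve-∀
    e₂ : ∀ a b c d → a * (b * c) * d ≡ a * (b * d * c)
    e₂ = solve-∀
    V+1 : suc V ≡ L * L
    V+1 = m+[n∸m]≡n {1} (*-mono-≤ L>0 L>0)
    v≡ : v ≡ R * (L ∸ 1)
    v≡ = trans (cong (M ∸_) (sym (*-identityʳ R))) (sym (*-distribˡ-∸ R L 1))
    2NN≤V : 2 * (N * N) ≤ V
    2NN≤V = ≤-pred (subst (suc (2 * (N * N)) ≤_) (sym V+1) (begin
      suc (2 * (N * N)) ≤⟨ +-monoˡ-≤ (2 * (N * N)) {1} (*-mono-≤ {1} {2} {1} (s≤s z≤n) (*-mono-≤ N>0 N>0)) ⟩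
      2 * (N * N) + 2 * (N * N) ≡⟨ e₃ N ⟩
      L * L ∎))
      where
      e₃ : ∀ N → 2 * (N * N) + 2 * (N * N) ≡ 2 * N * (2 * N)
      e₃ = solve-∀
    V≢0 : ℕ.NonZero V
    V≢0 = ℕ.>-nonZero (≤-trans (*-mono-≤ {1} {2} {1} (s≤s z≤n) (*-mono-≤ N>0 N>0)) 2NN≤V)
    V-factor : (L ∸ 1) * (L + 1) ≡ V
    V-factor = suc-injective (trans (go L L>0) (sym V+1))
      where
      go : ∀ L → 0 < L → suc ((L ∸ 1) * (L + 1)) ≡ L * L
      go (suc l) _ = e₄ l
        where
        e₄ : ∀ l → suc (l * (suc l + 1)) ≡ suc l * suc l
        e₄ = solve-∀
    one-round : M ^ suc R * V ≤ suc M ^ R * v * suc V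
    one-round = *-cancelˡ-≤ M {{ℕ.>-nonZero M>0}} (begin
      M * (M ^ suc R * V) ≡⟨ cong (λ z → M * (M ^ suc R * z)) (sym V-factor) ⟩
      M * (M * M ^ R * ((L ∸ 1) * (L + 1))) ≡⟨ e₅ R L (L ∸ 1) (M ^ R) ⟩
      L * L * (R * (L ∸ 1)) * ((M + R) * M ^ R) ≡⟨ cong (λ z → L * L * z * ((M + R) * M ^ R)) v≡ ⟨
      L * L * v * ((M + R) * M ^ R) ≤⟨ *-monoʳ-≤ (L * L * v) (bernoulli M R) ⟩
      L * L * v * (suc M ^ R * M) ≡⟨ e₆ (L * L) v (suc M ^ R) M ⟩
      M * (suc M ^ R * v * (L * L)) ≡⟨ cong (λ z → M * (suc M ^ R * v * z)) V+1 ⟨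
      M * (suc M ^ R * v * suc V) ∎)
      where
      e₅ : ∀ R L l p → R * L * (R * L * p * (l * (L + 1))) ≡ L * L * (R * l) * ((R * L + R) * p)
      e₅ = solve-∀
      e₆ : ∀ a v p M → a * v * (p * M) ≡ M * (p * v * a)
      e₆ = solve-∀
    rounds : M ^ (suc R * κ') ≤ 2 ^ x₂ * (suc M ^ R * v) ^ κ'
    rounds = *-cancelʳ-≤ _ _ (V ^ κ') {{m^n≢0 V κ' {{V≢0}}}} (begin
      M ^ (suc R * κ') * V ^ κ' ≡⟨ cong (_* V ^ κ') (^-*-assoc M (suc R) κ') ⟨
      (M ^ suc R) ^ κ' * V ^ κ' ≡⟨ ^-*-distrib (M ^ suc R) V κ' ⟨
      (M ^ suc R * V) ^ κ' ≤⟨ ^-monoˡ-≤ κ' one-round ⟩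
      (suc M ^ R * v * suc V) ^ κ' ≡⟨ ^-*-distrib (suc M ^ R * v) (suc V) κ' ⟩
      (suc M ^ R * v) ^ κ' * suc V ^ κ' ≤⟨ *-monoʳ-≤ ((suc M ^ R * v) ^ κ') (pow-upper (N * N) x₂ κ' 2NN≤V κ'≤) ⟩
      (suc M ^ R * v) ^ κ' * (2 ^ x₂ * V ^ κ') ≡⟨ e₇ ((suc M ^ R * v) ^ κ') (2 ^ x₂) (V ^ κ') ⟩
      2 ^ x₂ * (suc M ^ R * v) ^ κ' * V ^ κ' ∎)
      where
      e₇ : ∀ a b c → a * (b * c) ≡ b * a * c
      e₇ = solve-∀

-- Balancing, book and skewed Erdős-Szekeres put together.

module Combination where

  open import Defs
  open Book
  open Cliques
  open Counting
  open DensityProfile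
  open ErdosSzekeres
  open PowerBounds
  open Powers
  open RationalOrder
  open BalancedColourings
  open import Data.Bool using (true)
  open import Data.Fin using (Fin; suc; _≟_)
  open import Data.Nat as ℕ using (ℕ; suc; _+_; _*_; _∸_; _^_; _≤_; _<_; z≤n; s≤s)
  open import Data.Nat.Properties hiding (_≟_)
  open import Data.Nat.Tactic.RingSolver using (solve-∀)
  open import Data.Product using (_×_; proj₁; proj₂)
  import Data.Rational as ℚ
  import Data.Rational.Properties as ℚ
  open import Data.Vec.Functional using (updateAt)
  open import Data.Vec.Functional.Properties using (updateAt-updates; updateAt-minimal)
  open import Function using (const)
  open import Relation.Binary.PropositionalEquality
  open import Relation.Nullary using (yes; no)

  -- The number of boosts is bounded by s with s · 4^i₀ ≤ H; all losses, measured in bits, must stay below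
  -- the y bits gained from the skewed Erdős–Szekeres bound inside the book.
  module Combine (R k e i₀ m t G₀ ℓ N₁ x₁ x₂ y Λ B₀ n₀ : ℕ) where

    -- `Z'` is shaped to give Z / (Z' + 1) = 1 + 1/(2G). `S` is the number of balancing steps after
    -- which the gain (1 + 1/A)^S reaches 2^(Λ+1).
    r G Z' Z A S H : ℕ
    r  = suc R
    G  = suc G₀
    Z' = 3 + 4 * G₀
    Z  = 3 + Z'
    A  = 2 * r * Z
    S  = A * suc Λ
    H  = 2 * (6 * (r * t)) * suc ℓ

    -- `room` is what leaves 2^B₀ vertices after balancing, `surplus` what the skewing feeds on, and
    -- in `n₀-size` the extra bit beyond `Λ` allows `n₀` to be a rounded-down quotient.
    record Hypotheses : Set where
      field
        R>0     : 0 < R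
        t>0     : 0 < t
        N₁>0    : 0 < N₁
        r≤2^e   : r ≤ 2 ^ e
        J-large : 3 * r * (r * Z * t) ≤ 4 ^ (m + i₀)
        J-small : 2 ^ i₀ * 2 ^ (m + i₀) ≤ 6 * (r * t)
        ℓ-large : r * Z ≤ 2 ^ ℓ
        budget  : 2 ^ i₀ * (suc r + 5 * r * 2 ^ i₀) * (r * t) + 9 * r * (r * H) ≤ 2 ^ i₀ * B₀
        room    : B₀ + S + suc Λ ≤ r * k
        n₀-size : r ^ (r * k) ≤ 2 ^ suc Λ * n₀
        S+t≤k   : S + t ≤ k
        n₀-large : A * r ^ S ≤ n₀
        surplus : R * (2 * N₁) * y + S ≤ R * t
        k≤      : k ≤ N₁ * N₁ * x₂
        losses  : ∀ s → s * 4 ^ i₀ ≤ H → (t + s ≤ G * x₁) × (e * s + x₁ + x₂ + suc Λ < y)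

    module _ (hyp : Hypotheses) (c : Colouring r n₀) where
      open Hypotheses hyp

      E : EdgeColouring n₀ r
      E = edgeColouring c

      open EdgeColouring E using (N)

      Goal : Set
      Goal = HasMonoClique k c

      2≤r : 2 ≤ r
      2≤r = s≤s R>0

      open Balancing E Goal (2 + Z') (s≤s z≤n) hiding (A)

      initial : Stage n₀ k 0 (λ _ → k) (λ _ → true)
      initial = record
        { κ≤k   = λ _ → ≤-refl
        ; k≤κ+s = λ _ → m≤m+n k 0
        ; total = trans (+-identityʳ _) (sum-const r k)
        ; size  = ≤-reflexive (cong (_* 1) (sym (count-full n₀)))
        ; needs = λ i cl → clique⇒mono c cl
        }

      r^-cancel : ∀ {a b} s → r ^ s * a ≤ r ^ s * b → a ≤ b
      r^-cancel s = *-cancelˡ-≤ (r ^ s) {{m^n≢0 r s}}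

      -- The balancing steps alone have made up for the 2^(Λ+1) by which `n₀` may fall short of
      -- r^(rk), so the uniform bound finishes.
      long : ∀ {κ W} → Stage n₀ k S κ W → Goal
      long {κ} {W} st = erdős-szekeres E Goal 2≤r {r} (λ _ → 1) (≤-reflexive (trans (sum-const r 1) (*-identityʳ r)))
        (sum κ) κ W refl
        (subst (λ z → r ^ sum κ < suc (count W) * z) (sym (trans (prodPow-const 1 κ) (^-zeroˡ (sum κ))))
          (s≤s (≤-trans r^σ≤W (≤-reflexive (sym (*-identityʳ (count W)))))))
        needs
        where
        open Stage st
        open ≤-Reasoning
        A>0 : 0 < A
        A>0 = s≤s z≤n
        W-size : n₀ * 2 ^ suc Λ ≤ count W * r ^ S
        W-size = *-cancelʳ-≤ _ _ (A ^ S) {{m^n≢0 A S {{ℕ.>-nonZero A>0}}}} (begin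
          n₀ * 2 ^ suc Λ * A ^ S ≡⟨ *-assoc n₀ (2 ^ suc Λ) (A ^ S) ⟩
          n₀ * (2 ^ suc Λ * A ^ S) ≤⟨ *-monoʳ-≤ n₀ (pow-lower (suc Λ) S A>0 ≤-refl) ⟩
          n₀ * suc A ^ S ≤⟨ size ⟩
          count W * (r * A) ^ S ≡⟨ cong (count W *_) (^-*-distrib r A S) ⟩
          count W * (r ^ S * A ^ S) ≡⟨ *-assoc (count W) (r ^ S) (A ^ S) ⟨
          count W * r ^ S * A ^ S ∎)
        r^σ≤W : r ^ sum κ ≤ count W
        r^σ≤W = r^-cancel S (begin
          r ^ S * r ^ sum κ ≡⟨ *-comm (r ^ S) (r ^ sum κ) ⟩
          r ^ sum κ * r ^ S ≡⟨ ^-distribˡ-+-* r (sum κ) S ⟨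
          r ^ (sum κ + S) ≡⟨ cong (r ^_) total ⟩
          r ^ (r * k) ≤⟨ n₀-size ⟩
          2 ^ suc Λ * n₀ ≡⟨ *-comm (2 ^ suc Λ) n₀ ⟩
          n₀ * 2 ^ suc Λ ≤⟨ W-size ⟩
          count W * r ^ S ≡⟨ *-comm (count W) (r ^ S) ⟩
          r ^ S * count W ∎)

      module Even {s₁ κ W} (s₁≤S : s₁ ≤ S) (st : Stage n₀ k s₁ κ W) (balanced : Balanced W) where
        open Stage st

        w : ℕ
        w = count W

        W-size : r ^ (r * k) ≤ 2 ^ suc Λ * (w * r ^ s₁)
        W-size = ≤-trans n₀-size (*-monoʳ-≤ (2 ^ suc Λ) (size⇒large st))

        t≤κ : ∀ i → t ≤ κ i
        t≤κ i = +-cancelˡ-≤ S _ _ (begin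
          S + t ≤⟨ S+t≤k ⟩
          k ≤⟨ k≤κ+s i ⟩
          κ i + s₁ ≤⟨ +-monoʳ-≤ (κ i) s₁≤S ⟩
          κ i + S ≡⟨ +-comm (κ i) S ⟩
          S + κ i ∎)
          where open ≤-Reasoning

        2^B₀≤w : 2 ^ B₀ ≤ w
        2^B₀≤w = *-cancelʳ-≤ _ _ (r ^ S * 2 ^ suc Λ) {{m*n≢0 (r ^ S) (2 ^ suc Λ) {{m^n≢0 r S}} {{m^n≢0 2 (suc Λ)}}}} (begin
          2 ^ B₀ * (r ^ S * 2 ^ suc Λ) ≤⟨ *-mono-≤ (^-monoˡ-≤ B₀ 2≤r) (*-monoʳ-≤ (r ^ S) (^-monoˡ-≤ (suc Λ) 2≤r)) ⟩
          r ^ B₀ * (r ^ S * r ^ suc Λ) ≡⟨ *-assoc (r ^ B₀) (r ^ S) (r ^ suc Λ) ⟨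
          r ^ B₀ * r ^ S * r ^ suc Λ ≡⟨ cong (_* r ^ suc Λ) (^-distribˡ-+-* r B₀ S) ⟨
          r ^ (B₀ + S) * r ^ suc Λ ≡⟨ ^-distribˡ-+-* r (B₀ + S) (suc Λ) ⟨
          r ^ (B₀ + S + suc Λ) ≤⟨ ^-monoʳ-≤ r room ⟩
          r ^ (r * k) ≤⟨ W-size ⟩
          2 ^ suc Λ * (w * r ^ s₁) ≤⟨ *-monoʳ-≤ (2 ^ suc Λ) (*-monoʳ-≤ w (^-monoʳ-≤ r s₁≤S)) ⟩
          2 ^ suc Λ * (w * r ^ S) ≡⟨ swap (2 ^ suc Λ) w (r ^ S) ⟩
          w * (r ^ S * 2 ^ suc Λ) ∎)
          where
          open ≤-Reasoning
          swap : ∀ a b c → a * (b * c) ≡ b * (c * a)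
          swap = solve-∀

        w>0 : 0 < w
        w>0 = ≤-trans (m^n>0 2 B₀) 2^B₀≤w

        κ' : Fin r → ℕ
        κ' i = κ i ∸ t

        module BA = BookAlgorithm E Goal 2≤r i₀ m t Z' ℓ w W κ' t>0 w>0 J-large J-small ℓ-large
        module PR = Profile r t Z' BA.r>0 t>0

        start : ∀ i → BA.ColourState W i
        start i = record
          { Y = W ; Y⊆Y₀ = λ _ v∈ → v∈ ; a = t ; c = 0 ; h = 0 ; s = 0
          ; c+a≡t = refl
          ; h≤H   = z≤n
          ; s-few = z≤n
          ; size  = ≤-refl
          -- Balance was asked for with Z₀ = Z - 1, which is exactly the starting density (Z -
          -- 1)/(rZ) of the profile.
          ; dense = λ x∈W → *-cancelˡ (ι (r * Z)) (0<ι {r * Z} (s≤s z≤n)) (ℚ.≤-trans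
              (ℚ.≤-reflexive (trans (sym (ℚ.*-assoc (ι (r * Z)) (PR.p t 0) (ι w))) (trans (cong (ℚ._* ι w) PR.p-start) (sym (ι-* (2 + Z') w)))))
              (ℚ.≤-trans (ι-mono (balanced i x∈W)) (ℚ.≤-reflexive (ι-* (r * Z) _))))
          ; need  = λ cl → needs i (subst (λ z → Clique E i z W) (m+[n∸m]≡n (t≤κ i)) (clique-⊆ E (∪-least {S = W} (λ _ v∈ → v∈) (λ _ v∈ → v∈)) cl))
          }

        start-budget : BA.Budget B₀ start
        start-budget = subst (_≤ 2 ^ i₀ * B₀)
          (sym (cong₂ (λ a b → 2 ^ i₀ * (suc r + 5 * r * 2 ^ i₀) * a + 9 * r * b) (sum-const r t) (sum-const r H))) budget

        module InsideBook (j : Fin r) (Y : Subset n₀) (s : ℕ) (Y⊆W : Y ⊆ W) (s-few : s * 4 ^ i₀ ≤ H)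
          (Y-size : suc Z' ^ (t + s) * w ≤ (r * Z) ^ (t + s) * count Y) (need : Clique E j (κ' j) Y → Goal) where

          κ″ : Fin r → ℕ
          κ″ = updateAt κ j (const (κ' j))

          κ″j : κ″ j ≡ κ' j
          κ″j = updateAt-updates j κ

          -- Colour `j` needs `t` vertices fewer than before, so beyond `κ' j` full rounds of all
          -- colours there remain `d` steps, about R t, for the others. Giving them weight u/(rM),
          -- slightly above 1/r, and colour `j` the rest v/(rM) profits from these steps.
          σ q M u v d P : ℕ
          σ = sum κ″
          q = t + s
          M = R * (2 * N₁)
          u = suc M
          v = M ∸ R
          d = σ ∸ r * κ' j
          P = prodPow (skew j u v) κ″

          needs″ : Needs E Goal κ″ Y
          needs″ i cl with i ≟ j
          ... | yes refl = need (subst (λ z → Clique E i z Y) κ″j cl)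
          ... | no i≢j   = needs i (clique-⊆ E Y⊆W (subst (λ z → Clique E i z Y) (updateAt-minimal i j κ i≢j) cl))

          σ-total : σ + t + s₁ ≡ r * k
          σ-total = +-cancelʳ-≡ (κ' j) _ _ (begin
            σ + t + s₁ + κ' j ≡⟨ e₁ σ t s₁ (κ' j) ⟩
            σ + (t + κ' j) + s₁ ≡⟨ cong (λ z → σ + z + s₁) (m+[n∸m]≡n (t≤κ j)) ⟩
            σ + κ j + s₁ ≡⟨ cong (_+ s₁) (sum-updateAt κ j (const (κ' j))) ⟩
            sum κ + κ' j + s₁ ≡⟨ e₂ (sum κ) (κ' j) s₁ ⟩
            sum κ + s₁ + κ' j ≡⟨ cong (_+ κ' j) total ⟩
            r * k + κ' j ∎)
            where
            open ≡-Reasoning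
            e₁ : ∀ a b c d → a + b + c + d ≡ a + (b + d) + c
            e₁ = solve-∀
            e₂ : ∀ a b c → a + b + c ≡ a + c + b
            e₂ = solve-∀

          σ-large : r * κ' j + R * t ≤ σ + s₁
          σ-large = +-cancelʳ-≤ t _ _ (begin
            r * κ' j + R * t + t ≡⟨ e₁ R (κ' j) t ⟩
            r * (t + κ' j) ≡⟨ cong (r *_) (m+[n∸m]≡n (t≤κ j)) ⟩
            r * κ j ≤⟨ *-monoʳ-≤ r (κ≤k j) ⟩
            r * k ≡⟨ σ-total ⟨
            σ + t + s₁ ≡⟨ e₂ σ t s₁ ⟩
            σ + s₁ + t ∎)
            where
            open ≤-Reasoning
            e₁ : ∀ R a t → suc R * a + R * t + t ≡ suc R * (t + a)
            e₁ = solve-∀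
            e₂ : ∀ a b c → a + b + c ≡ a + c + b
            e₂ = solve-∀

          rκ'≤σ : r * κ' j ≤ σ
          rκ'≤σ = +-cancelʳ-≤ s₁ _ _ (≤-trans (+-monoʳ-≤ (r * κ' j)
            (≤-trans s₁≤S (≤-trans (m≤n+m S (R * (2 * N₁) * y)) surplus))) σ-large)

          σ≡ : r * κ' j + d ≡ σ
          σ≡ = m+[n∸m]≡n rκ'≤σ

          d-large : R * (2 * N₁) * y ≤ d
          d-large = +-cancelʳ-≤ s₁ _ _ (+-cancelˡ-≤ (r * κ' j) _ _ (begin
            r * κ' j + (R * (2 * N₁) * y + s₁) ≤⟨ +-monoʳ-≤ (r * κ' j) (≤-trans (+-monoʳ-≤ (R * (2 * N₁) * y) s₁≤S) surplus) ⟩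
            r * κ' j + R * t ≤⟨ σ-large ⟩
            σ + s₁ ≡⟨ cong (_+ s₁) σ≡ ⟨
            r * κ' j + d + s₁ ≡⟨ +-assoc (r * κ' j) d s₁ ⟩
            r * κ' j + (d + s₁) ∎))
            where open ≤-Reasoning

          P≡ : P ≡ u ^ (R * κ' j + d) * v ^ κ' j
          P≡ = *-cancelʳ-≡ _ _ (u ^ κ' j) {{m^n≢0 u (κ' j)}} (begin
            P * u ^ κ' j ≡⟨ cong (λ z → P * u ^ z) κ″j ⟨
            P * u ^ κ″ j ≡⟨ prodPow-skew j u v κ″ ⟩
            v ^ κ″ j * u ^ σ ≡⟨ cong₂ (λ a b → v ^ a * u ^ b) κ″j (sym σ≡) ⟩
            v ^ κ' j * u ^ (κ' j + R * κ' j + d) ≡⟨ cong (λ z → v ^ κ' j * u ^ z) (e₁ (κ' j) (R * κ' j) d) ⟩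
            v ^ κ' j * u ^ (R * κ' j + d + κ' j) ≡⟨ cong (v ^ κ' j *_) (^-distribˡ-+-* u (R * κ' j + d) (κ' j)) ⟩
            v ^ κ' j * (u ^ (R * κ' j + d) * u ^ κ' j) ≡⟨ e₂ (v ^ κ' j) (u ^ (R * κ' j + d)) (u ^ κ' j) ⟩
            u ^ (R * κ' j + d) * v ^ κ' j * u ^ κ' j ∎)
            where
            open ≡-Reasoning
            e₁ : ∀ a b c → a + b + c ≡ b + c + a
            e₁ = solve-∀
            e₂ : ∀ a b c → a * (b * c) ≡ b * a * c
            e₂ = solve-∀

          P-large : 2 ^ y * M ^ σ ≤ 2 ^ x₂ * P
          P-large = subst₂ (λ a b → 2 ^ y * M ^ a ≤ 2 ^ x₂ * b) σ≡ (sym P≡)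
            (skew-gain R N₁ (κ' j) d x₂ y R>0 N₁>0 (≤-trans (m∸n≤m (κ j) t) (≤-trans (κ≤k j) k≤)) d-large)

          Z^-bound : Z ^ q ≤ 2 ^ x₁ * suc Z' ^ q
          Z^-bound = begin
            Z ^ q ≡⟨ cong (_^ q) (e₁ G₀) ⟩
            (2 * suc (2 * G)) ^ q ≡⟨ ^-*-distrib 2 (suc (2 * G)) q ⟩
            2 ^ q * suc (2 * G) ^ q ≤⟨ *-monoʳ-≤ (2 ^ q) (pow-upper G x₁ q ≤-refl (proj₁ (losses s s-few))) ⟩
            2 ^ q * (2 ^ x₁ * (2 * G) ^ q) ≡⟨ swap (2 ^ q) (2 ^ x₁) ((2 * G) ^ q) ⟩
            2 ^ x₁ * (2 ^ q * (2 * G) ^ q) ≡⟨ cong (2 ^ x₁ *_) (^-*-distrib 2 (2 * G) q) ⟨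
            2 ^ x₁ * (2 * (2 * G)) ^ q ≡⟨ cong (λ z → 2 ^ x₁ * z ^ q) (e₂ G₀) ⟨
            2 ^ x₁ * suc Z' ^ q ∎
            where
            open ≤-Reasoning
            e₁ : ∀ g → 6 + 4 * g ≡ 2 * suc (2 * suc g)
            e₁ = solve-∀
            e₂ : ∀ g → 4 + 4 * g ≡ 2 * (2 * suc g)
            e₂ = solve-∀
            swap : ∀ a b c → a * (b * c) ≡ b * (a * c)
            swap = solve-∀

          weights≤ : sum (skew j u v) ≤ r * M
          weights≤ = ≤-reflexive (trans (sum-skew j u v) (trans (cong (v +_) (*-suc R M))
            (trans (sym (+-assoc v R (R * M))) (cong (_+ R * M) (m∸n+n≡m R≤M)))))
            where
            R≤M : R ≤ M
            R≤M = m≤m*n R (2 * N₁) {{m*n≢0 2 N₁ {{_}} {{ℕ.>-nonZero N₁>0}}}}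

          M>0 : 0 < M
          M>0 = *-mono-≤ R>0 (*-mono-≤ {1} {2} {1} (s≤s z≤n) N₁>0)

          X : ℕ
          X = r ^ s₁ * 2 ^ suc Λ * (r * Z) ^ q * 2 ^ x₂

          -- The factors r^(rk) match, and 2^y beats the losses: r^s ≤ 2^(es) from the boosts, 2^x₁
          -- from densities below 1/r, 2^x₂ from the skewing, and 2^(Λ+1) from the size of `n₀`.
          book-large : (r * M) ^ σ < suc (count Y) * P
          book-large = <-≤-trans (*-cancelʳ-< X ((r * M) ^ σ) (count Y * P) (begin-strict
            (r * M) ^ σ * X
              ≡⟨ cong₂ (λ a b → a * (r ^ s₁ * 2 ^ suc Λ * b * 2 ^ x₂)) (^-*-distrib r M σ) (trans (^-*-distrib r Z q) (cong (_* Z ^ q) (^-distribˡ-+-* r t s))) ⟩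
            r ^ σ * M ^ σ * (r ^ s₁ * 2 ^ suc Λ * (r ^ t * r ^ s * Z ^ q) * 2 ^ x₂)
              ≡⟨ e₁ (r ^ σ) (M ^ σ) (r ^ s₁) (2 ^ suc Λ) (r ^ t) (r ^ s) (Z ^ q) (2 ^ x₂) ⟩
            r ^ σ * r ^ t * r ^ s₁ * M ^ σ * (r ^ s * Z ^ q * 2 ^ x₂ * 2 ^ suc Λ)
              ≡⟨ cong (λ z → z * M ^ σ * (r ^ s * Z ^ q * 2 ^ x₂ * 2 ^ suc Λ)) r^rk ⟩
            r ^ (r * k) * M ^ σ * (r ^ s * Z ^ q * 2 ^ x₂ * 2 ^ suc Λ)
              ≤⟨ *-monoʳ-≤ (r ^ (r * k) * M ^ σ) (*-monoˡ-≤ (2 ^ suc Λ) (*-monoˡ-≤ (2 ^ x₂) (*-mono-≤ r^s≤ Z^-bound))) ⟩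
            r ^ (r * k) * M ^ σ * (2 ^ (e * s) * (2 ^ x₁ * suc Z' ^ q) * 2 ^ x₂ * 2 ^ suc Λ)
              ≡⟨ e₂ (r ^ (r * k)) (M ^ σ) (2 ^ (e * s)) (2 ^ x₁) (suc Z' ^ q) (2 ^ x₂) (2 ^ suc Λ) ⟩
            r ^ (r * k) * (M ^ σ * suc Z' ^ q) * (2 ^ (e * s) * 2 ^ x₁ * 2 ^ x₂ * 2 ^ suc Λ)
              ≡⟨ cong (r ^ (r * k) * (M ^ σ * suc Z' ^ q) *_) 2^-sum ⟩
            r ^ (r * k) * (M ^ σ * suc Z' ^ q) * 2 ^ (e * s + x₁ + x₂ + suc Λ)
              <⟨ *-monoʳ-< _ {{m*n≢0 (r ^ (r * k)) _ {{m^n≢0 r (r * k)}} {{m*n≢0 (M ^ σ) _ {{m^n≢0 M σ {{ℕ.>-nonZero M>0}}}} {{m^n≢0 (suc Z') q}}}}}}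
                   (^-monoʳ-< 2 (s≤s (s≤s z≤n)) (proj₂ (losses s s-few))) ⟩
            r ^ (r * k) * (M ^ σ * suc Z' ^ q) * 2 ^ y
              ≡⟨ e₃ (r ^ (r * k)) (M ^ σ) (suc Z' ^ q) (2 ^ y) ⟩
            r ^ (r * k) * suc Z' ^ q * (2 ^ y * M ^ σ)
              ≤⟨ *-mono-≤ (*-monoˡ-≤ (suc Z' ^ q) W-size) P-large ⟩
            2 ^ suc Λ * (w * r ^ s₁) * suc Z' ^ q * (2 ^ x₂ * P)
              ≡⟨ e₄ (2 ^ suc Λ) w (r ^ s₁) (suc Z' ^ q) (2 ^ x₂) P ⟩
            suc Z' ^ q * w * (P * (r ^ s₁ * 2 ^ suc Λ * 2 ^ x₂))
              ≤⟨ *-monoˡ-≤ (P * (r ^ s₁ * 2 ^ suc Λ * 2 ^ x₂)) Y-size ⟩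
            (r * Z) ^ q * count Y * (P * (r ^ s₁ * 2 ^ suc Λ * 2 ^ x₂))
              ≡⟨ e₅ ((r * Z) ^ q) (count Y) P (r ^ s₁) (2 ^ suc Λ) (2 ^ x₂) ⟩
            count Y * P * X ∎)) (*-monoˡ-≤ P (n≤1+n (count Y)))
            where
            open ≤-Reasoning
            e₁ : ∀ a b c d f g h i → a * b * (c * d * (f * g * h) * i) ≡ a * f * c * b * (g * h * i * d)
            e₁ = solve-∀
            e₂ : ∀ a b c d f g h → a * b * (c * (d * f) * g * h) ≡ a * (b * f) * (c * d * g * h)
            e₂ = solve-∀
            e₃ : ∀ a b c d → a * (b * c) * d ≡ a * c * (d * b)
            e₃ = solve-∀
            e₄ : ∀ a b c d f g → a * (b * c) * d * (f * g) ≡ d * b * (g * (c * a * f))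
            e₄ = solve-∀
            e₅ : ∀ a b c d f g → a * b * (c * (d * f * g)) ≡ b * c * (d * f * a * g)
            e₅ = solve-∀
            r^rk : r ^ σ * r ^ t * r ^ s₁ ≡ r ^ (r * k)
            r^rk = trans (cong (_* r ^ s₁) (sym (^-distribˡ-+-* r σ t))) (trans (sym (^-distribˡ-+-* r (σ + t) s₁)) (cong (r ^_) σ-total))
            r^s≤ : r ^ s ≤ 2 ^ (e * s)
            r^s≤ = ≤-trans (^-monoˡ-≤ s r≤2^e) (≤-reflexive (^-*-assoc 2 e s))
            2^-sum : 2 ^ (e * s) * 2 ^ x₁ * 2 ^ x₂ * 2 ^ suc Λ ≡ 2 ^ (e * s + x₁ + x₂ + suc Λ)
            2^-sum = sym (trans (^-distribˡ-+-* 2 (e * s + x₁ + x₂) (suc Λ)) (cong (_* 2 ^ suc Λ)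
              (trans (^-distribˡ-+-* 2 (e * s + x₁) x₂) (cong (_* 2 ^ x₂) (^-distribˡ-+-* 2 (e * s) x₁)))))

          clique : Goal
          clique = erdős-szekeres E Goal 2≤r (skew j u v) weights≤ σ κ″ Y refl book-large needs″

        goal : Goal
        goal = BA.run InsideBook.clique B₀ B₀ W start ≤-refl 2^B₀≤w start-budget

      ramsey : Goal
      ramsey = balance S (≤-trans (m≤m+n S t) S+t≤k) n₀-large long (λ s₁≤S st bal → Even.goal s₁≤S st bal) S 0 (+-identityʳ S) initial

-- Choice of the parameters and verification of the inequalities.

module ParameterChoice where

  open Powers
  open import Defs using (RamseyProp)
  open Combination
  open import Data.Nat as ℕ using (ℕ; zero; suc; _+_; _*_; _∸_; _^_; _/_; _≤_; _<_; z≤n; s≤s; _≤?_)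
  open import Data.Nat.DivMod using (m≡m%n+[m/n]*n; m%n<n; m/n*n≤m)
  open import Data.Nat.Properties hiding (_≤?_)
  open import Data.Nat.Tactic.RingSolver using (solve-∀)
  open import Data.Product using (∃; _×_; _,_; proj₁; proj₂)
  open import Relation.Binary.PropositionalEquality hiding (J)
  open import Relation.Nullary using (yes; no; contradiction)

  dyadic : ∀ r → 0 < r → ∃ λ e → r ≤ 2 ^ e × 2 ^ e ≤ 2 * r
  dyadic (suc zero)    _ = 0 , ≤-refl , s≤s z≤n
  dyadic (suc (suc r)) _ with dyadic (suc r) (s≤s z≤n)
  ... | e , lo , hi with suc (suc r) ≤? 2 ^ e
  ...   | yes p = e , p , ≤-trans hi (*-monoʳ-≤ 2 (n≤1+n (suc r)))
  ...   | no ¬p = suc e , ≤-trans (s≤s lo) (≤-trans (+-monoˡ-≤ (2 ^ e) (m^n>0 2 e)) (≤-reflexive (cong (2 ^ e +_) (sym (+-identityʳ (2 ^ e)))))) ,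
      *-monoʳ-≤ 2 (<⇒≤ (≰⇒> ¬p))

  tetradic : ∀ x → 0 < x → ∃ λ J → x ≤ 4 ^ J × 4 ^ J ≤ 4 * x
  tetradic (suc zero)    _ = 0 , ≤-refl , s≤s z≤n
  tetradic (suc (suc x)) _ with tetradic (suc x) (s≤s z≤n)
  ... | J , lo , hi with suc (suc x) ≤? 4 ^ J
  ...   | yes p = J , p , ≤-trans hi (*-monoʳ-≤ 4 (n≤1+n (suc x)))
  ...   | no ¬p = suc J , ≤-trans (s≤s lo) (≤-trans (+-monoˡ-≤ (4 ^ J) (m^n>0 4 J)) (+-monoʳ-≤ (4 ^ J) (m≤m+n (4 ^ J) (4 ^ J + (4 ^ J + 0))))) ,
      *-monoʳ-≤ 4 (<⇒≤ (≰⇒> ¬p))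

  -- `e` stands for log r. Products of logarithms such as `e * suc ℓ` are thereby absorbed into a
  -- single factor `ρ`.
  e²≤2^[1+e] : ∀ e → e * e ≤ 2 * 2 ^ e
  e²≤2^[1+e] 0 = z≤n
  e²≤2^[1+e] 1 = ≤ᵇ⇒≤ 1 4 _
  e²≤2^[1+e] 2 = ≤ᵇ⇒≤ 4 8 _
  e²≤2^[1+e] 3 = ≤ᵇ⇒≤ 9 16 _
  e²≤2^[1+e] (suc (suc (suc (suc e)))) = go e
    where
    open ≤-Reasoning
    e₁ : ∀ e → (5 + e) * (5 + e) + (7 + 6 * e + e * e) ≡ 2 * ((4 + e) * (4 + e))
    e₁ = solve-∀
    go : ∀ e → (4 + e) * (4 + e) ≤ 2 * 2 ^ (4 + e)
    go zero    = ≤ᵇ⇒≤ 16 32 _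
    go (suc e) = begin
      (5 + e) * (5 + e) ≤⟨ m≤m+n _ (7 + 6 * e + e * e) ⟩
      _ ≡⟨ e₁ e ⟩
      2 * ((4 + e) * (4 + e)) ≤⟨ *-monoʳ-≤ 2 (go e) ⟩
      2 * (2 * 2 ^ (4 + e)) ∎

  square-cancel-≤ : ∀ {a b} → a * a ≤ b * b → a ≤ b
  square-cancel-≤ {a} {b} le with a ≤? b
  ... | yes a≤b = a≤b
  ... | no a≰b  = contradiction le (<⇒≱ (*-mono-< (≰⇒> a≰b) (≰⇒> a≰b)))

  quotient-bounds : ∀ k U .{{_ : ℕ.NonZero U}} → k < U + (k / U) * U
  quotient-bounds k U = subst (_< U + (k / U) * U) (sym (m≡m%n+[m/n]*n k U)) (+-monoˡ-< ((k / U) * U) (m%n<n k U))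

  module Parameters (R k e b D : ℕ) (R>0 : 0 < R)
    (r≤ρ : suc R ≤ 2 ^ e) (b≤30 : b ≤ 30) (β-large : 12 * 32 * 32 * 16 * 108 ≤ 2 ^ b) where

    -- μ = 2^b ρ³ solves `boosts-cheap`: there μ² must exceed e r N₁ ℓ, which is of order ρ³ μ. The
    -- number 12 · 32 · 32 · 16 · 108 collects the constants met on the way.
    r ρ μ i₀ : ℕ
    r  = suc R
    ρ  = 2 ^ e
    i₀ = b + 3 * e
    μ  = 2 ^ i₀

    -- Opaque, since unfolding would unroll products of numerals.
    opaque
      τ N₁ U : ℕ
      τ  = 16 * (ρ * μ)
      N₁ = 32 * τ
      U  = τ * (32 * N₁)

      τ≡ : τ ≡ 16 * (ρ * μ)
      τ≡ = refl

      N₁≡ : N₁ ≡ 32 * τ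
      N₁≡ = refl

      U≡ : U ≡ τ * (32 * N₁)
      U≡ = refl

    private
      μ>0 : 0 < μ
      μ>0 = m^n>0 2 i₀
      ρ>0 : 0 < ρ
      ρ>0 = m^n>0 2 e
      τ>0 : 0 < τ
      τ>0 = subst (0 <_) (sym τ≡) (*-mono-≤ {1} {16} {1} (s≤s z≤n) (*-mono-≤ ρ>0 μ>0))
      N₁>0 : 0 < N₁
      N₁>0 = subst (0 <_) (sym N₁≡) (*-mono-≤ {1} {32} {1} (s≤s z≤n) τ>0)

    U>0 : 0 < U
    U>0 = subst (0 <_) (sym U≡) (*-mono-≤ τ>0 (*-mono-≤ {1} {32} {1} (s≤s z≤n) N₁>0))

    private
      μ≡ : μ ≡ 2 ^ b * (ρ * (ρ * ρ))
      μ≡ = trans (^-distribˡ-+-* 2 b (3 * e)) (cong (2 ^ b *_) (trans (^-distribˡ-+-* 2 e (e + (e + 0)))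
        (cong (ρ *_) (trans (^-distribˡ-+-* 2 e (e + 0)) (cong (λ z → ρ * 2 ^ z) (+-identityʳ e))))))

      expand : ∀ a b₁ p m {x y z} → x ≡ a * (p * m) → y ≡ b₁ * x → z ≡ x * (b₁ * y) → z ≡ a * b₁ * (b₁ * a) * (p * p * (m * m))
      expand a b₁ p m refl refl refl = e₁ a b₁ p m
        where
        e₁ : ∀ a b p m → a * (p * m) * (b * (b * (a * (p * m)))) ≡ a * b * (b * a) * (p * p * (m * m))
        e₁ = solve-∀

      U-expanded : ∀ {c} → c ≡ 16 * 32 * (32 * 16) → U ≡ c * (ρ * ρ * (μ * μ))
      U-expanded refl = expand 16 32 ρ μ τ≡ N₁≡ U≡

    -- With μ = 2^b ρ³ the left side is a constant times ρ^14, and ρ ≤ 2r.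
    U≪k-from : ∀ {c C} → c ≡ 16 * 32 * (32 * 16) → ρ ≤ 2 * r → c * 4 * (2 ^ b) ^ 4 * 2 ^ 14 ≤ C → C * r ^ 16 ≤ k →
      U * (4 * (μ * μ)) ≤ k
    U≪k-from {c} {C} c≡ ρ≤2r C-large k-large = begin
      U * (4 * (μ * μ)) ≡⟨ cong (λ x → x * (4 * (μ * μ))) (U-expanded c≡) ⟩
      c * (ρ * ρ * (μ * μ)) * (4 * (μ * μ)) ≡⟨ e₁ c 4 ρ μ ⟩
      c * 4 * (ρ * ρ * (μ * μ * (μ * μ))) ≡⟨ cong (λ z → c * 4 * (ρ * ρ * (z * z * (z * z)))) {μ} {β³} μ≡ ⟩
      c * 4 * (ρ * ρ * (β³ * β³ * (β³ * β³))) ≡⟨ e₂ (c * 4) ρ (2 ^ b) ⟩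
      c * 4 * (2 ^ b) ^ 4 * ρ ^ 14 ≤⟨ *-monoʳ-≤ (c * 4 * (2 ^ b) ^ 4) (^-monoˡ-≤ 14 ρ≤2r) ⟩
      c * 4 * (2 ^ b) ^ 4 * (2 * r) ^ 14 ≡⟨ cong (c * 4 * (2 ^ b) ^ 4 *_) (^-*-distrib 2 r 14) ⟩
      c * 4 * (2 ^ b) ^ 4 * (2 ^ 14 * r ^ 14) ≡⟨ *-assoc (c * 4 * (2 ^ b) ^ 4) (2 ^ 14) (r ^ 14) ⟨
      c * 4 * (2 ^ b) ^ 4 * 2 ^ 14 * r ^ 14 ≤⟨ *-mono-≤ C-large (^-monoʳ-≤ r (m≤m+n 14 2)) ⟩
      C * r ^ 16 ≤⟨ k-large ⟩
      k ∎
      where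
      open ≤-Reasoning
      β³ = 2 ^ b * (ρ * (ρ * ρ))
      e₁ : ∀ c d p m → c * (p * p * (m * m)) * (d * (m * m)) ≡ c * d * (p * p * (m * m * (m * m)))
      e₁ = solve-∀
      e₂ : ∀ c p b → c * (p * p * (b * (p * (p * p)) * (b * (p * (p * p))) * (b * (p * (p * p)) * (b * (p * (p * p))))))
        ≡ c * (b * (b * (b * (b * 1)))) * (p * (p * (p * (p * (p * (p * (p * (p * (p * (p * (p * (p * (p * (p * 1))))))))))))))
      e₂ = solve-∀

    -- Here U is a constant times ρ^8, so the left side is of order r^9.
    U≪D-from : ∀ {c C} → c ≡ 16 * 32 * (32 * 16) → ρ ≤ 2 * r → 480 * c * (2 ^ b) ^ 2 * 2 ^ 8 ≤ C → C * r ^ 12 ≤ D →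
      480 * (r * U) ≤ D
    U≪D-from {c} {C} c≡ ρ≤2r C-large D-large = begin
      480 * (r * U) ≡⟨ cong (λ x → 480 * (r * x)) (U-expanded c≡) ⟩
      480 * (r * (c * (ρ * ρ * (μ * μ)))) ≡⟨ cong (λ z → 480 * (r * (c * (ρ * ρ * (z * z))))) {μ} {β³} μ≡ ⟩
      480 * (r * (c * (ρ * ρ * (β³ * β³)))) ≡⟨ e₂ 480 c r ρ (2 ^ b) ⟩
      480 * c * (2 ^ b) ^ 2 * (ρ ^ 8 * r) ≤⟨ *-monoʳ-≤ (480 * c * (2 ^ b) ^ 2) (*-monoˡ-≤ r (^-monoˡ-≤ 8 ρ≤2r)) ⟩
      480 * c * (2 ^ b) ^ 2 * ((2 * r) ^ 8 * r) ≡⟨ cong (λ z → 480 * c * (2 ^ b) ^ 2 * (z * r)) (^-*-distrib 2 r 8) ⟩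
      480 * c * (2 ^ b) ^ 2 * (2 ^ 8 * r ^ 8 * r) ≡⟨ e₃ (480 * c * (2 ^ b) ^ 2) (2 ^ 8) r ⟩
      480 * c * (2 ^ b) ^ 2 * 2 ^ 8 * r ^ 9 ≤⟨ *-mono-≤ C-large (^-monoʳ-≤ r (m≤m+n 9 3)) ⟩
      C * r ^ 12 ≤⟨ D-large ⟩
      D ∎
      where
      open ≤-Reasoning
      β³ = 2 ^ b * (ρ * (ρ * ρ))
      e₂ : ∀ d c r p b → d * (r * (c * (p * p * (b * (p * (p * p)) * (b * (p * (p * p))))))) ≡ d * c * (b * (b * 1)) * ((p * (p * (p * (p * (p * (p * (p * (p * 1)))))))) * r)
      e₂ = solve-∀
      e₃ : ∀ a c r → a * (c * (r * (r * (r * (r * (r * (r * (r * (r * 1)))))))) * r) ≡ a * c * (r * (r * (r * (r * (r * (r * (r * (r * (r * 1)))))))))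
      e₃ = solve-∀

    -- `w` is the unit in which bits are counted. As U = 1024 τ², t is about k/τ and `w` about
    -- t²/(1024 k). The size of `τ` comes from 2 B₀ ≤ r k, that of `G₀` from t + s ≤ 64 N₁ w, and
    -- `ℓ` from rZ ≤ 320 · 32 · 16 · ρ² μ. The 7 in `B₀` is 6 for colour steps and 1 for boosts.
    w t G₀ ℓ B₀ : ℕ
    w  = (k / U) {{ℕ.>-nonZero U>0}}
    t  = 32 * N₁ * w
    G₀ = ℕ.pred (64 * N₁)
    ℓ  = 18 + b + 5 * e
    B₀ = 7 * (r * r * (μ * t))

    module Chosen (D>0 : 0 < D) (D≤k : D ≤ k) (U≪k : U * (4 * (μ * μ)) ≤ k) (U≪D : 480 * (r * U) ≤ D) where

      -- δk ≤ X₀, so e^{δk} ≤ 4^X₀ = 2^Λ.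
      X₀ Λ : ℕ
      X₀ = suc ((k / D) {{ℕ.>-nonZero D>0}})
      Λ  = 2 * X₀

      n₀ : ℕ
      n₀ = (r ^ (r * k) / 2 ^ Λ) {{m^n≢0 2 Λ}}

      open Combine R k e i₀ 0 t G₀ ℓ N₁ w (2 * w) (8 * w) Λ B₀ n₀ using (Z; A; S; H)

      private
        open ≤-Reasoning

        instance
          U≢0 : ℕ.NonZero U
          U≢0 = ℕ.>-nonZero U>0
          D≢0 : ℕ.NonZero D
          D≢0 = ℕ.>-nonZero D>0

        e>0 : 0 < e
        e>0 = n≢0⇒n>0 λ e≡0 → <⇒≱ (s≤s R>0) (subst (λ z → r ≤ 2 ^ z) e≡0 r≤ρ)

        4μ²≤w : 4 * (μ * μ) ≤ w
        4μ²≤w = ≤-pred (*-cancelʳ-< U _ _ (begin-strict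
          4 * (μ * μ) * U ≡⟨ *-comm (4 * (μ * μ)) U ⟩
          U * (4 * (μ * μ)) ≤⟨ U≪k ⟩
          k <⟨ quotient-bounds k U ⟩
          suc w * U ∎))

        w>0 : 0 < w
        w>0 = ≤-trans (*-mono-≤ {1} {4} {1} (s≤s z≤n) (*-mono-≤ μ>0 μ>0)) 4μ²≤w

        Uw≤k : U * w ≤ k
        Uw≤k = ≤-trans (≤-reflexive (*-comm U w)) (m/n*n≤m k U)

        k≤2Uw : k ≤ 2 * (U * w)
        k≤2Uw = begin
          k ≤⟨ <⇒≤ (quotient-bounds k U) ⟩
          U + w * U ≤⟨ +-monoˡ-≤ (w * U) (m≤n*m U w {{ℕ.>-nonZero w>0}}) ⟩
          w * U + w * U ≡⟨ e₁ w U ⟩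
          2 * (U * w) ∎
          where
          e₁ : ∀ w U → w * U + w * U ≡ 2 * (U * w)
          e₁ = solve-∀

        τt≤k : τ * t ≤ k
        τt≤k = ≤-trans (≤-reflexive (trans (sym (*-assoc τ (32 * N₁) w)) (cong (_* w) (sym U≡)))) Uw≤k

        sucG₀ : suc G₀ ≡ 64 * N₁
        sucG₀ = suc-pred (64 * N₁) {{m*n≢0 64 N₁ {{_}} {{ℕ.>-nonZero N₁>0}}}}

        Z≤ : Z ≤ 320 * N₁
        Z≤ = begin
          6 + 4 * G₀ ≡⟨ e₁ G₀ ⟩
          2 + 4 * suc G₀ ≡⟨ cong (λ z → 2 + 4 * z) sucG₀ ⟩
          2 + 4 * (64 * N₁) ≤⟨ +-monoˡ-≤ (4 * (64 * N₁)) (*-mono-≤ {2} {64} {1} (s≤s (s≤s z≤n)) N₁>0) ⟩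
          64 * N₁ + 4 * (64 * N₁) ≡⟨ e₂ N₁ ⟩
          320 * N₁ ∎
          where
          e₁ : ∀ g → 6 + 4 * g ≡ 2 + 4 * suc g
          e₁ = solve-∀
          e₂ : ∀ n → 64 * n + 4 * (64 * n) ≡ 320 * n
          e₂ = solve-∀

        ρ⁵ : 2 ^ (5 * e) ≡ ρ * (ρ * (ρ * (ρ * ρ)))
        ρ⁵ = trans (cong (2 ^_) (*-comm 5 e)) (trans (sym (^-*-assoc 2 e 5))
          (cong (λ z → ρ * (ρ * (ρ * (ρ * z)))) (*-identityʳ ρ)))

        ℓ-large : r * Z ≤ 2 ^ ℓ
        ℓ-large = begin
          r * Z ≤⟨ *-mono-≤ r≤ρ Z≤ ⟩
          ρ * (320 * N₁) ≡⟨ cong (λ z → ρ * (320 * z)) (trans N₁≡ (cong (32 *_) τ≡)) ⟩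
          ρ * (320 * (32 * (16 * (ρ * μ)))) ≡⟨ e₁ 320 32 16 ρ μ ⟩
          320 * 32 * 16 * (ρ * ρ * μ) ≤⟨ *-monoˡ-≤ (ρ * ρ * μ) {320 * 32 * 16} {2 ^ 18} (≤ᵇ⇒≤ 163840 262144 _) ⟩
          2 ^ 18 * (ρ * ρ * μ) ≡⟨ cong (λ z → 2 ^ 18 * (ρ * ρ * z)) μ≡ ⟩
          2 ^ 18 * (ρ * ρ * (2 ^ b * (ρ * (ρ * ρ)))) ≡⟨ e₂ (2 ^ 18) (2 ^ b) ρ ⟩
          2 ^ 18 * 2 ^ b * (ρ * (ρ * (ρ * (ρ * ρ)))) ≡⟨ cong₂ _*_ (sym (^-distribˡ-+-* 2 18 b)) (sym ρ⁵) ⟩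
          2 ^ (18 + b) * 2 ^ (5 * e) ≡⟨ ^-distribˡ-+-* 2 (18 + b) (5 * e) ⟨
          2 ^ ℓ ∎
          where
          e₁ : ∀ c d f p m → p * (c * (d * (f * (p * m)))) ≡ c * d * f * (p * p * m)
          e₁ = solve-∀
          e₂ : ∀ c b p → c * (p * p * (b * (p * (p * p)))) ≡ c * b * (p * (p * (p * (p * p))))
          e₂ = solve-∀

        e·sucℓ≤ : e * suc ℓ ≤ 108 * ρ
        e·sucℓ≤ = begin
          e * (19 + b + 5 * e) ≤⟨ *-monoʳ-≤ e (+-monoˡ-≤ (5 * e) (+-monoʳ-≤ 19 b≤30)) ⟩
          e * (49 + 5 * e) ≤⟨ *-monoʳ-≤ e (+-monoˡ-≤ (5 * e) (*-monoʳ-≤ 49 {1} e>0)) ⟩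
          e * (49 * e + 5 * e) ≡⟨ e₁ e ⟩
          54 * (e * e) ≤⟨ *-monoʳ-≤ 54 (e²≤2^[1+e] e) ⟩
          54 * (2 * ρ) ≡⟨ *-assoc 54 2 ρ ⟨
          108 * ρ ∎
          where
          e₁ : ∀ e → e * (49 * e + 5 * e) ≡ 54 * (e * e)
          e₁ = solve-∀

        -- Multiplied by `w` this reads e H ≤ w μ². With s 4^i₀ ≤ H and 4^i₀ = μ², the boosts cost
        -- at most `w` bits.
        boosts-cheap : e * (12 * r * (32 * N₁) * suc ℓ) ≤ μ * μ
        boosts-cheap = begin
          e * (12 * r * (32 * N₁) * suc ℓ) ≡⟨ cong (λ z → e * (12 * r * (32 * z) * suc ℓ)) (trans N₁≡ (cong (32 *_) τ≡)) ⟩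
          e * (12 * r * (32 * (32 * (16 * (ρ * μ)))) * suc ℓ) ≡⟨ e₁ 12 32 16 e r ρ μ (suc ℓ) ⟩
          12 * 32 * 32 * 16 * (e * suc ℓ) * (r * ρ) * μ ≤⟨ *-monoˡ-≤ μ (*-mono-≤ (*-monoʳ-≤ (12 * 32 * 32 * 16) e·sucℓ≤) (*-monoˡ-≤ ρ r≤ρ)) ⟩
          12 * 32 * 32 * 16 * (108 * ρ) * (ρ * ρ) * μ ≡⟨ cong (λ z → z * (ρ * ρ) * μ) (*-assoc (12 * 32 * 32 * 16) 108 ρ) ⟨
          12 * 32 * 32 * 16 * 108 * ρ * (ρ * ρ) * μ ≤⟨ *-monoˡ-≤ μ (*-monoˡ-≤ (ρ * ρ) (*-monoˡ-≤ ρ β-large)) ⟩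
          2 ^ b * ρ * (ρ * ρ) * μ ≡⟨ cong (_* μ) (trans (*-assoc (2 ^ b) ρ (ρ * ρ)) (sym μ≡)) ⟩
          μ * μ ∎
          where
          e₁ : ∀ c d f e r p m l → e * (c * r * (d * (d * (f * (p * m)))) * l) ≡ c * d * d * f * (e * l) * (r * p) * m
          e₁ = solve-∀

        108r≤μ² : 108 * (r * suc ℓ) ≤ μ * μ
        108r≤μ² = begin
          108 * (r * suc ℓ) ≤⟨ *-monoˡ-≤ (r * suc ℓ) {108} {384} (≤ᵇ⇒≤ 108 384 _) ⟩
          384 * (r * suc ℓ) ≤⟨ *-mono-≤ (m≤m*n 384 N₁ {{ℕ.>-nonZero N₁>0}}) (≤-refl {r * suc ℓ}) ⟩
          384 * N₁ * (r * suc ℓ) ≡⟨ e₁ N₁ r (suc ℓ) ⟩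
          12 * r * (32 * N₁) * suc ℓ ≤⟨ m≤n*m _ e {{ℕ.>-nonZero e>0}} ⟩
          e * (12 * r * (32 * N₁) * suc ℓ) ≤⟨ boosts-cheap ⟩
          μ * μ ∎
          where
          e₁ : ∀ n r l → 384 * n * (r * l) ≡ 12 * r * (32 * n) * l
          e₁ = solve-∀

        budget : μ * (suc r + 5 * r * μ) * (r * t) + 9 * r * (r * H) ≤ μ * B₀
        budget = begin
          μ * (suc r + 5 * r * μ) * (r * t) + 9 * r * (r * H)
            ≤⟨ +-monoˡ-≤ (9 * r * (r * H)) (*-monoˡ-≤ (r * t) (*-monoʳ-≤ μ (+-monoˡ-≤ (5 * r * μ) sucr≤))) ⟩
          μ * (r * μ + 5 * r * μ) * (r * t) + 9 * r * (r * H)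
            ≡⟨ e₁ μ r t (suc ℓ) ⟩
          6 * (μ * (r * μ) * (r * t)) + 108 * (r * suc ℓ) * (r * r * t)
            ≤⟨ +-monoʳ-≤ (6 * (μ * (r * μ) * (r * t))) (*-monoˡ-≤ (r * r * t) 108r≤μ²) ⟩
          6 * (μ * (r * μ) * (r * t)) + μ * μ * (r * r * t)
            ≡⟨ e₂ μ r t ⟩
          μ * B₀ ∎
          where
          2≤μ : 2 ≤ μ
          2≤μ = ≤-trans (^-monoʳ-≤ 2 {1} {i₀} (≤-trans e>0 (≤-trans (m≤n*m e 3) (m≤n+m (3 * e) b)))) ≤-refl
          sucr≤ : suc r ≤ r * μ
          sucr≤ = ≤-trans (s≤s (m≤m+n r R)) (≤-trans (≤-reflexive (e₃ R)) (*-monoʳ-≤ r 2≤μ))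
            where
            e₃ : ∀ R → suc (suc R + R) ≡ suc R * 2
            e₃ = solve-∀
          e₁ : ∀ m r t l → m * (r * m + 5 * r * m) * (r * t) + 9 * r * (r * (2 * (6 * (r * t)) * l))
                         ≡ 6 * (m * (r * m) * (r * t)) + 108 * (r * l) * (r * r * t)
          e₁ = solve-∀
          e₂ : ∀ m r t → 6 * (m * (r * m) * (r * t)) + m * m * (r * r * t) ≡ m * (7 * (r * r * (m * t)))
          e₂ = solve-∀

        -- 40 = 2 · 320 / 16 is what brings `S`, at most 2r · 320 N₁ · (Λ + 1), down to 16 N₁ w,
        -- half of `t`. This is the condition that fixes how small δ must be.
        40rΛ≤w : 40 * r * suc Λ ≤ w
        40rΛ≤w = *-cancelˡ-≤ D (begin
          D * (40 * r * suc Λ) ≤⟨ *-monoʳ-≤ D (*-monoʳ-≤ (40 * r) sucΛ≤) ⟩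
          D * (40 * r * (3 * X₀)) ≡⟨ e₁ D r X₀ ⟩
          120 * r * (X₀ * D) ≤⟨ *-monoʳ-≤ (120 * r) X₀D≤ ⟩
          120 * r * (k + k) ≤⟨ *-monoʳ-≤ (120 * r) (+-mono-≤ k≤2Uw k≤2Uw) ⟩
          120 * r * (2 * (U * w) + 2 * (U * w)) ≡⟨ e₂ r U w ⟩
          480 * (r * U) * w ≤⟨ *-monoˡ-≤ w U≪D ⟩
          D * w ∎)
          where
          sucΛ≤ : suc Λ ≤ 3 * X₀
          sucΛ≤ = +-monoˡ-≤ (2 * X₀) {1} {X₀} (s≤s z≤n)
          X₀D≤ : X₀ * D ≤ k + k
          X₀D≤ = +-mono-≤ D≤k (m/n*n≤m k D)
          e₁ : ∀ D r m → D * (40 * r * (3 * m)) ≡ 120 * r * (m * D)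
          e₁ = solve-∀
          e₂ : ∀ r U w → 120 * r * (2 * (U * w) + 2 * (U * w)) ≡ 480 * (r * U) * w
          e₂ = solve-∀

        sucΛ≤w : suc Λ ≤ w
        sucΛ≤w = ≤-trans (m≤n*m (suc Λ) (40 * r)) 40rΛ≤w

        S≤ : S ≤ 16 * N₁ * w
        S≤ = begin
          2 * r * Z * suc Λ ≤⟨ *-monoˡ-≤ (suc Λ) (*-monoʳ-≤ (2 * r) Z≤) ⟩
          2 * r * (320 * N₁) * suc Λ ≡⟨ e₁ r N₁ (suc Λ) ⟩
          16 * N₁ * (40 * r * suc Λ) ≤⟨ *-monoʳ-≤ (16 * N₁) 40rΛ≤w ⟩
          16 * N₁ * w ∎
          where
          e₁ : ∀ r n l → 2 * r * (320 * n) * l ≡ 16 * n * (40 * r * l)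
          e₁ = solve-∀

        w≤N₁w : w ≤ N₁ * w
        w≤N₁w = m≤n*m w N₁ {{ℕ.>-nonZero N₁>0}}

        2S≤t : S + S ≤ t
        2S≤t = ≤-trans (+-mono-≤ S≤ S≤) (≤-reflexive (e₁ N₁ w))
          where
          e₁ : ∀ n w → 16 * n * w + 16 * n * w ≡ 32 * n * w
          e₁ = solve-∀

        S+Λ≤t : S + suc Λ ≤ t
        S+Λ≤t = ≤-trans (+-mono-≤ S≤ (≤-trans sucΛ≤w (≤-trans w≤N₁w (m≤n*m (N₁ * w) 16)))) (≤-reflexive (e₁ N₁ w))
          where
          e₁ : ∀ n w → 16 * n * w + 16 * (n * w) ≡ 32 * n * w
          e₁ = solve-∀

        2t≤k : t + t ≤ k
        2t≤k = ≤-trans (≤-reflexive (cong (t +_) (sym (+-identityʳ t)))) (≤-trans (*-monoˡ-≤ t {2} {τ} 2≤τ) τt≤k)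
          where
          2≤τ : 2 ≤ τ
          2≤τ = subst (2 ≤_) (sym τ≡) (*-mono-≤ {2} {16} {1} (s≤s (s≤s z≤n)) (*-mono-≤ ρ>0 μ>0))

        k≤rk : k ≤ r * k
        k≤rk = m≤n*m k r

        S≤t : S ≤ t
        S≤t = ≤-trans (m≤m+n S S) 2S≤t

        room : B₀ + S + suc Λ ≤ r * k
        room = *-cancelˡ-≤ 2 (begin
          2 * (B₀ + S + suc Λ) ≡⟨ e₁ B₀ S (suc Λ) ⟩
          2 * B₀ + ((S + suc Λ) + (S + suc Λ)) ≤⟨ +-mono-≤ 2B₀≤ (≤-trans (+-mono-≤ S+Λ≤t S+Λ≤t) (≤-trans 2t≤k k≤rk)) ⟩
          r * k + r * k ≡⟨ cong (r * k +_) (+-identityʳ (r * k)) ⟨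
          2 * (r * k) ∎)
          where
          e₁ : ∀ a b c → 2 * (a + b + c) ≡ 2 * a + ((b + c) + (b + c))
          e₁ = solve-∀
          e₂ : ∀ r m t → 2 * (7 * (r * r * (m * t))) ≡ r * (14 * (r * m) * t)
          e₂ = solve-∀
          2B₀≤ : 2 * B₀ ≤ r * k
          2B₀≤ = begin
            2 * B₀ ≡⟨ e₂ r μ t ⟩
            r * (14 * (r * μ) * t) ≤⟨ *-monoʳ-≤ r (*-monoˡ-≤ t (≤-trans (*-mono-≤ {14} {16} (≤ᵇ⇒≤ 14 16 _) (*-monoˡ-≤ μ r≤ρ)) (≤-reflexive (sym τ≡)))) ⟩
            r * (τ * t) ≤⟨ *-monoʳ-≤ r τt≤k ⟩
            r * k ∎

        2^Λ≤ : 2 ^ Λ ≤ r ^ (r * k)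
        2^Λ≤ = ≤-trans (^-monoˡ-≤ Λ {2} {r} (s≤s R>0)) (^-monoʳ-≤ r
          (≤-trans (n≤1+n Λ) (≤-trans (m≤n+m (suc Λ) (B₀ + S)) room)))

        n₀-size : r ^ (r * k) ≤ 2 ^ suc Λ * n₀
        n₀-size = begin
          r ^ (r * k) ≤⟨ <⇒≤ (quotient-bounds (r ^ (r * k)) (2 ^ Λ)) ⟩
          2 ^ Λ + n₀ * 2 ^ Λ ≤⟨ +-monoˡ-≤ (n₀ * 2 ^ Λ) (m≤n*m (2 ^ Λ) n₀ {{ℕ.>-nonZero n₀>0}}) ⟩
          n₀ * 2 ^ Λ + n₀ * 2 ^ Λ ≡⟨ e₁ n₀ (2 ^ Λ) ⟩
          2 ^ suc Λ * n₀ ∎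
          where
          instance
            2^Λ≢0 : ℕ.NonZero (2 ^ Λ)
            2^Λ≢0 = m^n≢0 2 Λ
          e₁ : ∀ n p → n * p + n * p ≡ 2 * p * n
          e₁ = solve-∀
          n₀>0 : 0 < n₀
          n₀>0 = *-cancelʳ-< (2 ^ Λ) 0 n₀ (+-cancelˡ-< (2 ^ Λ) 0 (n₀ * 2 ^ Λ)
            (≤-<-trans (≤-trans (≤-reflexive (+-identityʳ (2 ^ Λ))) 2^Λ≤) (quotient-bounds (r ^ (r * k)) (2 ^ Λ))))

        m<r^m : ∀ m → m ≤ r ^ m
        m<r^m m = ≤-trans (<⇒≤ (m<2^m m)) (^-monoˡ-≤ m (s≤s R>0))

        n₀-large : A * r ^ S ≤ n₀
        n₀-large = *-cancelˡ-≤ (2 ^ suc Λ) {{m^n≢0 2 (suc Λ)}} (begin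
          2 ^ suc Λ * (A * r ^ S) ≤⟨ *-mono-≤ (^-monoˡ-≤ (suc Λ) {2} {r} (s≤s R>0)) (*-monoˡ-≤ (r ^ S) (≤-trans (m≤m*n A (suc Λ)) (m<r^m S))) ⟩
          r ^ suc Λ * (r ^ S * r ^ S) ≡⟨ cong (r ^ suc Λ *_) (^-distribˡ-+-* r S S) ⟨
          r ^ suc Λ * r ^ (S + S) ≡⟨ ^-distribˡ-+-* r (suc Λ) (S + S) ⟨
          r ^ (suc Λ + (S + S)) ≤⟨ ^-monoʳ-≤ r (≤-trans (+-mono-≤ (≤-trans (m≤n+m (suc Λ) S) S+Λ≤t) 2S≤t) (≤-trans 2t≤k k≤rk)) ⟩
          r ^ (r * k) ≤⟨ n₀-size ⟩
          2 ^ suc Λ * n₀ ∎)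

        surplus : R * (2 * N₁) * (8 * w) + S ≤ R * t
        surplus = begin
          R * (2 * N₁) * (8 * w) + S ≤⟨ +-monoʳ-≤ (R * (2 * N₁) * (8 * w)) (≤-trans S≤ (m≤n*m (16 * N₁ * w) R {{ℕ.>-nonZero R>0}})) ⟩
          R * (2 * N₁) * (8 * w) + R * (16 * N₁ * w) ≡⟨ e₁ R N₁ w ⟩
          R * t ∎
          where
          e₁ : ∀ R n w → R * (2 * n) * (8 * w) + R * (16 * n * w) ≡ R * (32 * n * w)
          e₁ = solve-∀

        k≤ : k ≤ N₁ * N₁ * (2 * w)
        k≤ = ≤-trans k≤2Uw (≤-reflexive (trans (cong (λ z → 2 * (z * w)) U≡) (trans (e₁ 32 τ N₁ w)
               (cong (λ z → z * N₁ * (2 * w)) (sym N₁≡)))))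
          where
          e₁ : ∀ c x n w → 2 * (x * (c * n) * w) ≡ c * x * n * (2 * w)
          e₁ = solve-∀

        4^i₀ : 4 ^ i₀ ≡ μ * μ
        4^i₀ = 4^≡2^*2^ i₀

        -- Boosts, densities and Λ take `w` bits each and the skewing takes 2w: 5w against a gain of
        -- 8w.
        losses : ∀ s → s * 4 ^ i₀ ≤ H → (t + s ≤ suc G₀ * w) × (e * s + w + 2 * w + suc Λ < 8 * w)
        losses s s-few = total-steps , (begin-strict
          e * s + w + 2 * w + suc Λ ≤⟨ +-mono-≤ (+-monoˡ-≤ (2 * w) (+-monoˡ-≤ w es≤w)) sucΛ≤w ⟩
          w + w + 2 * w + w ≡⟨ e₁ w ⟩
          5 * w <⟨ *-monoˡ-< w {{ℕ.>-nonZero w>0}} (≤ᵇ⇒≤ 6 8 _) ⟩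
          8 * w ∎)
          where
          e₁ : ∀ w → w + w + 2 * w + w ≡ 5 * w
          e₁ = solve-∀
          es≤w : e * s ≤ w
          es≤w = *-cancelʳ-≤ (e * s) w (μ * μ) {{m*n≢0 μ μ {{m^n≢0 2 i₀}} {{m^n≢0 2 i₀}}}} (begin
            e * s * (μ * μ) ≡⟨ cong (e * s *_) 4^i₀ ⟨
            e * s * 4 ^ i₀ ≡⟨ *-assoc e s (4 ^ i₀) ⟩
            e * (s * 4 ^ i₀) ≤⟨ *-monoʳ-≤ e s-few ⟩
            e * (2 * (6 * (r * (32 * N₁ * w))) * suc ℓ) ≡⟨ e₂ e r N₁ w (suc ℓ) ⟩
            w * (e * (12 * r * (32 * N₁) * suc ℓ)) ≤⟨ *-monoʳ-≤ w boosts-cheap ⟩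
            w * (μ * μ) ∎)
            where
            e₂ : ∀ e r n w l → e * (2 * (6 * (r * (32 * n * w))) * l) ≡ w * (e * (12 * r * (32 * n) * l))
            e₂ = solve-∀
          total-steps : t + s ≤ suc G₀ * w
          total-steps = begin
            t + s ≤⟨ +-monoʳ-≤ t (≤-trans (m≤n*m s e {{ℕ.>-nonZero e>0}}) (≤-trans es≤w (≤-trans w≤N₁w (m≤n*m (N₁ * w) 32)))) ⟩
            32 * N₁ * w + 32 * (N₁ * w) ≡⟨ e₃ N₁ w ⟩
            64 * N₁ * w ≡⟨ cong (_* w) sucG₀ ⟨
            suc G₀ * w ∎
            where
            e₃ : ∀ n w → 32 * n * w + 32 * (n * w) ≡ 64 * n * w
            e₃ = solve-∀

        t>0 : 0 < t
        t>0 = *-mono-≤ (*-mono-≤ {1} {32} {1} (s≤s z≤n) N₁>0) w>0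

        X : ℕ
        X = 3 * r * (r * Z * t)

        X≥t : t ≤ X
        X≥t = ≤-trans (m≤n*m t (r * Z)) (m≤n*m (r * Z * t) (3 * r))

        J-choice : ∃ λ J → X ≤ 4 ^ J × 4 ^ J ≤ 4 * X
        J-choice = tetradic X (≤-trans t>0 X≥t)

        J : ℕ
        J = proj₁ J-choice

        i₀≤J : i₀ ≤ J
        i₀≤J = ≮⇒≥ λ J<i₀ → <⇒≱ (^-monoʳ-< 4 (s≤s (s≤s z≤n)) J<i₀) (begin
          4 ^ i₀ ≡⟨ 4^i₀ ⟩
          μ * μ ≤⟨ ≤-trans (m≤n*m (μ * μ) 4) 4μ²≤w ⟩
          w ≤⟨ ≤-trans w≤N₁w (≤-trans (m≤n*m (N₁ * w) 32) (≤-reflexive (sym (*-assoc 32 N₁ w)))) ⟩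
          t ≤⟨ X≥t ⟩
          X ≤⟨ proj₁ (proj₂ J-choice) ⟩
          4 ^ J ∎)

        -- Compared after squaring, as `J` is chosen through 4^J. Both sides then contain r² t, and
        -- 4 μ² ≤ w, hence a lower bound on `k`, decides the rest.
        J-small : μ * 2 ^ J ≤ 6 * (r * t)
        J-small = square-cancel-≤ (begin
          μ * 2 ^ J * (μ * 2 ^ J) ≡⟨ e₁ μ (2 ^ J) ⟩
          μ * μ * (2 ^ J * 2 ^ J) ≡⟨ cong (μ * μ *_) (4^≡2^*2^ J) ⟨
          μ * μ * 4 ^ J ≤⟨ *-monoʳ-≤ (μ * μ) (proj₂ (proj₂ J-choice)) ⟩
          μ * μ * (4 * (3 * r * (r * Z * t))) ≡⟨ e₂ (μ * μ) r Z t ⟩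
          12 * (r * r * t) * (μ * μ * Z) ≤⟨ *-monoʳ-≤ (12 * (r * r * t)) (*-monoʳ-≤ (μ * μ) Z≤) ⟩
          12 * (r * r * t) * (μ * μ * (320 * N₁)) ≡⟨ e₃ (r * r * t) (μ * μ) N₁ ⟩
          12 * (r * r * t) * (80 * N₁ * (4 * (μ * μ))) ≤⟨ *-monoʳ-≤ (12 * (r * r * t)) (*-mono-≤ (*-monoˡ-≤ N₁ {80} {96} (≤ᵇ⇒≤ 80 96 _)) 4μ²≤w) ⟩
          12 * (r * r * t) * (96 * N₁ * w) ≡⟨ e₄ r N₁ w ⟩
          6 * (r * t) * (6 * (r * t)) ∎)
          where
          e₁ : ∀ m x → m * x * (m * x) ≡ m * m * (x * x)
          e₁ = solve-∀
          e₂ : ∀ m r z t → m * (4 * (3 * r * (r * z * t))) ≡ 12 * (r * r * t) * (m * z)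
          e₂ = solve-∀
          e₃ : ∀ a m n → 12 * a * (m * (320 * n)) ≡ 12 * a * (80 * n * (4 * m))
          e₃ = solve-∀
          e₄ : ∀ r n w → 12 * (r * r * (32 * n * w)) * (96 * n * w) ≡ 6 * (r * (32 * n * w)) * (6 * (r * (32 * n * w)))
          e₄ = solve-∀

        m : ℕ
        m = J ∸ i₀

        m+i₀ : m + i₀ ≡ J
        m+i₀ = m∸n+n≡m i₀≤J

      k≤X₀D : k ≤ X₀ * D
      k≤X₀D = <⇒≤ (quotient-bounds k D)

      n₀·2^Λ≤ : n₀ * 2 ^ Λ ≤ r ^ (r * k)
      n₀·2^Λ≤ = m/n*n≤m (r ^ (r * k)) (2 ^ Λ) {{m^n≢0 2 Λ}}

      hypotheses : Combine.Hypotheses R k e i₀ m t G₀ ℓ N₁ w (2 * w) (8 * w) Λ B₀ n₀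
      hypotheses = record
        { R>0      = R>0
        ; t>0      = t>0
        ; N₁>0     = N₁>0
        ; r≤2^e    = r≤ρ
        ; J-large  = subst (λ z → X ≤ 4 ^ z) (sym m+i₀) (proj₁ (proj₂ J-choice))
        ; J-small  = subst (λ z → μ * 2 ^ z ≤ 6 * (r * t)) (sym m+i₀) J-small
        ; ℓ-large  = ℓ-large
        ; budget   = budget
        ; room     = room
        ; n₀-size  = n₀-size
        ; S+t≤k    = ≤-trans (+-monoˡ-≤ t S≤t) 2t≤k
        ; n₀-large = n₀-large
        ; surplus  = surplus
        ; k≤       = k≤
        ; losses   = losses
        }

  -- `C` plays the part of 2^160 and serves both as the constant in δ and as that in the lower bound
  -- on `k`. The closed numerical inequalities are the only conditions on `b`, `c` and `C`.
  ramsey-threshold : ∀ C R k e b c → 0 < R → suc R ≤ 2 ^ e → 2 ^ e ≤ 2 * suc R → b ≤ 30 →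
    12 * 32 * 32 * 16 * 108 ≤ 2 ^ b → c ≡ 16 * 32 * (32 * 16) →
    c * 4 * (2 ^ b) ^ 4 * 2 ^ 14 ≤ C → 480 * c * (2 ^ b) ^ 2 * 2 ^ 8 ≤ C → 0 < C → C * suc R ^ 16 ≤ k →
    ∃ λ X₀ → ∃ λ n₀ → k ≤ X₀ * (C * suc R ^ 12) × n₀ * 2 ^ (2 * X₀) ≤ suc R ^ (suc R * k) × RamseyProp (suc R) k n₀
  ramsey-threshold C R k e b c R>0 r≤ρ ρ≤2r b≤30 β-large c≡ C-large₁ C-large₂ C>0 k-large =
    X₀ , n₀ , k≤X₀D , n₀·2^Λ≤ , Combine.ramsey R k e i₀ _ t G₀ ℓ N₁ w (2 * w) (8 * w) Λ B₀ n₀ hypotheses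
    where
    D : ℕ
    D = C * suc R ^ 12
    open Parameters R k e b D R>0 r≤ρ b≤30 β-large
    open Chosen (*-mono-≤ C>0 (m^n>0 (suc R) 12))
      (≤-trans (*-monoʳ-≤ C (^-monoʳ-≤ (suc R) {12} {16} (m≤m+n 12 4))) k-large)
      (U≪k-from c≡ ρ≤2r C-large₁ k-large) (U≪D-from c≡ ρ≤2r C-large₂ ≤-refl)

-- The theorem with its numerical constants.

open import Defs
open import Data.Nat using (ℕ; _≤_; _*_; _^_)
open import Data.Integer using (+_)
open import Data.Rational using (_/_)
open import Data.Product using (Σ; _×_)
import Data.Rational as Q

open import Data.Nat using (suc; s≤s; z≤n)
import Data.Nat.Properties as ℕ
open import Data.Product using (_,_; ∃)
import Data.Rational.Properties as Q
open import Data.Unit using (tt)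
open import Relation.Binary.PropositionalEquality using (refl; sym; subst₂)
open Exponential using (expPartial≤4^; δk≥0; δk≤)
open ParameterChoice using (dyadic; ramsey-threshold)
open RationalOrder using (ι; ι-def; ι-*; ι-mono; 0≤ι; *-monoˡ)

theorem5p1 : (r : ℕ) → (hr : 2 ≤ r) → (k : ℕ) → 2 ^ 160 * r ^ 16 ≤ k →
    Σ ℕ λ n → RamseyProp r k n
    × (∀ (N : ℕ) → (+ n / 1) Q.* expPartial (δk r k hr) N Q.≤ (+ (r ^ (r * k)) / 1))
theorem5p1 r@(suc R) hr@(s≤s R>0) k k-large = choose (dyadic r (s≤s z≤n))
  where
  -- Bounding every partial sum by r^(rk) / n bounds their supremum e^(δk).
  Bound : ℕ → Set
  Bound n = ∀ N → (+ n / 1) Q.* expPartial (δk (suc R) k hr) N Q.≤ (+ (suc R ^ (suc R * k)) / 1)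
  conclude : (∃ λ X₀ → ∃ λ n → k ≤ X₀ * (2 ^ 160 * suc R ^ 12) × n * 2 ^ (2 * X₀) ≤ suc R ^ (suc R * k) × RamseyProp (suc R) k n) →
    Σ ℕ λ n → RamseyProp (suc R) k n × Bound n
  conclude (X₀ , n , k≤ , n≤ , ramsey) = n , ramsey , λ N →
    subst₂ (λ x y → x Q.* expPartial (δk (suc R) k hr) N Q.≤ y) (ι-def n) (ι-def (suc R ^ (suc R * k)))
      (Q.≤-trans (*-monoˡ (ι n) (0≤ι n) (expPartial≤4^ (δk (suc R) k hr) (δk≥0 (suc R) k hr) X₀ (δk≤ (suc R) k hr X₀ k≤) N))
        (Q.≤-trans (Q.≤-reflexive (sym (ι-* n (2 ^ (2 * X₀))))) (ι-mono n≤)))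
  choose : (∃ λ e → suc R ≤ 2 ^ e × 2 ^ e ≤ 2 * suc R) → Σ ℕ λ n → RamseyProp (suc R) k n × Bound n
  -- With b = 30, the condition on 2^b has room, since 12 · 32 · 32 · 16 · 108 < 2^25. As c = 2^18,
  -- the two conditions on 2^160 ask for 2^154 and for less than 2^95.
  choose (e , lo , hi) = conclude (ramsey-threshold (2 ^ 160) R k e 30 (16 * 32 * (32 * 16)) R>0 lo hi ℕ.≤-refl
    (ℕ.≤ᵇ⇒≤ (12 * 32 * 32 * 16 * 108) (2 ^ 30) tt) refl
    (ℕ.≤ᵇ⇒≤ (16 * 32 * (32 * 16) * 4 * (2 ^ 30) ^ 4 * 2 ^ 14) (2 ^ 160) tt)
    (ℕ.≤ᵇ⇒≤ (480 * (16 * 32 * (32 * 16)) * (2 ^ 30) ^ 2 * 2 ^ 8) (2 ^ 160) tt) (ℕ.m^n>0 2 160) k-large)
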